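{- Let $p>2$, let $w\ge0$ be an even integer, and let $\mu$ be a $p$-core which is either empty or a square $(j^j)$ with $j\ge1$. Then there exists a JS-partition $\lambda$ fixed under the Mullineux map with $p$-weight $w$ and $p$-core $\lambda_{(p)}=\mu$, except in the case $w=2$ and $\mu=\left(\left(\tfrac{p-1}{2}\right)^{\frac{p-1}{2}}\right)$, in which no such partition exists.
   Context: Fix an integer $p\ge 2$. A partition is written $\lambda=(l_1^{a_1},\dots,l_t^{a_t})$ with $l_1>\dots>l_t>0$, $a_i\ge1$; $(j^j)$ is the partition with $j$ parts equal to $j$. It is $p$-regular if all $a_i\le p-1$. A $p$-regular $\lambda$ is a JS-partition if $l_i-l_{i+1}+a_i+a_{i+1}\equiv 0\pmod p$ for $1\le i<t$. The $p$-core $\lambda_{(p)}$ is obtained by repeatedly removing rim hooks of length $p$ until none remains; a $p$-core is a partition equal to its own $p$-core; the $p$-weight is $(|\lambda|-|\lambda_{(p)}|)/p$. Mullineux symbol: the rim of $\lambda$ is the set of nodes $(i,j)$ of the Young diagram with $(i+1,j+1)$ not in it, ordered from the end of the first row to the start of the last row. The $p$-rim is the union of $p$-segments: the first consists of the first $p$ nodes of the rim (or all of it), each next one consists of the first $p$ (or all remaining) rim nodes starting at the last node of the row just below the lowest row of the previous segment, until the last row is reached. Let $a_1$ = size of the $p$-rim of $\lambda^{(1)}=\lambda$, $r_1$ = its number of parts; removing the $p$-rim gives $\lambda^{(2)}$; iterate until $\lambda^{(m+1)}=\emptyset$, defining $a_j,r_j$ for $\lambda^{(j)}$. The Mullineux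 symbol $G_p(\lambda)=\begin{pmatrix}a_1&\cdots&a_m\\ r_1&\cdots&r_m\end{pmatrix}$ determines $\lambda$. The Mullineux map sends $\lambda$ to the $p$-regular partition $\lambda^M$ with Mullineux symbol $\begin{pmatrix}a_1&\cdots&a_m\\ s_1&\cdots&s_m\end{pmatrix}$, $s_j=a_j-r_j+\varepsilon_j$, where $\varepsilon_j=0$ if $p\mid a_j$ and $\varepsilon_j=1$ otherwise; $\lambda$ is fixed if $\lambda^M=\lambda$. -}

module Defs where

open import Data.Nat using (ℕ; zero; suc; _+_; _*_; _∸_; _≤_; _<_; _≥_; _≟_; _≤ᵇ_)
open import Data.Nat.Divisibility using (_∣_)
open import Data.Nat.ListAction using (sum)
open import Data.List using (List; []; _∷_; length; map; _++_; take; drop; replicate; downFrom; filter; dropWhile; reverse)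
open import Data.List.Relation.Unary.All using (All)
open import Data.List.Relation.Unary.Linked using (Linked)
open import Data.List.Membership.Propositional using (_∈_)
open import Data.Product using (Σ; _×_; _,_; proj₁; proj₂)
open import Data.Bool using (Bool; true; false; if_then_else_)
open import Relation.Nullary using (¬_; does)
open import Relation.Binary.PropositionalEquality using (_≡_)
open import Relation.Binary.Construct.Closure.ReflexiveTransitive using (Star)
open import Relation.Unary using (Decidable)

Partition : Set
Partition = List ℕ

IsPartition : Partition → Set
IsPartition la = Linked _≥_ la × All (λ x → 0 < x) la

size : Partition → ℕ
size = sum

part : Partition → ℕ → ℕ
part [] _ = 0
part (x ∷ xs) zero = x
part (x ∷ xs) (suc i) = part xs i

square : ℕ → Partition
square j = replicate j j

runs : List ℕ → List (ℕ × ℕ)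
runs [] = []
runs (x ∷ xs) with runs xs
... | [] = (x , 1) ∷ []
... | (y , k) ∷ rest = if does (x ≟ y) then (x , suc k) ∷ rest else (x , 1) ∷ (y , k) ∷ rest

IsPRegular : ℕ → Partition → Set
IsPRegular p la = IsPartition la × All (λ r → suc (proj₂ r) ≤ p) (runs la)

-- JS condition on consecutive (lᵢ,aᵢ),(lᵢ₊₁,aᵢ₊₁): p ∣ lᵢ - lᵢ₊₁ + aᵢ + aᵢ₊₁   (lᵢ > lᵢ₊₁)
JSPair : ℕ → ℕ × ℕ → ℕ × ℕ → Set
JSPair p (l , a) (l' , a') = p ∣ ((l ∸ l') + a + a')

IsJS : ℕ → Partition → Set
IsJS p la = IsPRegular p la × Linked (JSPair p) (runs la)

-- The rim: nodes (i , j) (row i, column j, 0-indexed) with (i+1 , j+1) ∉ λ,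
-- ordered from the end of the first row to the start of the last row.

Node : Set
Node = ℕ × ℕ

private
  headOr0 : List ℕ → ℕ
  headOr0 [] = 0
  headOr0 (y ∷ _) = y

  colsDown : ℕ → ℕ → List ℕ
  colsDown x lo = map (lo +_) (downFrom (x ∸ lo))

rimFrom : ℕ → Partition → List Node
rimFrom i [] = []
rimFrom i (x ∷ xs) = map (λ c → (i , c)) (colsDown x (headOr0 xs ∸ 1)) ++ rimFrom (suc i) xs

rim : Partition → List Node
rim = rimFrom 0

RemoveHook : ℕ → Partition → Partition → Set
RemoveHook p la nu =
  IsPartition nu ×
  Σ ℕ (λ k → (k + p ≤ length (rim la)) ×
    ((i j : ℕ) →
      ((j < part nu i) → (j < part la i) × ¬ ((i , j) ∈ take p (drop k (rim la)))) ×
      ((j < part la i) × ¬ ((i , j) ∈ take p (drop k (rim la))) → j < part nu i)))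

IsPCore : ℕ → Partition → Set
IsPCore p mu = IsPartition mu × ((nu : Partition) → ¬ RemoveHook p mu nu)

HasPCore : ℕ → Partition → Partition → Set
HasPCore p la mu = Star (RemoveHook p) la mu × IsPCore p mu

HasPWeight : ℕ → Partition → Partition → ℕ → Set
HasPWeight p la mu w = size la ≡ size mu + p * w

private
  lastNode : List Node → Node → Node
  lastNode [] d = d
  lastNode (n ∷ []) d = n
  lastNode (n ∷ m ∷ ns) d = lastNode (m ∷ ns) d

-- fuel, p, index of the last row, remaining rim (starting at the start of a segment)
pRimSegs : ℕ → ℕ → ℕ → List Node → List Node
pRimSegs zero p L rs = []
pRimSegs (suc fuel) p L rs with take p rs
... | [] = []
... | seg@(n ∷ _) =
  let r = proj₁ (lastNode seg n) in
  if L ≤ᵇ r then seg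
  else seg ++ pRimSegs fuel p L (dropWhile (λ m → proj₁ m Data.Nat.≤? r) rs)

pRim : ℕ → Partition → List Node
pRim p la = pRimSegs (length (rim la)) p (length la ∸ 1) (rim la)

-- remove a set of nodes (right-aligned in each row) from the diagram
private
  countRow : ℕ → List Node → ℕ
  countRow i ns = length (filter (λ m → proj₁ m ≟ i) ns)

  removeFrom : ℕ → List Node → Partition → Partition
  removeFrom i ns [] = []
  removeFrom i ns (x ∷ xs) = (x ∸ countRow i ns) ∷ removeFrom (suc i) ns xs

removeNodes : List Node → Partition → Partition
removeNodes ns la = filter (λ x → 1 Data.Nat.≤? x) (removeFrom 0 ns la)

mullSymFuel : ℕ → ℕ → Partition → List (ℕ × ℕ)
mullSymFuel fuel p [] = []
mullSymFuel zero p (x ∷ xs) = []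
mullSymFuel (suc fuel) p la@(x ∷ xs) =
  (length (pRim p la) , length la) ∷ mullSymFuel fuel p (removeNodes (pRim p la) la)

mullineuxSymbol : ℕ → Partition → List (ℕ × ℕ)
mullineuxSymbol p la = mullSymFuel (suc (size la)) p la

eps : ℕ → ℕ → ℕ
eps p a = if does (Data.Nat.Divisibility._∣?_ p a) then 0 else 1

mullCol : ℕ → ℕ × ℕ → ℕ × ℕ
mullCol p (a , r) = (a , (a + eps p a) ∸ r)

IsMullineuxImage : ℕ → Partition → Partition → Set
IsMullineuxImage p la nu =
  IsPRegular p nu × mullineuxSymbol p nu ≡ map (mullCol p) (mullineuxSymbol p la)

IsMullineuxFixed : ℕ → Partition → Set
IsMullineuxFixed p la = IsPRegular p la × IsMullineuxImage p la la

GoodPartition : ℕ → ℕ → Partition → Partition → Set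
GoodPartition p w mu la =
  IsPartition la × IsJS p la × IsMullineuxFixed p la × HasPCore p la mu × HasPWeight p la mu w

Exceptional : ℕ → ℕ → Partition → Set
Exceptional p w mu = (w ≡ 2) × Σ ℕ (λ j → (2 * j + 1 ≡ p) × (mu ≡ square j))

{-# OPTIONS --safe #-}

-- Existence, for w = 2k. A row of length kp + 1 is put on top of a partition ν of
-- j² + kp - 1. If k > j, then ν is the most balanced partition of kp - 1 into p - 1 parts,
-- followed by the square (j^j); if k ≤ j, then ν = ((j+2)^j, k^m, (k-1)^n). The first
-- p-segment of the p-rim lies in the top row, the second one runs through the upper part
-- of ν, and a rim of 2j - 1 nodes remains (none if j = 0). Hence removing the p-rim leads
-- from (k, j) to (k - 1, j - 1), and each column (a, r) of the symbol has 2r = a + ε. The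
-- family fails for k = 1 and 2j ≥ p - 1: for p = 2j there is ((p+2)^2, (j+2)^(j-2)), and
-- p = 2j + 1 is the exception.
--
-- Non-existence, for p = 2j + 1 and n = j² + 2p. The partition contains (j^j). By the
-- Jantzen–Seitz congruences a p-segment covers either two runs of equal parts or one, so
-- the first column (a, r) of the symbol can be read off the runs, and 2r = a + ε is
-- impossible: a single p-segment contradicts parity or the size; two p-segments with p
-- nodes each force p ∣ n, which is false as 4n ≡ 1 (mod p); if the second one is shorter,
-- then n has a closed form that is incompatible with containing (j^j); three p-segments
-- force at least p + 1 rows and a first row that is at least as long, and then the
-- congruences leave no room for only 2p nodes outside (j^j).

module Submission where

open import Defs
open import Data.Nat
open import Data.Nat.Properties
open import Data.Nat.Divisibility
open import Data.Nat.DivMod using (_/_; _%_; m≡m%n+[m/n]*n; m%n<n)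
open import Data.Nat.ListAction.Properties using (sum-++)
open import Data.Nat.ListAction using (sum)
open import Data.Nat.Tactic.RingSolver using (solve-∀)
open import Data.List using (List; []; _∷_; length; map; _++_; take; drop; replicate; downFrom; filter; dropWhile)
open import Data.List.Properties using (length-map; length-++; length-downFrom; map-cong; map-++; map-∘; ++-assoc; ++-identityʳ; filter-++; filter-all; filter-none; take-all; length-replicate)
open import Data.List.Membership.Propositional using (_∈_)
open import Data.List.Membership.Propositional.Properties using (∈-map⁺; ∈-map⁻; ∈-++⁺ˡ; ∈-++⁺ʳ; ∈-++⁻)
open import Data.List.Relation.Unary.Any using (here; there)
open import Data.List.Relation.Unary.All as All using (All; []; _∷_)
import Data.List.Relation.Unary.All.Properties as Allₚ
open import Data.List.Relation.Unary.Linked using (Linked; []; [-]; _∷_)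
open import Data.Product using (Σ; ∃; ∃₂; _×_; _,_; proj₁; proj₂)
open import Data.Sum using (_⊎_; inj₁; inj₂)
open import Data.Bool using (if_then_else_; true; false; T)
open import Data.Empty using (⊥; ⊥-elim)
open import Data.Unit using (tt)
open import Function using (_∘_)
open import Relation.Nullary using (¬_; yes; no; contradiction)
open import Relation.Binary.Construct.Closure.ReflexiveTransitive using (Star; ε; _◅_; _◅◅_)
open import Relation.Binary.Definitions using (Tri; tri<; tri≈; tri>)
open import Relation.Binary.PropositionalEquality

-- `removeFrom` and `lastNode` are private to Defs. In the two proofs below a
-- with-abstraction turns the goal into one whose unification solves the underscore in
-- the signature of the auxiliary lemma by the private function.

-- The sizes dictate the families. If a p-rim has a = 2p + 2j - 1 nodes with 0 < 2j ≤ p, then 2r = a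
-- + ε asks for exactly p + j rows; and j² + 2kp drops by exactly 2p + 2j - 1 when k and j both drop
-- by one, so each remainder has the size that the next step wants. The descent changes character at
-- k = 1: the p-rim of ((p+1), (j+2)^j, 1^(p-2j-1)) leaves the square of side j + 1, which is larger
-- than the core and needs 2(j + 1) ≤ p. The core hypothesis yields only 2j ≤ p, and the gap
-- consists of p = 2j and p = 2j + 1.
--
-- The p-rim is computed by a fuel-driven function on lists of nodes, which does not evaluate on
-- symbolic partitions. The relations `Seg` and `PRim` describe its result row by row instead. A
-- `Seg` with p nodes also gives a rim hook, so the same constructions serve the symbol and the way
-- down to the core.
--
-- Non-existence looks only at the first column of the symbol, and uses of the core only its size
-- and that row j of the partition has at least j nodes.

removeRows : ℕ → List Node → Partition → Partition
removeRows i ns [] = []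
removeRows i ns (x ∷ xs) = (x ∸ length (filter (λ m → proj₁ m ≟ i) ns)) ∷ removeRows (suc i) ns xs

lastRow : List Node → ℕ → ℕ
lastRow [] d = d
lastRow (n ∷ []) d = proj₁ n
lastRow (n ∷ m ∷ ns) d = lastRow (m ∷ ns) d

mutual
  removeNodes≡ : ∀ ns la → removeNodes ns la ≡ filter (1 ≤?_) (removeRows 0 ns la)
  removeNodes≡ ns la with filter {P = 1 ≤_} (1 ≤?_)
  ... | g with 0
  ... | i = cong g (from i ns la)

  private
    from : ∀ i ns la → _ ≡ removeRows i ns la
    from i ns [] = refl
    from i ns (x ∷ xs) = cong (_ ∷_) (from (suc i) ns xs)

mutual
  pRimSegs-step : ∀ fuel p L rs {n ns} → take p rs ≡ n ∷ ns →
    pRimSegs (suc fuel) p L rs ≡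
      (let r = lastRow (n ∷ ns) (proj₁ n) in
       if L ≤ᵇ r then n ∷ ns
       else (n ∷ ns) ++ pRimSegs fuel p L (dropWhile (λ m → proj₁ m ≤? r) rs))
  pRimSegs-step fuel p L rs {n} {ns} eq with take p rs | eq
  ... | .(n ∷ ns) | refl with n ∷ ns
  ... | w = cong (λ r → if L ≤ᵇ r then w
                        else (n ∷ ns) ++ pRimSegs fuel p L (dropWhile (λ k → proj₁ k ≤? r) rs))
                 (last≡ w n)

  private
    last≡ : ∀ ns d → _ ≡ lastRow ns (proj₁ d)
    last≡ [] d = refl
    last≡ (n ∷ []) d = refl
    last≡ (n ∷ m ∷ ns) d = last≡ (m ∷ ns) d

take-prefix : ∀ {A : Set} {n} (xs ys : List A) → length xs ≡ n → take n (xs ++ ys) ≡ xs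
take-prefix [] ys refl = refl
take-prefix (x ∷ xs) ys refl = cong (x ∷_) (take-prefix xs ys refl)

drop-length-++ : ∀ {A : Set} (xs ys : List A) → drop (length xs) (xs ++ ys) ≡ ys
drop-length-++ [] ys = refl
drop-length-++ (x ∷ xs) ys = drop-length-++ xs ys

dropWhile-++ : ∀ r (xs ys : List Node) → All (λ n → proj₁ n ≤ r) xs → All (λ n → r < proj₁ n) ys →
  dropWhile (λ n → proj₁ n ≤? r) (xs ++ ys) ≡ ys
dropWhile-++ r [] [] [] [] = refl
dropWhile-++ r [] (y ∷ ys) [] (r<y ∷ _) with proj₁ y ≤ᵇ r in e
... | true = contradiction (≤ᵇ⇒≤ _ _ (subst T (sym e) tt)) (<⇒≱ r<y)
... | false = refl
dropWhile-++ r (x ∷ xs) ys (x≤r ∷ pxs) pys with proj₁ x ≤ᵇ r in e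
... | true = dropWhile-++ r xs ys pxs pys
... | false = ⊥-elim (subst T e (≤⇒≤ᵇ x≤r))

lastRow-++ : ∀ xs {n ns d e} → lastRow (xs ++ n ∷ ns) d ≡ lastRow (n ∷ ns) e
lastRow-++ [] {ns = []} = refl
lastRow-++ [] {ns = m ∷ ns} = lastRow-++ [] {m} {ns}
lastRow-++ (x ∷ []) {n} {ns} = lastRow-++ [] {n} {ns}
lastRow-++ (x ∷ y ∷ xs) = lastRow-++ (y ∷ xs)

-- The rim, row by row

rowNodes : ℕ → ℕ → ℕ → List Node
rowNodes i x lo = map (λ c → (i , c)) (map (lo +_) (downFrom (x ∸ lo)))

firstPart : List ℕ → ℕ
firstPart [] = 0
firstPart (x ∷ _) = x

rimFrom-∷ : ∀ i x xs → rimFrom i (x ∷ xs) ≡ rowNodes i x (firstPart xs ∸ 1) ++ rimFrom (suc i) xs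
rimFrom-∷ i x [] = refl
rimFrom-∷ i x (y ∷ xs) = refl

length-rowNodes : ∀ i x lo → length (rowNodes i x lo) ≡ x ∸ lo
length-rowNodes i x lo = trans (length-map _ (map (lo +_) (downFrom (x ∸ lo))))
  (trans (length-map _ (downFrom (x ∸ lo))) (length-downFrom (x ∸ lo)))

rowNodes-row : ∀ i x lo → All (λ n → proj₁ n ≡ i) (rowNodes i x lo)
rowNodes-row i x lo = Allₚ.map⁺ (All.universal (λ _ → refl) _)

downFrom-+ : ∀ m n → downFrom (m + n) ≡ map (n +_) (downFrom m) ++ downFrom n
downFrom-+ zero n = refl
downFrom-+ (suc m) n = cong₂ _∷_ (+-comm m n) (downFrom-+ m n)

rowNodes-split : ∀ i {x y lo} → lo ≤ y → y ≤ x → rowNodes i x lo ≡ rowNodes i x y ++ rowNodes i y lo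
rowNodes-split i {x} {y} {lo} lo≤y y≤x = begin
  col (map (lo +_) (downFrom (x ∸ lo)))
    ≡⟨ cong (λ k → col (map (lo +_) (downFrom k))) (sym split) ⟩
  col (map (lo +_) (downFrom ((x ∸ y) + (y ∸ lo))))
    ≡⟨ cong (col ∘ map (lo +_)) (downFrom-+ (x ∸ y) (y ∸ lo)) ⟩
  col (map (lo +_) (map ((y ∸ lo) +_) (downFrom (x ∸ y)) ++ downFrom (y ∸ lo)))
    ≡⟨ cong col (map-++ _ (map _ (downFrom (x ∸ y))) _) ⟩
  col (map (lo +_) (map ((y ∸ lo) +_) (downFrom (x ∸ y))) ++ map (lo +_) (downFrom (y ∸ lo)))
    ≡⟨ map-++ _ (map (lo +_) (map _ (downFrom (x ∸ y)))) _ ⟩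
  col (map (lo +_) (map ((y ∸ lo) +_) (downFrom (x ∸ y)))) ++ rowNodes i y lo
    ≡⟨ cong (λ l → col l ++ rowNodes i y lo) (trans (sym (map-∘ _)) (map-cong shift (downFrom (x ∸ y)))) ⟩
  rowNodes i x y ++ rowNodes i y lo ∎
  where
  open ≡-Reasoning
  col = map (λ c → (i , c))
  split : (x ∸ y) + (y ∸ lo) ≡ x ∸ lo
  split = trans (sym (+-∸-assoc (x ∸ y) lo≤y)) (cong (_∸ lo) (m∸n+n≡m y≤x))
  shift : ∀ c → lo + ((y ∸ lo) + c) ≡ y + c
  shift c = trans (sym (+-assoc lo _ c)) (cong (_+ c) (m+[n∸m]≡n lo≤y))

∈-downFrom⁻ : ∀ n {c} → c ∈ downFrom n → c < n
∈-downFrom⁻ (suc n) (here refl) = n<1+n n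
∈-downFrom⁻ (suc n) (there p) = m<n⇒m<1+n (∈-downFrom⁻ n p)

∈-downFrom⁺ : ∀ n {c} → c < n → c ∈ downFrom n
∈-downFrom⁺ (suc n) {c} (s≤s c≤n) with c ≟ n
... | yes refl = here refl
... | no c≢n = there (∈-downFrom⁺ n (≤∧≢⇒< c≤n c≢n))

∈-rowNodes⁻ : ∀ i x lo {i′ j} → (i′ , j) ∈ rowNodes i x lo → i′ ≡ i × lo ≤ j × j < x
∈-rowNodes⁻ i x lo p with ∈-map⁻ _ p
... | c , q , refl with ∈-map⁻ _ q
... | d , r , refl = refl , m≤m+n lo d , (begin-strict
        lo + d         <⟨ +-monoʳ-< lo d< ⟩
        lo + (x ∸ lo)  ≡⟨ m+[n∸m]≡n (<⇒≤ (m∸n≢0⇒n<m {x} {lo} (λ e → contradiction (subst (d <_) e d<) λ ()))) ⟩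
        x              ∎)
  where
  open ≤-Reasoning
  d< = ∈-downFrom⁻ _ r

∈-rowNodes⁺ : ∀ i x lo {j} → lo ≤ j → j < x → (i , j) ∈ rowNodes i x lo
∈-rowNodes⁺ i x lo {j} lo≤j j<x = ∈-map⁺ _ (subst (_∈ map (lo +_) (downFrom (x ∸ lo))) (m+[n∸m]≡n lo≤j)
  (∈-map⁺ (lo +_) (∈-downFrom⁺ (x ∸ lo) (∸-monoˡ-< j<x lo≤j))))

rimFrom-rows : ∀ i la → All (λ n → i ≤ proj₁ n × proj₁ n < i + length la) (rimFrom i la)
rimFrom-rows i [] = []
rimFrom-rows i (x ∷ xs) rewrite rimFrom-∷ i x xs = Allₚ.++⁺
  (All.map (λ { refl → ≤-refl , m<m+n i z<s }) (rowNodes-row i x _))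
  (All.map (λ { {n} (a , b) → ≤-trans (n≤1+n i) a , subst (proj₁ n <_) (sym (+-suc i _)) b })
    (rimFrom-rows (suc i) xs))

count : ℕ → List Node → ℕ
count i ns = length (filter (λ m → proj₁ m ≟ i) ns)

count-++ : ∀ i xs ys → count i (xs ++ ys) ≡ count i xs + count i ys
count-++ i xs ys = trans (cong length (filter-++ _ xs ys)) (length-++ (filter _ xs))

count-none : ∀ i {ns} → All (λ n → proj₁ n ≢ i) ns → count i ns ≡ 0
count-none i p = cong length (filter-none _ p)

count-rowNodes : ∀ i x lo → count i (rowNodes i x lo) ≡ x ∸ lo
count-rowNodes i x lo = trans (cong length (filter-all _ (rowNodes-row i x lo))) (length-rowNodes i x lo)

removeRows-++ : ∀ i ns xs ys → removeRows i ns (xs ++ ys)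
  ≡ removeRows i ns xs ++ removeRows (i + length xs) ns ys
removeRows-++ i ns [] ys = cong (λ k → removeRows k ns ys) (sym (+-identityʳ i))
removeRows-++ i ns (x ∷ xs) ys = cong (_ ∷_) (trans (removeRows-++ (suc i) ns xs ys)
  (cong (λ k → removeRows (suc i) ns xs ++ removeRows k ns ys) (sym (+-suc i _))))

-- `Seg h y xs ys c`: the first c rim nodes of the rows xs, followed by a row of length h,
-- end in the last row of xs. Removing them leaves the rows ys, the last of which is y.
-- All but the last row lose everything beyond the row below, diminished by one.

data Seg (h y : ℕ) : List ℕ → List ℕ → ℕ → Set where
  end  : ∀ {x} d → x ≡ suc d + y → h ≤ suc y → Seg h y (x ∷ []) (y ∷ []) (suc d)
  step : ∀ {x x′ xs ys c} d → x ≡ d + suc x′ → Seg h y (suc x′ ∷ xs) ys c →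
         Seg h y (x ∷ suc x′ ∷ xs) (x′ ∷ ys) (suc d + c)

segNodes : ∀ {h y xs ys c} → ℕ → Seg h y xs ys c → List Node
segNodes {y = y} i (end {x} d e q) = rowNodes i x y
segNodes i (step {x} {x′} d e s) = rowNodes i x x′ ++ segNodes (suc i) s

seg-length-≡ : ∀ {h y xs ys c} → Seg h y xs ys c → length ys ≡ length xs
seg-length-≡ (end _ _ _) = refl
seg-length-≡ (step _ _ s) = cong suc (seg-length-≡ s)

segNodes-length : ∀ {h y xs ys c} i (s : Seg h y xs ys c) → length (segNodes i s) ≡ c
segNodes-length {y = y} i (end d refl q) = trans (length-rowNodes i (suc d + y) y) (m+n∸n≡m (suc d) y)
segNodes-length i (step {x} {x′} d refl s) = trans (length-++ (rowNodes i x x′))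
  (cong₂ _+_ (trans (length-rowNodes i x x′) (trans (cong (_∸ x′) (+-suc d x′)) (m+n∸n≡m (suc d) x′)))
             (segNodes-length (suc i) s))

segNodes-rows : ∀ {h y xs ys c} i (s : Seg h y xs ys c) →
  All (λ n → i ≤ proj₁ n × proj₁ n < i + length xs) (segNodes i s)
segNodes-rows i (end d e q) = All.map (λ { refl → ≤-refl , m<m+n i z<s }) (rowNodes-row i _ _)
segNodes-rows i (step {xs = xs} d e s) = Allₚ.++⁺ (All.map (λ { refl → ≤-refl , m<m+n i z<s })
  (rowNodes-row i _ _))
  (All.map (λ { {n} (a , b) → ≤-trans (n≤1+n i) a , subst (proj₁ n <_) (sym (+-suc i _)) b })
    (segNodes-rows (suc i) s))

segNodes-∷ : ∀ {h y xs ys c} i (s : Seg h y xs ys c) → ∃₂ λ n ns → segNodes i s ≡ n ∷ ns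
segNodes-∷ i s with segNodes i s | segNodes-length i s
segNodes-∷ i (end d e q) | n ∷ ns | _ = n , ns , refl
segNodes-∷ i (step d e s) | n ∷ ns | _ = n , ns , refl

lastRow-All : ∀ {r} ns d → All (λ n → proj₁ n ≡ r) ns → 0 < length ns → lastRow ns d ≡ r
lastRow-All (n ∷ []) d (p ∷ _) _ = p
lastRow-All (n ∷ m ∷ ns) d (_ ∷ ps) _ = lastRow-All (m ∷ ns) d ps z<s

segNodes-lastRow : ∀ {h y xs ys c} i (s : Seg h y xs ys c) d → suc (lastRow (segNodes i s) d) ≡ i + length xs
segNodes-lastRow {h} {y} i s@(end {x} d _ _) d′ = trans
  (cong suc (lastRow-All _ d′ (rowNodes-row i x y) (subst (0 <_) (sym (segNodes-length i s)) z<s)))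
  (+-comm 1 i)
segNodes-lastRow i (step {x} {x′} {xs} d _ s) d′ with segNodes (suc i) s in e | segNodes-∷ (suc i) s
... | _ | m , ms , refl = begin
  suc (lastRow (rowNodes i x x′ ++ m ∷ ms) d′)  ≡⟨ cong suc (lastRow-++ (rowNodes i x x′)) ⟩
  suc (lastRow (m ∷ ms) d′)  ≡⟨ cong (λ l → suc (lastRow l d′)) e ⟨
  suc (lastRow (segNodes (suc i) s) d′)  ≡⟨ segNodes-lastRow (suc i) s d′ ⟩
  suc i + suc (length xs)  ≡⟨ +-suc i _ ⟨
  i + suc (suc (length xs))  ∎
  where open ≡-Reasoning

rimFrom-prefix : ∀ i α rest → ∃ λ R → rimFrom i (α ++ rest) ≡ R ++ rimFrom (i + length α) rest ×
  All (λ n → proj₁ n < i + length α) R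
rimFrom-prefix i [] rest = [] , cong (λ k → rimFrom k rest) (sym (+-identityʳ i)) , []
rimFrom-prefix i (x ∷ α) rest with rimFrom-prefix (suc i) α rest
... | R , e , p = row ++ R
  , trans (rimFrom-∷ i x (α ++ rest)) (trans (cong (row ++_) e) (trans (sym (++-assoc row R _))
      (cong (λ k → (row ++ R) ++ rimFrom k rest) (sym (+-suc i (length α))))))
  , Allₚ.++⁺ (All.map (λ { refl → m<m+n i z<s }) (rowNodes-row i x lo))
             (All.map (λ {n} → subst (proj₁ n <_) (sym (+-suc i (length α)))) p)
  where
  lo = firstPart (α ++ rest) ∸ 1
  row = rowNodes i x lo

-- `R` is what the segment leaves of the rim in its last row. It is empty for y = 0, so that a
-- `short` segment exhausts the rim.
rimFrom-seg : ∀ {h y xs ys c} i (s : Seg h y xs ys c) zs → firstPart zs ≡ h →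
  ∃ λ R → All (λ n → suc (proj₁ n) ≡ i + length xs) R × (y ≡ 0 → R ≡ []) ×
    rimFrom i (xs ++ zs) ≡ segNodes i s ++ (R ++ rimFrom (i + length xs) zs)
rimFrom-seg {y = y} i (end {x} d e h≤) zs refl = rowNodes i y lo
  , All.map (λ { refl → +-comm 1 i }) (rowNodes-row i y lo)
  , (λ { refl → cong (λ k → map (λ c → (i , c)) (map (lo +_) (downFrom k))) (0∸n≡0 lo) })
  , trans (rimFrom-∷ i x zs) (trans (cong₂ _++_ (rowNodes-split i (∸-monoˡ-≤ 1 h≤) y≤x)
      (cong (λ k → rimFrom k zs) (+-comm 1 i))) (++-assoc (rowNodes i x y) _ _))
  where
  lo = firstPart zs ∸ 1
  y≤x : y ≤ x
  y≤x = subst (y ≤_) (sym e) (m≤n+m y (suc d))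
rimFrom-seg i (step {x} {x′} {xs} d e s) zs h≡ with rimFrom-seg (suc i) s zs h≡
... | R , rows , nil , eq rewrite +-suc i (suc (length xs)) =
  R , rows , nil , trans (cong (rowNodes i x x′ ++_) eq) (sym (++-assoc (rowNodes i x x′) _ _))

-- Only the counts in the rows of `xs` matter, so `ns` may be a whole p-rim of which the segment is
-- one piece.
removeRows-seg : ∀ {h y xs ys c} i (s : Seg h y xs ys c) ns →
  (∀ r → i ≤ r → r < i + length xs → count r ns ≡ count r (segNodes i s)) → removeRows i ns xs ≡ ys
removeRows-seg {y = y} i (end {x} d e _) ns h = cong (_∷ [])
  (trans (cong (x ∸_) (trans (h i ≤-refl (m<m+n i z<s)) (count-rowNodes i x y)))
         (m∸[m∸n]≡n (subst (y ≤_) (sym e) (m≤n+m y (suc d)))))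
removeRows-seg i (step {x} {x′} {xs} d e s) ns h = cong₂ _∷_
  (trans (cong (x ∸_) (trans (h i ≤-refl (m<m+n i z<s)) (trans (count-++ i (rowNodes i x x′) _)
    (trans (cong₂ _+_ (count-rowNodes i x x′)
      (count-none i (All.map (λ { (a , _) refl → contradiction a 1+n≰n }) (segNodes-rows (suc i) s))))
        (+-identityʳ _)))))
         (m∸[m∸n]≡n (subst (x′ ≤_) (sym e) (≤-trans (n≤1+n x′) (m≤n+m (suc x′) d)))))
  (removeRows-seg (suc i) s ns λ r a b → trans (h r (≤-trans (n≤1+n i) a) (subst (r <_) (sym (+-suc i _)) b))
    (trans (count-++ r (rowNodes i x x′) _)
      (cong (_+ count r (segNodes (suc i) s))
        (count-none r (All.map (λ { refl refl → contradiction a 1+n≰n }) (rowNodes-row i x x′))))))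

∈-seg⁻ : ∀ {h y xs ys c} i (s : Seg h y xs ys c) k {j} → (i + k , j) ∈ segNodes i s → part ys k ≤ j
  × j < part xs k
∈-seg⁻ {y = y} i (end {x} d e _) k p with ∈-rowNodes⁻ i x y p
∈-seg⁻ i (end d e _) zero p | _ , a , b = a , b
∈-seg⁻ i (end d e _) (suc k) p | q , _ = contradiction q (m+1+n≢m i)
∈-seg⁻ i (step {x} {x′} d e s) k p with ∈-++⁻ (rowNodes i x x′) p
∈-seg⁻ i (step {x} {x′} d e s) zero p | inj₁ q = proj₂ (∈-rowNodes⁻ i x x′ q)
∈-seg⁻ i (step d e s) zero p | inj₂ q = contradiction (proj₁ (All.lookup (segNodes-rows (suc i) s) q)) λ lt →
  1+n≰n (subst (suc i ≤_) (+-identityʳ i) lt)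
∈-seg⁻ i (step {x} {x′} d e s) (suc k) p | inj₁ q = contradiction (proj₁ (∈-rowNodes⁻ i x x′ q)) (m+1+n≢m i)
∈-seg⁻ i (step d e s) (suc k) {j} p | inj₂ q = ∈-seg⁻ (suc i) s k (subst (λ r → (r , j) ∈ segNodes (suc i) s)
  (+-suc i k) q)

∈-seg⁺ : ∀ {h y xs ys c} i (s : Seg h y xs ys c) k {j} → part ys k ≤ j → j < part xs k →
  (i + k , j) ∈ segNodes i s
∈-seg⁺ {y = y} i (end {x} d e _) zero a b rewrite +-identityʳ i = ∈-rowNodes⁺ i x y a b
∈-seg⁺ i (step {x} {x′} d e s) zero a b rewrite +-identityʳ i = ∈-++⁺ˡ (∈-rowNodes⁺ i x x′ a b)
∈-seg⁺ i (step {x} {x′} d e s) (suc k) {j} a b = ∈-++⁺ʳ (rowNodes i x x′)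
  (subst (λ r → (r , j) ∈ segNodes (suc i) s) (sym (+-suc i k)) (∈-seg⁺ (suc i) s k a b))

-- Removal of a rim hook

part-++ˡ : ∀ xs ys {i} → i < length xs → part (xs ++ ys) i ≡ part xs i
part-++ˡ (x ∷ xs) ys {zero} _ = refl
part-++ˡ (x ∷ xs) ys {suc i} (s≤s lt) = part-++ˡ xs ys lt

part-++ʳ : ∀ xs ys i → part (xs ++ ys) (length xs + i) ≡ part ys i
part-++ʳ [] ys i = refl
part-++ʳ (x ∷ xs) ys i = part-++ʳ xs ys i

part-seg-≤ : ∀ {h y xs ys c} (s : Seg h y xs ys c) k → part ys k ≤ part xs k
part-seg-≤ {y = y} (end d refl _) zero = m≤n+m y (suc d)
part-seg-≤ (end d e _) (suc k) = z≤n
part-seg-≤ (step {x′ = x′} d refl s) zero = ≤-trans (n≤1+n x′) (m≤n+m (suc x′) d)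
part-seg-≤ (step d e s) (suc k) = part-seg-≤ s k

-- The rows `ys` may end in zeros, which a partition must not contain. Hence the result is a
-- separate `ν` that agrees with `α ++ ys ++ zs` part by part, missing parts counting as 0.
removeHook : ∀ {p h y xs ys} α zs ν → Seg h y xs ys p → firstPart zs ≡ h → IsPartition ν →
  (∀ i → part ν i ≡ part (α ++ ys ++ zs) i) → RemoveHook p (α ++ xs ++ zs) ν
removeHook {p} {h} {y} {xs} {ys} α zs ν s h≡ ν-part ν≡
  with rimFrom-prefix 0 α (xs ++ zs) | rimFrom-seg (length α) s zs h≡
... | R , e₁ , rows | R′ , _ , _ , e₂ = ν-part , length R , fits , λ i j → ⊆ i j , ⊇ i j
  where
  λ′ = α ++ xs ++ zs
  S = segNodes (length α) s
  rest = R′ ++ rimFrom (length α + length xs) zs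
  rim≡ : rim λ′ ≡ R ++ S ++ rest
  rim≡ = trans e₁ (cong (R ++_) e₂)
  S≡ : take p (drop (length R) (rim λ′)) ≡ S
  S≡ rewrite rim≡ | drop-length-++ R (S ++ rest) = take-prefix S rest (segNodes-length (length α) s)
  fits : length R + p ≤ length (rim λ′)
  fits rewrite rim≡ | length-++ R {S ++ rest} | length-++ S {rest} | segNodes-length (length α) s =
    +-monoʳ-≤ (length R) (m≤m+n p _)
  parts : ∀ i j → (part ν i ≤ j × j < part λ′ i → (i , j) ∈ S) ×
                  ((i , j) ∈ S → part ν i ≤ j) × part ν i ≤ part λ′ i
  parts i j with <-≤-connex i (length α)
  ... | inj₁ i<α = (λ (a , b) → contradiction (≤-trans b (≤-trans (≤-reflexive (sym same)) a)) 1+n≰n)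
                 , (λ q → contradiction (proj₁ (All.lookup (segNodes-rows _ s) q)) (<⇒≱ i<α)) , ≤-reflexive same
    where
    same : part ν i ≡ part λ′ i
    same = trans (ν≡ i) (trans (part-++ˡ α _ i<α) (sym (part-++ˡ α _ i<α)))
  ... | inj₂ α≤i with m≤n⇒∃[o]m+o≡n α≤i
  ...   | k , refl rewrite ν≡ (length α + k) | part-++ʳ α (ys ++ zs) k | part-++ʳ α
    (xs ++ zs) k with <-≤-connex k (length xs)
  ...     | inj₁ k<xs rewrite part-++ˡ xs zs k<xs | part-++ˡ ys zs (subst (k <_) (sym (seg-length-≡ s)) k<xs) =
              (λ (a , b) → ∈-seg⁺ _ s k a b) , (λ q → proj₁ (∈-seg⁻ _ s k q)) , part-seg-≤ s k
  ...     | inj₂ xs≤k with m≤n⇒∃[o]m+o≡n xs≤k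
  ...       | m , refl rewrite part-++ʳ xs zs m | subst (λ l → part (ys ++ zs) (l + m) ≡ part zs m)
    (seg-length-≡ s) (part-++ʳ ys zs m) =
              (λ (a , b) → contradiction (≤-trans b a) 1+n≰n)
            , (λ q → contradiction (+-cancelˡ-< (length α) _ _ (proj₂ (All.lookup (segNodes-rows _ s) q)))
              (m+n≮m (length xs) m))
            , ≤-refl
  ⊆ : ∀ i j → j < part ν i → j < part λ′ i × ¬ (i , j) ∈ take p (drop (length R) (rim λ′))
  ⊆ i j lt with parts i j
  ... | _ , out , le = ≤-trans lt le , λ q → <⇒≱ lt (out (subst ((i , j) ∈_) S≡ q))
  ⊇ : ∀ i j → j < part λ′ i × ¬ (i , j) ∈ take p (drop (length R) (rim λ′)) → j < part ν i
  ⊇ i j (lt , q) with <-≤-connex j (part ν i)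
  ... | inj₁ r = r
  ... | inj₂ le = contradiction (subst ((i , j) ∈_) (sym S≡) (proj₁ (parts i j) (le , lt))) q

-- `PRim p xs ws a`: the p-rim of the rows xs has a nodes and its removal leaves the rows
-- ws, which may contain zeros.

data PRim (p : ℕ) : List ℕ → List ℕ → ℕ → Set where
  whole : ∀ {y xs ys} → Seg 0 y xs ys p → PRim p xs ys p
  short : ∀ {xs ys c} → Seg 0 0 xs ys c → c ≤ p → PRim p xs ys c
  _∷_   : ∀ {h y xs ys zs ws a} → Seg (suc h) y xs ys p → PRim p (suc h ∷ zs) ws a →
          PRim p (xs ++ suc h ∷ zs) (ys ++ ws) (p + a)

-- Agreement of `PRim` with the computed p-rim

-- `leaves` ranges over all `ns` with the right counts in the rows of `xs`: in the induction, the
-- nodes of the other segments are present as well.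
record PRimAt (p i : ℕ) (xs ws : List ℕ) (a : ℕ) (P : List Node) : Set where
  field
    len    : length P ≡ a
    rows   : All (λ n → i ≤ proj₁ n) P
    leaves : ∀ ns → (∀ r → i ≤ r → r < i + length xs → count r ns ≡ count r P) → removeRows i ns xs ≡ ws

-- The segment reaches the last row `L`, so the test `L ≤ᵇ r` ends the recursion.
pRim-last : ∀ {p h y xs ys c} i fuel L {rs} (s : Seg h y xs ys c) → suc L ≡ i + length xs →
  take p rs ≡ segNodes i s → pRimSegs (suc fuel) p L rs ≡ segNodes i s
pRim-last {p} i fuel L {rs} s L≡ t with segNodes-∷ i s
... | n , ns , e = trans (trans (pRimSegs-step fuel p L rs (trans t e))
  (cong (λ b → if b then n ∷ ns
                else (n ∷ ns) ++ pRimSegs fuel p L (dropWhile (λ m → proj₁ m ≤? lastRow (n ∷ ns) (proj₁ n)) rs))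
                  (T⇒true (≤⇒≤ᵇ (≤-reflexive L≡r))))) (sym e)
  where
  T⇒true : ∀ {b} → T b → b ≡ true
  T⇒true {true} _ = refl
  L≡r : L ≡ lastRow (n ∷ ns) (proj₁ n)
  L≡r = suc-injective (trans L≡ (trans (sym (segNodes-lastRow i s (proj₁ n)))
    (cong (λ l → suc (lastRow l (proj₁ n))) e)))

segAt : ∀ {p h y xs ys c} i (s : Seg h y xs ys c) → PRimAt p i xs ys c (segNodes i s)
segAt i s = record
  { len = segNodes-length i s
  ; rows = All.map proj₁ (segNodes-rows i s)
  ; leaves = removeRows-seg i s }

-- Each segment costs one unit of fuel and uses up at least one row, so one unit per row suffices.
pRimAt : ∀ {p xs ws a} i fuel L → PRim p xs ws a → length xs ≤ fuel → suc L ≡ i + length xs →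
  PRimAt p i xs ws a (pRimSegs fuel p L (rimFrom i xs))
pRimAt i zero L (whole (end _ _ _)) () _
pRimAt i zero L (whole (step _ _ _)) () _
pRimAt i zero L (short (end _ _ _) _) () _
pRimAt i zero L (short (step _ _ _) _) () _
pRimAt i zero L (end _ _ _ ∷ _) () _
pRimAt i zero L (step _ _ _ ∷ _) () _
pRimAt {p} {xs} i (suc fuel) L (whole s) _ L≡ with rimFrom-seg i s [] refl
... | R , _ , _ , e rewrite ++-identityʳ xs | pRim-last {p} i fuel L s L≡ (trans (cong (take p) e)
        (take-prefix (segNodes i s) _ (segNodes-length i s))) = segAt i s
pRimAt {p} {xs} i (suc fuel) L (short s c≤p) _ L≡ with rimFrom-seg i s [] refl
... | R , _ , nil , e rewrite ++-identityʳ xs | nil refl | ++-identityʳ (segNodes i s)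
  | pRim-last {p} i fuel L s L≡
    (trans (cong (take p) e) (take-all p _ (≤-trans (≤-reflexive (segNodes-length i s)) c≤p))) = segAt i s
pRimAt {p} i (suc fuel) L (_∷_ {h} {y} {xs} {ys} {zs} {ws} {a} s pr) le L≡ = subst (PRimAt p i _ _ _)
  (sym prim≡) (record
  { len = trans (length-++ S) (cong₂ _+_ (segNodes-length i s) len)
  ; rows = Allₚ.++⁺ (All.map proj₁ (segNodes-rows i s)) (All.map (λ r → ≤-trans (m≤m+n i _) r) rows)
  ; leaves = λ ns h′ → trans (removeRows-++ i ns xs (suc h ∷ zs)) (cong₂ _++_
      (removeRows-seg i s ns λ r i≤ r< → trans (h′ r i≤ (≤-trans r< (+-monoʳ-≤ i xs≤)))
        (trans (count-++ r S _) (trans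
          (cong (count r S +_) (count-none r (All.map (λ { b refl → <⇒≱ r< b }) rows))) (+-identityʳ _))))
      (leaves ns λ r b r< → trans (h′ r (≤-trans (m≤m+n i _) b) (subst (r <_) lens r<))
        (trans (count-++ r S _) (cong (_+ count r P′)
          (count-none r (All.map (λ { (_ , c) refl → <⇒≱ c b }) (segNodes-rows i s))))))) })
  where
  S = segNodes i s
  j = i + length xs
  lens : j + length (suc h ∷ zs) ≡ i + length (xs ++ suc h ∷ zs)
  lens = trans (+-assoc i _ _) (cong (i +_) (sym (length-++ xs)))
  xs≤ : length xs ≤ length (xs ++ suc h ∷ zs)
  xs≤ = subst (length xs ≤_) (sym (length-++ xs)) (m≤m+n _ _)
  0<xs : ∀ {h y xs ys c} → Seg h y xs ys c → 0 < length xs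
  0<xs (end _ _ _) = z<s
  0<xs (step _ _ _) = z<s
  fuel≥ : length (suc h ∷ zs) ≤ fuel
  fuel≥ = s≤s⁻¹ (≤-trans (+-monoˡ-≤ (suc (length zs)) (0<xs s)) (≤-trans (≤-reflexive (sym (length-++ xs))) le))
  P′ = pRimSegs fuel p L (rimFrom j (suc h ∷ zs))
  open PRimAt (pRimAt j fuel L pr fuel≥ (trans L≡ (sym lens)))
  prim≡ : pRimSegs (suc fuel) p L (rimFrom i (xs ++ suc h ∷ zs)) ≡ S ++ P′
  prim≡ with rimFrom-seg i s (suc h ∷ zs) refl | segNodes-∷ i s
  ... | R , Rrows , _ , e | n , ns , e′ = begin
    pRimSegs (suc fuel) p L rs  ≡⟨ pRimSegs-step fuel p L rs (trans t e′) ⟩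
    (if L ≤ᵇ r then n ∷ ns else (n ∷ ns) ++ pRimSegs fuel p L (dropWhile (λ m → proj₁ m ≤? r) rs))
      ≡⟨ cong (λ b → if b then n ∷ ns else (n ∷ ns) ++ pRimSegs fuel p L
        (dropWhile (λ m → proj₁ m ≤? r) rs)) L≰r ⟩
    (n ∷ ns) ++ pRimSegs fuel p L (dropWhile (λ m → proj₁ m ≤? r) rs)
      ≡⟨ cong₂ (λ l l′ → l ++ pRimSegs fuel p L l′) (sym e′) drops ⟩
    S ++ P′ ∎
    where
    open ≡-Reasoning
    rs = rimFrom i (xs ++ suc h ∷ zs)
    r = lastRow (n ∷ ns) (proj₁ n)
    r≡ : suc r ≡ j
    r≡ = trans (cong (λ l → suc (lastRow l (proj₁ n))) (sym e′)) (segNodes-lastRow i s (proj₁ n))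
    t : take p rs ≡ S
    t = trans (cong (take p) e) (take-prefix S _ (segNodes-length i s))
    L≰r : (L ≤ᵇ r) ≡ false
    L≰r with L ≤ᵇ r in eq
    ... | false = refl
    ... | true = contradiction
      (≤-trans (subst (_≤ suc r) (trans L≡ (sym lens)) (s≤s (≤ᵇ⇒≤ L r (subst T (sym eq) tt)))) (≤-reflexive r≡))
        (m+1+n≰m j)
    -- The rest `R` of the last row is skipped together with the segment: the next p-segment starts
    -- in the row below.
    drops : dropWhile (λ m → proj₁ m ≤? r) rs ≡ rimFrom j (suc h ∷ zs)
    drops = trans (cong (dropWhile (λ m → proj₁ m ≤? r)) (trans e (sym (++-assoc S R _))))
      (dropWhile-++ r (S ++ R) _
        (Allₚ.++⁺ (All.map (λ (_ , b) → s≤s⁻¹ (≤-trans b (≤-reflexive (sym r≡)))) (segNodes-rows i s))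
                  (All.map (λ b → ≤-reflexive (suc-injective (trans b (sym r≡)))) Rrows))
        (All.map (λ (b , _) → ≤-trans (≤-reflexive r≡) b) (rimFrom-rows j (suc h ∷ zs))))

seg-length≤ : ∀ {h y xs ys c} → Seg h y xs ys c → length xs ≤ c
seg-length≤ (end d _ _) = s≤s z≤n
seg-length≤ (step d _ s) = s≤s (≤-trans (seg-length≤ s) (m≤n+m _ d))

-- Each row contributes a node to the rim, so the fuel `length (rim xs)` used by `pRim` covers what
-- `pRimAt` asks for.
pRim-length≤ : ∀ {p xs ws a} i → PRim p xs ws a → length xs ≤ length (rimFrom i xs)
pRim-length≤ {xs = xs} i r = go i r
  where
  one : ∀ {h y xs ys c} i zs (s : Seg h y xs ys c) → firstPart zs ≡ h →
    length zs ≤ length (rimFrom (i + length xs) zs) →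
        length (xs ++ zs) ≤ length (rimFrom i (xs ++ zs))
  one {xs = xs} {c = c} i zs s h≡ le with rimFrom-seg i s zs h≡
  ... | R , _ , _ , e rewrite e | length-++ xs {zs} | length-++ (segNodes i s) {R ++ rimFrom (i + length xs) zs}
    | length-++ R {rimFrom (i + length xs) zs} | segNodes-length i s =
      +-mono-≤ (seg-length≤ s) (≤-trans le (m≤n+m _ (length R)))
  go : ∀ {p xs ws a} i → PRim p xs ws a → length xs ≤ length (rimFrom i xs)
  go {xs = xs} i (whole s) = subst (λ l → length l ≤ length (rimFrom i l)) (++-identityʳ xs)
    (one i [] s refl z≤n)
  go {xs = xs} i (short s _) = subst (λ l → length l ≤ length (rimFrom i l)) (++-identityʳ xs)
    (one i [] s refl z≤n)
  go i (s ∷ r) = one i _ s refl (go _ r)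

pRim-length>0 : ∀ {p xs ws a} → PRim p xs ws a → 0 < length xs
pRim-length>0 (whole (end _ _ _)) = z<s
pRim-length>0 (whole (step _ _ _)) = z<s
pRim-length>0 (short (end _ _ _) _) = z<s
pRim-length>0 (short (step _ _ _) _) = z<s
pRim-length>0 (end _ _ _ ∷ _) = z<s
pRim-length>0 (step _ _ _ ∷ _) = z<s

pRim-spec : ∀ {p xs ws a} → PRim p xs ws a →
  length (pRim p xs) ≡ a × removeNodes (pRim p xs) xs ≡ filter (1 ≤?_) ws
pRim-spec {p} {xs} r = len , trans (removeNodes≡ (pRim p xs) xs)
  (cong (filter (1 ≤?_)) (leaves (pRim p xs) λ _ _ _ → refl))
  where
  open PRimAt (pRimAt 0 (length (rim xs)) (length xs ∸ 1) r (pRim-length≤ 0 r)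
                 (trans (+-comm 1 _) (m∸n+n≡m (pRim-length>0 r))))

-- Certificates for fixed symbols

-- The condition s = r on a column is put as a + ε = 2r, which avoids the truncated subtraction in
-- `mullCol`.
data Fixed (p : ℕ) : List ℕ → Set where
  []    : Fixed p []
  fixed : ∀ {xs ws a} → PRim p xs ws a → a + eps p a ≡ length xs + length xs →
          Fixed p (filter (1 ≤?_) ws) → Fixed p xs

-- The symbols agree at every fuel, truncated or not, so the number of columns never has to be
-- estimated.
fixed⇒symbol : ∀ {p xs} fuel → Fixed p xs → mullSymFuel fuel p xs ≡ map (mullCol p) (mullSymFuel fuel p xs)
fixed⇒symbol {xs = []} _ _ = refl
fixed⇒symbol {xs = _ ∷ _} zero _ = refl
fixed⇒symbol {p} {xs = x ∷ xs} (suc fuel) (fixed {ws = ws} {a} r e f) with pRim-spec r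
... | refl , rem = cong₂ _∷_
  (cong (a ,_) (sym (trans (cong (_∸ length (x ∷ xs)) e) (m+n∸n≡m (length (x ∷ xs)) (length (x ∷ xs))))))
  (subst (λ l → mullSymFuel fuel p l ≡ map (mullCol p) (mullSymFuel fuel p l)) (sym rem) (fixed⇒symbol fuel f))

eps-∣ : ∀ {p a} → p ∣ a → eps p a ≡ 0
eps-∣ {p} {a} d with p ∣? a
... | yes _ = refl
... | no ¬d = contradiction d ¬d

eps-∤ : ∀ {p a} → ¬ p ∣ a → eps p a ≡ 1
eps-∤ {p} {a} ¬d with p ∣? a
... | yes d = contradiction d ¬d
... | no _ = refl

-- Partitions in exponential notation

expand : List (ℕ × ℕ) → List ℕ
expand [] = []
expand ((l , a) ∷ R) = replicate a l ++ expand R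

_⊳_ : ℕ × ℕ → ℕ × ℕ → Set
(l , _) ⊳ (l′ , _) = l′ < l

IsRun : ℕ × ℕ → Set
IsRun (l , a) = 0 < l × 0 < a

firstRun : List (ℕ × ℕ) → ℕ
firstRun [] = 0
firstRun ((l , _) ∷ _) = l

firstRun< : ∀ {l a R} → 0 < l → Linked _⊳_ ((l , a) ∷ R) → firstRun R < l
firstRun< 0<l [-] = 0<l
firstRun< 0<l (lt ∷ _) = lt

linked-tail : ∀ {A : Set} {R : A → A → Set} {x xs} → Linked R (x ∷ xs) → Linked R xs
linked-tail [-] = []
linked-tail (_ ∷ l) = l

runs-replicate : ∀ l a R xs → runs xs ≡ R → firstRun R < l → runs (replicate (suc a) l ++ xs) ≡ (l , suc a) ∷ R
runs-replicate l zero [] xs e _ rewrite e = refl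
runs-replicate l zero ((l′ , b) ∷ R) xs e lt rewrite e with l ≡ᵇ l′ in q
... | true = contradiction (≡ᵇ⇒≡ l l′ (subst T (sym q) tt)) (>⇒≢ lt)
... | false = refl
runs-replicate l (suc a) R xs e lt rewrite runs-replicate l a R xs e lt with l ≡ᵇ l in q
... | true = refl
... | false = ⊥-elim (subst T q (≡⇒≡ᵇ l l refl))

runs-expand : ∀ R → Linked _⊳_ R → All IsRun R → runs (expand R) ≡ R
runs-expand [] _ _ = refl
runs-expand ((l , suc a) ∷ R) lk ((0<l , _) ∷ pos) =
  runs-replicate l a R (expand R) (runs-expand R (linked-tail lk) pos) (firstRun< 0<l lk)

expand-partition : ∀ R → Linked _⊳_ R → All IsRun R → IsPartition (expand R)
expand-partition R lk pos = sorted R lk pos , positive R pos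
  where
  positive : ∀ R → All IsRun R → All (λ x → 0 < x) (expand R)
  positive [] [] = []
  positive ((l , a) ∷ R) ((0<l , _) ∷ pos) = Allₚ.++⁺ (Allₚ.replicate⁺ a 0<l) (positive R pos)
  cons : ∀ l xs → firstPart xs ≤ l → Linked _≥_ xs → Linked _≥_ (l ∷ xs)
  cons l [] _ _ = [-]
  cons l (x ∷ xs) le lk = le ∷ lk
  block : ∀ l a xs → firstPart xs ≤ l → Linked _≥_ xs → Linked _≥_ (replicate a l ++ xs)
  block l zero xs le lk = lk
  block l (suc zero) xs le lk = cons l xs le lk
  block l (suc (suc a)) xs le lk = ≤-refl ∷ block l (suc a) xs le lk
  first : ∀ R → All IsRun R → firstPart (expand R) ≡ firstRun R
  first [] _ = refl
  first ((l , suc a) ∷ R) _ = refl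
  first ((l , zero) ∷ R) ((_ , ()) ∷ _)
  sorted : ∀ R → Linked _⊳_ R → All IsRun R → Linked _≥_ (expand R)
  sorted [] _ _ = []
  sorted ((l , a) ∷ R) lk ((0<l , _) ∷ pos) = block l a (expand R)
    (≤-trans (≤-reflexive (first R pos)) (<⇒≤ (firstRun< 0<l lk))) (sorted R (linked-tail lk) pos)

record JSRuns (p : ℕ) (R : List (ℕ × ℕ)) : Set where
  constructor jsRuns
  field
    decreasing : Linked _⊳_ R
    isRun      : All IsRun R
    regular    : All (λ r → suc (proj₂ r) ≤ p) R
    js         : Linked (JSPair p) R

jsRuns⇒IsJS : ∀ {p R} → JSRuns p R → IsJS p (expand R)
jsRuns⇒IsJS {p} {R} (jsRuns lk pos reg js) = (expand-partition R lk pos , subst (All _) (sym e) reg) , subst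
  (Linked (JSPair p)) (sym e) js
  where e = runs-expand R lk pos

-- The p-rim is best described on rows and the Jantzen-Seitz condition on runs; `expand R ≡ xs`
-- links the two forms.
good : ∀ {p mu R xs} w → expand R ≡ xs → JSRuns p R → Fixed p xs → Star (RemoveHook p) xs mu → IsPCore p mu →
  sum xs ≡ sum mu + p * w → GoodPartition p w mu xs
good {p} {xs = xs} w refl rs f chain core weight = proj₁ (proj₁ js) , js
  , (proj₁ js , proj₁ js , fixed⇒symbol (suc (size xs)) f) , (chain , core) , weight
  where js = jsRuns⇒IsJS rs

-- Segments through blocks of equal rows, and the fixed families

castSeg : ∀ {h y xs xs′ ys ys′ c c′} → xs ≡ xs′ → ys ≡ ys′ → c ≡ c′ → Seg h y xs ys c → Seg h y xs′ ys′ c′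
castSeg refl refl refl s = s

replicate-∷ʳ : ∀ a (x : ℕ) → replicate a x ++ x ∷ [] ≡ replicate (suc a) x
replicate-∷ʳ zero x = refl
replicate-∷ʳ (suc a) x = cong (x ∷_) (replicate-∷ʳ a x)

-- Along a block of equal rows the rim runs straight down, one node per row; only the last row can
-- contribute more.
seg-block : ∀ {h y x d} a → suc x ≡ suc d + y → h ≤ suc y →
  Seg h y (replicate (suc a) (suc x)) (replicate a x ++ y ∷ []) (a + suc d)
seg-block zero e q = end _ e q
seg-block (suc a) e q = step 0 refl (seg-block a e q)

seg-prepend : ∀ {h y x x′ d xs ys c} a → suc x ≡ d + suc x′ → Seg h y (suc x′ ∷ xs) ys c →
  Seg h y (replicate (suc a) (suc x) ++ suc x′ ∷ xs) (replicate a x ++ x′ ∷ ys) (a + (suc d + c))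
seg-prepend zero e s = step _ e s
seg-prepend (suc a) e s = step 0 refl (seg-prepend a e s)

-- The last upper row drops to length z and joins the lower block. This is how one part passes from
-- q + 1 to q in family B. For m = 0 the lower block is empty.
seg-two-blocks : ∀ {h x z d} a m → suc x ≡ d + suc z → h ≤ suc z →
  Seg h z (replicate (suc a) (suc x) ++ replicate m (suc z)) (replicate a x ++ replicate (suc m) z)
    (a + (suc d + m))
seg-two-blocks {x = x} {d = d} a zero e q = castSeg (sym (++-identityʳ (replicate (suc a) (suc x)))) refl
  (cong (λ k → a + suc k) (sym (+-identityʳ d))) (seg-block a (trans e (+-suc d _)) q)
seg-two-blocks {x = x} {z} {d} a (suc m) e q = castSeg refl (cong (λ ys → replicate a x ++ z ∷ ys)
  (replicate-∷ʳ m z))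
  (cong (λ c → a + (suc d + c)) (+-comm m 1)) (seg-prepend a e (seg-block m refl q))

sum-replicate : ∀ a l → sum (replicate a l) ≡ a * l
sum-replicate zero l = refl
sum-replicate (suc a) l = cong (l +_) (sum-replicate a l)

fixed-clean : ∀ {p xs ws a ν} z → PRim p xs ws a → a + eps p a ≡ length xs + length xs →
  ws ≡ ν ++ replicate z 0 → All (1 ≤_) ν → Fixed p ν → Fixed p xs
fixed-clean {p} {ν = ν} z r e refl pos f = fixed r e (subst (Fixed p) (sym clean) f)
  where
  clean : filter (1 ≤?_) (ν ++ replicate z 0) ≡ ν
  clean = trans (filter-++ (1 ≤?_) ν _) (trans (cong₂ _++_ (filter-all (1 ≤?_) pos)
    (filter-none (1 ≤?_) (Allₚ.replicate⁺ z λ ()))) (++-identityʳ ν))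

positive-square : ∀ i → All (1 ≤_) (replicate i i)
positive-square zero = []
positive-square i@(suc _) = Allₚ.replicate⁺ i (s≤s z≤n)

∤-between : ∀ {p x} → 0 < x → x < p → ¬ p ∣ x
∤-between {x = suc x} _ lt = >⇒∤ lt

∤-p+ : ∀ {p x} → ¬ p ∣ x → ¬ p ∣ p + x
∤-p+ ¬d d = ¬d (∣m+n∣m⇒∣n d ∣-refl)

-- The rim of the square has 2j - 1 < p nodes, hence is a single short segment, and its removal
-- leaves the next smaller square.
fixed-square : ∀ {p} j → j + j ≤ p → Fixed p (replicate j j)
fixed-square zero _ = []
fixed-square {p} (suc i) le = fixed-clean 1 (short (seg-block i (sym (cong suc (+-identityʳ i))) z≤n) (<⇒≤ le))
  (trans (cong (i + suc i +_) (eps-∤ (∤-between (subst (0 <_) (sym (+-suc i i)) z<s) le)))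
    (trans (+-comm _ 1) (sym (cong (λ k → k + k) (length-replicate (suc i))))))
  refl (positive-square i) (fixed-square i (≤-trans (+-mono-≤ (n≤1+n i) (n≤1+n i)) le))

-- Serves twice: as the first p-segment at k = 1, and as the hook by which `core-A` gets rid of the
-- long top row.
seg-first-block : ∀ {h} p d j → p ≡ suc (d + j) → h ≤ 2 + j →
  Seg h (suc j) (suc p ∷ replicate j (2 + j)) (replicate (suc j) (suc j)) p
seg-first-block p d zero refl q = castSeg refl refl (cong suc (sym (+-identityʳ d))) (end d (e d) q)
  where
  e : ∀ d → suc (suc (d + 0)) ≡ suc d + 1
  e = solve-∀
seg-first-block p d (suc i) refl q = castSeg refl (cong (2 + i ∷_) (replicate-∷ʳ i (2 + i))) (e₂ d i)
  (seg-prepend {d = d} 0 (e₁ d i) (seg-block i refl q))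
  where
  e₁ : ∀ d i → suc (suc (d + suc i)) ≡ d + suc (2 + i)
  e₁ = solve-∀
  e₂ : ∀ d i → suc d + (i + 1) ≡ suc (d + suc i)
  e₂ = solve-∀

-- ((p+1), (j+2)^j, 1^(m+1)) with p = m + 2j + 2. Removing the p-rim leaves the square of j + 1.

fixed-weight-two : ∀ {p} j m → p ≡ suc (suc m + (j + j)) →
  Fixed p (suc p ∷ (replicate j (2 + j) ++ replicate (suc m) 1))
fixed-weight-two {p} j m refl = fixed-clean (suc m)
  (seg-first-block p (suc m + j) j (cong suc (sym (+-assoc (suc m) j j))) (s≤s z≤n)
    ∷ short {c = m + 1} (seg-block m refl z≤n) m<p)
  (trans (cong (p + (m + 1) +_) (eps-∤ (∤-p+ (∤-between (subst (0 <_) (+-comm 1 m) z<s) m<p′))))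
    (trans (e m j) (sym lens)))
  (cong (replicate (suc j) (suc j) ++_) (replicate-∷ʳ m 0)) (Allₚ.replicate⁺ (suc j) (s≤s z≤n))
  (fixed-square (suc j) square≤)
  where
  m<p′ : m + 1 < p
  m<p′ = s≤s (≤-trans (≤-reflexive (+-comm m 1)) (m≤m+n (suc m) (j + j)))
  square≤ : suc j + suc j ≤ p
  square≤ = subst (_≤ p) (e₂ j) (s≤s (s≤s (m≤n+m (j + j) m)))
    where
    e₂ : ∀ j → suc (suc (j + j)) ≡ suc j + suc j
    e₂ = solve-∀
  m<p = <⇒≤ m<p′
  e : ∀ m j → suc (suc m + (j + j)) + (m + 1) + 1 ≡ (suc (j + suc m)) + suc (j + suc m)
  e = solve-∀
  lens : length (suc p ∷ (replicate j (2 + j) ++ replicate (suc m) 1)) + length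
    (suc p ∷ (replicate j (2 + j) ++ replicate (suc m) 1)) ≡ suc (j + suc m) + suc (j + suc m)
  lens = cong (λ l → suc l + suc l) (trans (length-++ (replicate j _))
    (cong₂ _+_ (length-replicate j) (length-replicate (suc m))))

seg-first-row : ∀ {h} P k → h ≤ 2 + k * suc P →
  Seg h (suc (k * suc P)) (suc (suc k * suc P) ∷ []) (suc (k * suc P) ∷ []) (suc P)
seg-first-row P k le = end P (cong suc (sym (+-suc P (k * suc P)))) le

seg-shape : ∀ {h y xs ys c} → Seg h y xs ys c → ∃₂ λ x zs → xs ≡ suc x ∷ zs
seg-shape (end d e _) = _ , [] , cong (_∷ []) e
seg-shape (step d e s) = _ , _ , cong (_∷ _) (trans e (+-suc d _))

pRim-shape : ∀ {p xs ws a} → PRim p xs ws a → ∃₂ λ x zs → xs ≡ suc x ∷ zs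
pRim-shape (whole s) = seg-shape s
pRim-shape (short s _) = seg-shape s
pRim-shape (s ∷ _) with seg-shape s
... | x , zs , refl = x , _ , refl

pRim-first-row : ∀ P k {xs ws a} → PRim (suc P) xs ws a → firstPart xs ≤ 2 + k * suc P →
  PRim (suc P) (suc (suc k * suc P) ∷ xs) (suc (k * suc P) ∷ ws) (suc P + a)
pRim-first-row P k r le with pRim-shape r
... | _ , _ , refl = seg-first-row P k le ∷ r

length-two-blocks : ∀ s t (x y : ℕ) → length (replicate s x ++ replicate t y) ≡ s + t
length-two-blocks s t x y = trans (length-++ (replicate s x))
  (cong₂ _+_ (length-replicate s) (length-replicate t))

length-three-blocks : ∀ s t u (x y z : ℕ) → length ((replicate s x ++ replicate t y) ++ replicate u z)
  ≡ s + t + u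
length-three-blocks s t u x y z = trans (length-++ (replicate s x ++ replicate t y))
  (cong₂ _+_ (length-two-blocks s t x y) (length-replicate u))

-- ((kp+1), (j+2)^j, k^m, (k-1)^n) with k = k′ + 2, j = k + r, n = k′ + 2r + 3 and
-- p = m + n + 1. Removing the p-rim decreases both k and j by one.

familyA : ℕ → ℕ → ℕ → ℕ → List ℕ
familyA p k r m = suc ((2 + k) * p) ∷
  ((replicate (2 + k + r) (4 + k + r) ++ replicate m (2 + k)) ++ replicate (3 + k + (r + r)) (1 + k))

fixed-A : ∀ P k r m → P ≡ m + (3 + k + (r + r)) → k ≤ m → Fixed (suc P) (familyA (suc P) k r m)
fixed-A P k r m P≡ k≤m = next k refl
  where
  p = suc P
  n = 2 + k + (r + r)
  -- The lowest block has `suc n` rows of length `suc k`, so its rim has `n + suc k` = 2j - 1 nodes.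
  -- By `k≤m` this is less than p, and one short segment covers it.
  x<p : n + suc k < p
  x<p = s≤s (begin
    n + suc k            ≤⟨ +-monoʳ-≤ n (s≤s k≤m) ⟩
    n + suc m            ≡⟨ e k r m ⟩
    m + (3 + k + (r + r)) ≡⟨ P≡ ⟨
    P                    ∎)
    where
    open ≤-Reasoning
    e : ∀ k r m → 2 + k + (r + r) + suc m ≡ m + (3 + k + (r + r))
    e = solve-∀
  h≤ : 4 + k + r ≤ 2 + (1 + k) * p
  h≤ = begin
    4 + k + r               ≤⟨ m≤m+n _ _ ⟩
    4 + k + r + (r + m)     ≡⟨ e k r m ⟩
    suc (m + (3 + k + (r + r))) ≡⟨ cong suc P≡ ⟨
    p                       ≤⟨ m≤m+n p (k * p) ⟩
    p + k * p               ≤⟨ m≤n+m _ 2 ⟩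
    2 + (1 + k) * p         ∎
    where
    open ≤-Reasoning
    e : ∀ k r m → 4 + k + r + (r + m) ≡ suc (m + (3 + k + (r + r)))
    e = solve-∀
  rimA : PRim p (familyA p k r m)
    ((suc ((1 + k) * p) ∷ []) ++ ((replicate (1 + k + r) (3 + k + r) ++ replicate (suc m) (1 + k)) ++
      (replicate n k ++ 0 ∷ [])))
    (p + (p + (n + suc k)))
  rimA = seg-first-row P (1 + k) h≤
    ∷ (castSeg refl refl (trans (c≡ k r m) (sym (cong suc P≡))) (seg-two-blocks {d = 2 + r} (1 + k + r) m
      (x≡ k r) (n≤1+n _))
    ∷ short (seg-block n (cong suc (sym (+-identityʳ k))) z≤n) (<⇒≤ x<p))
    where
    c≡ : ∀ k r m → 1 + k + r + (suc (2 + r) + m) ≡ suc (m + (3 + k + (r + r)))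
    c≡ = solve-∀
    x≡ : ∀ k r → 4 + k + r ≡ 2 + r + (2 + k)
    x≡ = solve-∀
  column : p + (p + (n + suc k)) + eps p (p + (p + (n + suc k)))
    ≡ length (familyA p k r m) + length (familyA p k r m)
  column = begin
    p + (p + (n + suc k)) + eps p (p + (p + (n + suc k)))
      ≡⟨ cong (p + (p + (n + suc k)) +_)
        (eps-∤ (∤-p+ (∤-p+ (∤-between (subst (0 <_) (sym (+-suc n k)) z<s) x<p)))) ⟩
    p + (p + (n + suc k)) + 1
      ≡⟨ cong (λ P → suc P + (suc P + (n + suc k)) + 1) P≡ ⟩
    suc (m + (3 + k + (r + r))) + (suc (m + (3 + k + (r + r))) + (n + suc k)) + 1
      ≡⟨ e k r m ⟩
    suc ((2 + k + r) + m + (3 + k + (r + r))) + suc ((2 + k + r) + m + (3 + k + (r + r)))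
      ≡⟨ cong (λ l → suc l + suc l) (length-three-blocks (2 + k + r) m (3 + k + (r + r)) _ _ _) ⟨
    length (familyA p k r m) + length (familyA p k r m) ∎
    where
    open ≡-Reasoning
    e : ∀ k r m → suc (m + (3 + k + (r + r))) + (suc (m + (3 + k + (r + r))) + (2 + k + (r + r) + suc k)) + 1
        ≡ suc ((2 + k + r) + m + (3 + k + (r + r))) + suc ((2 + k + r) + m + (3 + k + (r + r)))
    e = solve-∀
  next : ∀ k₁ → k ≡ k₁ → Fixed p (familyA p k r m)
  -- The lowest block consists of ones and disappears entirely; the remainder is the member for k =
  -- 1.
  next zero refl = fixed-clean (suc n) rimA column
    (cong₂ _∷_ (cong suc (+-identityʳ p)) (cong ((replicate (1 + r) (3 + r) ++ replicate (suc m) 1) ++_)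
      (replicate-∷ʳ n 0)))
    (s≤s z≤n ∷ Allₚ.++⁺ (Allₚ.replicate⁺ (1 + r) (s≤s z≤n)) (Allₚ.replicate⁺ (suc m) (s≤s z≤n)))
    (fixed-weight-two (1 + r) m (cong suc (trans P≡ (e r m))))
    where
    e : ∀ r m → m + (3 + (r + r)) ≡ suc m + (1 + r + (1 + r))
    e = solve-∀
  next (suc k₁) refl = fixed-clean 1 rimA column
    (cong (suc ((2 + k₁) * p) ∷_)
      (sym (++-assoc (replicate (2 + k₁ + r) (4 + k₁ + r) ++ replicate (suc m) (2 + k₁)) (replicate n k)
        (0 ∷ []))))
    (s≤s z≤n ∷ Allₚ.++⁺ (Allₚ.++⁺ (Allₚ.replicate⁺ (2 + k₁ + r) (s≤s z≤n)) (Allₚ.replicate⁺ (suc m) (s≤s z≤n)))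
      (Allₚ.replicate⁺ n (s≤s z≤n)))
    (fixed-A P k₁ r (suc m) (trans P≡ (e k₁ r m)) (≤-trans (n≤1+n k₁) (≤-trans k≤m (n≤1+n m))))
    where
    e : ∀ k r m → m + (4 + k + (r + r)) ≡ suc m + (3 + k + (r + r))
    e = solve-∀

-- ((kp+1), (q+1)^s, q^t, j^j). The parts q + 1 and q form the partition of kp - 1 into
-- p - 1 parts that are as equal as possible: s + t = p - 1, k = s + 1 + (p-1)e and
-- q = k + e = s + 1 + pe. Removing the p-rim decreases both k and j by one.

familyB : ℕ → ℕ → ℕ → ℕ → ℕ → List ℕ
familyB x s q t j = x ∷ ((replicate s (suc q) ++ replicate t q) ++ replicate j j)

module _ {P k q u v j : ℕ} (q≤ : q ≤ k * suc P) (0<q : 1 ≤ q) (2j≤p : j + j ≤ suc P) (j≤ : j ≤ suc q) where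

  private
    p = suc P
    -- `j ∸ 1` and `1 ⊓ j` include the case j = 0, in which there is no third segment and no row is
    -- emptied.
    tailRim : ∀ {mid mid′} → (∀ h → h ≤ suc q → Seg h q mid mid′ p) → ∀ j → j + j ≤ p → j ≤ suc q →
      PRim p (mid ++ replicate j j) (mid′ ++ (replicate (j ∸ 1) (j ∸ 1) ++ replicate (1 ⊓ j) 0))
        (p + (j + j ∸ 1))
    tailRim {mid} {mid′} seg zero _ _ rewrite ++-identityʳ mid | ++-identityʳ mid′ | +-identityʳ p = whole
      (seg 0 z≤n)
    tailRim seg (suc i) 2j≤p j≤ = seg (suc i) j≤ ∷ short (seg-block i (cong suc (sym (+-identityʳ i))) z≤n)
      (≤-trans (n≤1+n _) 2j≤p)

    epsB : ∀ j → j + j ≤ p → p + (p + (j + j ∸ 1)) + eps p (p + (p + (j + j ∸ 1))) ≡ (p + j) + (p + j)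
    epsB zero _ = trans (cong (p + (p + 0) +_) (eps-∣ (∣m∣n⇒∣m+n ∣-refl (∣m∣n⇒∣m+n ∣-refl (p ∣0)))))
      (e p) where
      e : ∀ p → p + (p + 0) + 0 ≡ p + 0 + (p + 0)
      e = solve-∀
    epsB (suc i) 2j≤p = trans (cong (p + (p + (i + suc i)) +_)
      (eps-∤ (∤-p+ (∤-p+ (∤-between (subst (0 <_) (sym (+-suc i i)) z<s) 2j≤p))))) (e p i)
      where
      e : ∀ p i → p + (p + (i + suc i)) + 1 ≡ p + suc i + (p + suc i)
      e = solve-∀

  -- `mid` stands for the p - 1 rows under the top row, which have two different lengths or all the
  -- same length. Its segment is given for every `h` up to `suc q`, because for j = 0 there is no
  -- row below.
  fixed-B-step : ∀ {mid} → (∀ h → h ≤ suc q → Seg h q mid (replicate u (suc q) ++ replicate v q) p) →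
    firstPart (mid ++ replicate j j) ≤ 2 + q → length mid ≡ P →
    Fixed p (familyB (suc (k * p)) u q v (j ∸ 1)) → Fixed p (suc (suc k * p) ∷ (mid ++ replicate j j))
  fixed-B-step {mid} seg first len f = fixed-clean (1 ⊓ j) rimB
    (trans (epsB j 2j≤p) (cong (λ l → suc l + suc l)
      (sym (trans (length-++ mid) (cong₂ _+_ len (length-replicate j))))))
    (cong (suc (k * p) ∷_) (sym (++-assoc (replicate u (suc q) ++ replicate v q)
      (replicate (j ∸ 1) (j ∸ 1)) _)))
    (s≤s z≤n ∷ Allₚ.++⁺ (Allₚ.++⁺ (Allₚ.replicate⁺ u (s≤s z≤n)) (Allₚ.replicate⁺ v 0<q))
      (positive-square (j ∸ 1)))
    f
    where
    rimB : PRim p (suc (suc k * p) ∷ (mid ++ replicate j j))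
      ((suc (k * p) ∷ []) ++ ((replicate u (suc q) ++ replicate v q) ++ (replicate (j ∸ 1) (j ∸ 1) ++ replicate
        (1 ⊓ j) 0)))
      (p + (p + (j + j ∸ 1)))
    rimB = pRim-first-row P k (tailRim seg j 2j≤p j≤) (≤-trans first (+-monoʳ-≤ 2 q≤))

q≤kp : ∀ P e s → 1 ≤ P → suc (s + suc P * e) ≤ suc (s + P * e) * suc P
q≤kp (suc P) e s _ = subst (suc (s + suc (suc P) * e) ≤_) (eq P e s) (m≤m+n _ _)
  where
  eq : ∀ P e s → suc (s + suc (suc P) * e) + (suc P + s * suc P + P * e * suc (suc P))
    ≡ suc (s + suc P * e) * suc (suc P)
  eq = solve-∀

-- Lexicographic descent in (e, s): each p-rim turns one part q + 1 into q, and once all parts are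
-- equal the count restarts with e - 1. It ends at k = 1, where the bound on j leaves only j = 0.
fixed-B : ∀ P e s t j → s + t ≡ P → 1 ≤ t → j ≤ s + P * e → j + j ≤ suc P →
  Fixed (suc P) (familyB (suc (suc (s + P * e) * suc P)) s (suc (s + suc P * e)) t j)
fixed-B P e (suc s) t j st 1≤t j≤ 2j≤ = fixed-B-step {k = suc (s + P * e)} {u = s} {v = suc t}
  (q≤kp P e s (subst (1 ≤_) st (s≤s z≤n))) (s≤s z≤n) 2j≤
  (≤-trans j≤ (≤-trans (+-monoʳ-≤ (suc s) (*-monoˡ-≤ e (n≤1+n P))) (n≤1+n _)))
  (λ h le → castSeg refl refl (trans (+-suc s (suc t)) (cong suc (trans (+-suc s t) st)))
    (seg-two-blocks {d = 1} s t refl le))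
  ≤-refl (trans (length-two-blocks (suc s) t _ _) st)
  (fixed-B P e s (suc t) (j ∸ 1) (trans (+-suc s t) st) (s≤s z≤n) (∸-monoˡ-≤ 1 j≤)
    (≤-trans (+-mono-≤ (m∸n≤m j 1) (m∸n≤m j 1)) 2j≤))
fixed-B P zero zero (suc m) j refl 1≤t j≤ 2j≤ with subst (j ≤_) (*-zeroʳ m) j≤
... | z≤n rewrite *-zeroʳ m | ++-identityʳ (replicate m 1) | +-identityʳ m =
  fixed-weight-two 0 m (cong (suc ∘ suc) (sym (+-identityʳ m)))
fixed-B P (suc e) zero (suc t) j refl 1≤t j≤ 2j≤ = subst₂
  (λ k q → Fixed (suc P) (familyB (suc (suc k * suc P)) 0 (suc q) P j))
  (sym (*-suc P e)) (sym (*-suc (suc P) e))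
  (fixed-B-step {k = suc (t + P * e)} {u = t} {v = 1} (q≤kp P e t (s≤s z≤n)) (s≤s z≤n) 2j≤
    (≤-trans j≤′ (s≤s (≤-trans (+-monoʳ-≤ t (*-monoˡ-≤ e (n≤1+n P))) (n≤1+n _))))
    (λ h le → castSeg refl refl (+-comm t 2) (seg-block {d = 1} t refl le))
    ≤-refl (length-replicate P)
    (fixed-B P e t 1 (j ∸ 1) (+-comm t 1) (s≤s z≤n) (∸-monoˡ-≤ 1 j≤′)
      (≤-trans (+-mono-≤ (m∸n≤m j 1) (m∸n≤m j 1)) 2j≤)))
  where
  j≤′ : j ≤ suc (t + P * e)
  j≤′ = subst (j ≤_) (*-suc P e) j≤

-- ((p+2)^2, (j+2)^(j-2)) with p = 2j and j = i + 2. The p-rim is a single hook of length p,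
-- and so is that of the remaining ((p+1), (j+1)^(j-1)), which leaves the square of j.

fixed-half : ∀ i → Fixed (4 + (i + i)) (replicate 2 (6 + (i + i)) ++ replicate i (4 + i))
fixed-half i = fixed-clean 0 (whole (castSeg refl refl (e₁ i) (seg-two-blocks {d = 2 + i} 1 i (e₂ i) z≤n)))
  (column {replicate 2 (6 + (i + i)) ++ replicate i (4 + i)} (length-two-blocks 2 i (6 + (i + i)) (4 + i)))
  (sym (++-identityʳ _)) (s≤s z≤n ∷ Allₚ.replicate⁺ (suc i) (s≤s z≤n))
  (fixed-clean 0 (whole (castSeg refl refl (e₃ i) (seg-two-blocks {d = 2 + i} 0 (suc i) (e₄ i) z≤n)))
    (column {5 + (i + i) ∷ replicate (suc i) (3 + i)} (cong suc (length-replicate (suc i))))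
    (sym (++-identityʳ _)) (Allₚ.replicate⁺ (2 + i) (s≤s z≤n))
    (fixed-square (2 + i) (≤-reflexive (e₅ i))))
  where
  p = 4 + (i + i)
  e₁ : ∀ i → 1 + (suc (2 + i) + i) ≡ 4 + (i + i)
  e₁ = solve-∀
  e₂ : ∀ i → 6 + (i + i) ≡ 2 + i + suc (3 + i)
  e₂ = solve-∀
  e₃ : ∀ i → suc (2 + i) + suc i ≡ 4 + (i + i)
  e₃ = solve-∀
  e₄ : ∀ i → 5 + (i + i) ≡ 2 + i + suc (2 + i)
  e₄ = solve-∀
  e₅ : ∀ i → 2 + i + (2 + i) ≡ 4 + (i + i)
  e₅ = solve-∀
  column : ∀ {xs} → length xs ≡ 2 + i → p + eps p p ≡ length xs + length xs
  column len = trans (cong (p +_) (eps-∣ (∣-refl {p})))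
    (trans (+-identityʳ p) (trans (sym (e₅ i)) (cong (λ l → l + l) (sym len))))

-- Jantzen–Seitz conditions

js-last : ∀ {p l a} → 0 < l → 0 < a → a < p → JSRuns p ((l , a) ∷ [])
js-last 0<l 0<a a<p = jsRuns [-] ((0<l , 0<a) ∷ []) (a<p ∷ []) [-]

-- `suc d` is the difference of the two parts and `c` the quotient in the congruence.
js-∷ : ∀ {p l a l′ a′ R} d c → l ≡ suc d + l′ → suc d + a + a′ ≡ c * p → 0 < a → a < p →
  JSRuns p ((l′ , a′) ∷ R) → JSRuns p ((l , a) ∷ (l′ , a′) ∷ R)
js-∷ {a = a} {l′} {a′} d c refl e 0<a a<p (jsRuns dec run reg js) = jsRuns
  (s≤s (m≤n+m l′ d) ∷ dec) ((z<s , 0<a) ∷ run) (a<p ∷ reg)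
  (divides c (trans (cong (λ x → x + a + a′) (m+n∸n≡m (suc d) l′)) e) ∷ js)

js-square : ∀ {p} j → suc j + suc j ≤ p → JSRuns p ((suc j , suc j) ∷ [])
js-square j le = js-last z<s z<s (≤-trans (+-monoˡ-≤ (suc j) (s≤s z≤n)) le)

js-weight-two : ∀ i m → let j = suc i; p = suc (suc m + (j + j)) in
  JSRuns p ((suc p , 1) ∷ (2 + j , j) ∷ (1 , suc m) ∷ [])
js-weight-two i m = js-∷ (m + suc i) 1 (e₁ i m) (e₂ i m) z<s (s≤s (s≤s z≤n))
  (js-∷ (suc i) 1 (e₃ i) (e₄ i m) z<s (s≤s (≤-trans (m≤m+n (suc i) (suc i)) (m≤n+m _ (suc m))))
    (js-last z<s z<s (s≤s (m≤m+n (suc m) _))))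
  where
  e₁ : ∀ i m → suc (suc (suc m + (suc i + suc i))) ≡ suc (m + suc i) + (2 + suc i)
  e₁ = solve-∀
  e₂ : ∀ i m → suc (m + suc i) + 1 + suc i ≡ 1 * suc (suc m + (suc i + suc i))
  e₂ = solve-∀
  e₃ : ∀ i → 2 + suc i ≡ suc (suc i) + 1
  e₃ = solve-∀
  e₄ : ∀ i m → suc (suc i) + suc i + suc m ≡ 1 * suc (suc m + (suc i + suc i))
  e₄ = solve-∀

js-A : ∀ k r m → let p = suc (suc m + (3 + k + (r + r))) in
  JSRuns p ((suc ((2 + k) * p) , 1) ∷ (4 + k + r , 2 + k + r) ∷ (2 + k , suc m) ∷
    (1 + k , 3 + k + (r + r)) ∷ [])
js-A k r m = js-∷ ((1 + k) * p + (suc m + r)) (2 + k) (e₁ k r m) (e₂ k r m) z<s (s≤s (s≤s z≤n))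
  (js-∷ (1 + r) 1 (e₃ k r) (e₄ k r m) z<s (subst (3 + k + r ≤_) (e₅ k r m) (m≤m+n _ _))
  (js-∷ 0 1 refl (e₆ k r m) z<s (s≤s (m≤m+n (suc m) _))
  (js-last z<s z<s (s≤s (m≤n+m _ (suc m))))))
  where
  p = suc (suc m + (3 + k + (r + r)))
  e₁ : ∀ k r m → suc ((2 + k) * suc (suc m + (3 + k + (r + r))))
    ≡ suc ((1 + k) * suc (suc m + (3 + k + (r + r))) + (suc m + r)) + (4 + k + r)
  e₁ = solve-∀
  e₂ : ∀ k r m → suc ((1 + k) * suc (suc m + (3 + k + (r + r))) + (suc m + r)) + 1 + (2 + k + r)
    ≡ (2 + k) * suc (suc m + (3 + k + (r + r)))
  e₂ = solve-∀
  e₃ : ∀ k r → 4 + k + r ≡ suc (1 + r) + (2 + k)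
  e₃ = solve-∀
  e₄ : ∀ k r m → suc (1 + r) + (2 + k + r) + suc m ≡ 1 * suc (suc m + (3 + k + (r + r)))
  e₄ = solve-∀
  e₅ : ∀ k r m → 3 + k + r + (2 + m + r) ≡ suc (suc m + (3 + k + (r + r)))
  e₅ = solve-∀
  e₆ : ∀ k r m → 1 + suc m + (3 + k + (r + r)) ≡ 1 * suc (suc m + (3 + k + (r + r)))
  e₆ = solve-∀

-- Family A with m = 0, where one run is missing. In `good-A` the exponent m is `d + k`, so this
-- happens only for p = 2j and half the weight equal to 2.
js-A₀ : ∀ r → let p = suc (3 + (r + r)) in
  JSRuns p ((suc (2 * p) , 1) ∷ (4 + r , 2 + r) ∷ (1 , 3 + (r + r)) ∷ [])
js-A₀ r = js-∷ (suc (3 + (r + r)) + r) 2 (e₁ r) (e₂ r) z<s (s≤s (s≤s z≤n))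
  (js-∷ (2 + r) 2 (e₃ r) (e₄ r) z<s (s≤s (s≤s (s≤s (≤-trans (m≤m+n r r) (n≤1+n _)))))
  (js-last z<s z<s ≤-refl))
  where
  e₁ : ∀ r → suc (2 * suc (3 + (r + r))) ≡ suc (suc (3 + (r + r)) + r) + (4 + r)
  e₁ = solve-∀
  e₂ : ∀ r → suc (suc (3 + (r + r)) + r) + 1 + (2 + r) ≡ 2 * suc (3 + (r + r))
  e₂ = solve-∀
  e₃ : ∀ r → 4 + r ≡ suc (2 + r) + 1
  e₃ = solve-∀
  e₄ : ∀ r → suc (2 + r) + (2 + r) + (3 + (r + r)) ≡ 2 * suc (3 + (r + r))
  e₄ = solve-∀

js-half : ∀ i → let p = 4 + (i + i) in ∃ λ R → expand R ≡ replicate 2 (2 + p) ++ replicate i (4 + i)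
  × JSRuns p R
js-half zero = (6 , 2) ∷ [] , refl , js-last z<s z<s (s≤s (s≤s (s≤s z≤n)))
js-half (suc i) = (6 + (suc i + suc i) , 2) ∷ (5 + i , suc i) ∷ [] , cong
  (λ l → 6 + (suc i + suc i) ∷ 6 + (suc i + suc i) ∷ l) (++-identityʳ (replicate (suc i) (5 + i)))
  , js-∷ (2 + i) 1 (e₁ i) (e₂ i) z<s (s≤s (s≤s (s≤s z≤n)))
    (js-last z<s z<s (s≤s (≤-trans (m≤m+n (suc i) (suc i)) (m≤n+m _ 3))))
  where
  e₁ : ∀ i → 6 + (suc i + suc i) ≡ suc (2 + i) + (5 + i)
  e₁ = solve-∀
  e₂ : ∀ i → suc (2 + i) + 2 + suc i ≡ 1 * (4 + (suc i + suc i))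
  e₂ = solve-∀

js-B-tail : ∀ p q t j c → 0 < t → t < p → q + t ≡ c * p → j < q → j + j ≤ p →
  ∃ λ R → expand ((q , t) ∷ R) ≡ replicate t q ++ replicate j j × JSRuns p ((q , t) ∷ R)
js-B-tail p q t zero c 0<t t<p e j<q _ = [] , refl , js-last j<q 0<t t<p
js-B-tail p q t (suc j) c 0<t t<p e j<q 2j≤ with m≤n⇒∃[o]m+o≡n j<q
... | d , refl = (suc j , suc j) ∷ [] , cong (replicate t (suc (suc j) + d) ++_)
  (++-identityʳ (replicate (suc j) (suc j)))
  , js-∷ d c (cong suc (+-comm (suc j) d)) (trans (eq d t j) e) 0<t t<p (js-square j 2j≤)
  where
  eq : ∀ d t j → suc d + t + suc j ≡ suc (suc j) + d + t
  eq = solve-∀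

js-B : ∀ P e s t j → s + t ≡ P → 1 ≤ t → j ≤ s + P * e → j + j ≤ suc P →
  ∃ λ R → expand R ≡ familyB (suc (suc (s + P * e) * suc P)) s (suc (s + suc P * e)) t j × JSRuns (suc P) R
js-B P e s (suc t) j refl 1≤t j≤ 2j≤ with js-B-tail (suc P) (suc (s + suc P * e)) (suc t) j (suc e) z<s
  (s≤s (m≤n+m (suc t) s))
  (eq s t e) (s≤s (≤-trans j≤ (+-monoʳ-≤ s (*-monoˡ-≤ e (n≤1+n P))))) 2j≤
  where
  eq : ∀ s t e → suc (s + suc (s + suc t) * e) + suc t ≡ suc e * suc (s + suc t)
  eq = solve-∀
js-B P e zero (suc t) j refl 1≤t j≤ 2j≤ | R , R≡ , jsR = (suc (suc (P * e) * suc P) , 1) ∷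
  (suc (suc P * e) , suc t) ∷ R
  , cong (suc (suc (P * e) * suc P) ∷_) R≡
  , js-∷ (P + t * e * suc P) (2 + t * e) (e₁ t e) (e₂ t e) z<s (s≤s (s≤s z≤n)) jsR
  where
  e₁ : ∀ t e → suc (suc (suc t * e) * suc (suc t)) ≡ suc (suc t + t * e * suc (suc t)) + suc (suc (suc t) * e)
  e₁ = solve-∀
  e₂ : ∀ t e → suc (suc t + t * e * suc (suc t)) + 1 + suc t ≡ (2 + t * e) * suc (suc t)
  e₂ = solve-∀
js-B P e (suc s) (suc t) j refl 1≤t j≤ 2j≤ | R , R≡ , jsR =
  (suc (suc (suc s + P * e) * suc P) , 1) ∷ (suc q , suc s) ∷ (q , suc t) ∷ R
  , cong (suc (suc (suc s + P * e) * suc P) ∷_) (trans (cong (replicate (suc s) (suc q) ++_) R≡)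
    (sym (++-assoc (replicate (suc s) (suc q)) (replicate (suc t) q) (replicate j j))))
  , js-∷ (s + suc t + suc s * P + (suc s + t) * e * suc P) (suc (suc s) + (suc s + t) * e) (e₁ s t e)
    (e₂ s t e) z<s
      (s≤s (s≤s z≤n))
    (js-∷ 0 1 refl (cong suc (sym (+-identityʳ P))) z<s (s≤s (m≤m+n (suc s) _)) jsR)
  where
  q = suc (suc s + suc P * e)
  e₁ : ∀ s t e → suc (suc (suc s + (suc s + suc t) * e) * suc (suc s + suc t))
    ≡ suc (s + suc t + suc s * (suc s + suc t) + (suc s + t) * e * suc (suc s + suc t)) + suc
      (suc (suc s + suc (suc s + suc t) * e))
  e₁ = solve-∀
  e₂ : ∀ s t e → suc (s + suc t + suc s * (suc s + suc t) + (suc s + t) * e * suc (suc s + suc t)) + 1 + suc s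
    ≡ (suc (suc s) + (suc s + t) * e) * suc (suc s + suc t)
  e₂ = solve-∀

-- Hooks leading down to the square

firstPart-block≤ : ∀ a {l b xs} → l ≤ b → firstPart xs ≤ b → firstPart (replicate a l ++ xs) ≤ b
firstPart-block≤ zero _ le = le
firstPart-block≤ (suc a) le _ = le

firstPart-square : ∀ j → firstPart (replicate j j) ≡ j
firstPart-square zero = refl
firstPart-square (suc j) = refl

partition-∷ : ∀ {l xs} → 0 < l → firstPart xs ≤ l → IsPartition xs → IsPartition (l ∷ xs)
partition-∷ {xs = []} 0<l _ _ = [-] , 0<l ∷ []
partition-∷ {xs = x ∷ xs} 0<l le (lk , pos) = le ∷ lk , 0<l ∷ pos

partition-block : ∀ a {l xs} → 0 < l → firstPart xs ≤ l → IsPartition xs → IsPartition (replicate a l ++ xs)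
partition-block zero _ _ q = q
partition-block (suc a) 0<l le q = partition-∷ 0<l (firstPart-block≤ a ≤-refl le) (partition-block a 0<l le q)

partition-square-++ : ∀ j {xs} → firstPart xs ≤ j → IsPartition xs → IsPartition (replicate j j ++ xs)
partition-square-++ zero _ q = q
partition-square-++ (suc j) le q = partition-block (suc j) z<s le q

partition-square : ∀ j → IsPartition (replicate j j)
partition-square j = subst IsPartition (++-identityʳ _) (partition-square-++ j z≤n ([] , []))

replicate-+ : ∀ m n (x : ℕ) → replicate (m + n) x ≡ replicate m x ++ replicate n x
replicate-+ zero n x = refl
replicate-+ (suc m) n x = cong (x ∷_) (replicate-+ m n x)

-- A block that vanishes for κ = 0, where `replicate n 0` would not be a partition.
rows⁺ : ℕ → ℕ → List ℕ
rows⁺ n zero = []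
rows⁺ n κ@(suc _) = replicate n κ

rows⁺-square : ∀ j → rows⁺ j j ≡ replicate j j
rows⁺-square zero = refl
rows⁺-square (suc j) = refl

firstPart-rows⁺ : ∀ n κ → firstPart (rows⁺ n κ) ≤ κ
firstPart-rows⁺ n zero = z≤n
firstPart-rows⁺ zero (suc κ) = z≤n
firstPart-rows⁺ (suc n) (suc κ) = ≤-refl

partition-rows⁺ : ∀ n κ → IsPartition (rows⁺ n κ)
partition-rows⁺ n zero = [] , []
partition-rows⁺ n (suc κ) = subst IsPartition (++-identityʳ _) (partition-block n z<s z≤n ([] , []))

part-++-cong : ∀ xs {ys zs} → (∀ i → part ys i ≡ part zs i) → ∀ i → part (xs ++ ys) i ≡ part (xs ++ zs) i
part-++-cong [] h i = h i
part-++-cong (x ∷ xs) h zero = refl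
part-++-cong (x ∷ xs) h (suc i) = part-++-cong xs h i

part-rows⁺ : ∀ n κ i → part (rows⁺ n κ) i ≡ part (replicate n κ) i
part-rows⁺ n (suc κ) i = refl
part-rows⁺ zero zero i = refl
part-rows⁺ (suc n) zero zero = refl
part-rows⁺ (suc n) zero (suc i) = part-rows⁺ n zero i

part-++-0 : ∀ xs i → part ((xs ++ 0 ∷ []) ++ []) i ≡ part xs i
part-++-0 [] zero = refl
part-++-0 [] (suc i) = refl
part-++-0 (x ∷ xs) zero = refl
part-++-0 (x ∷ xs) (suc i) = part-++-0 xs i

hook : ∀ {p y xs ys} α zs → Seg (firstPart zs) y xs ys p → IsPartition (α ++ ys ++ zs) →
  RemoveHook p (α ++ xs ++ zs) (α ++ ys ++ zs)
hook α zs s q = removeHook α zs _ s refl q λ _ → refl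

-- Under the square stand p rows of length κ. Their last column is a vertical hook of p nodes; it is
-- removed κ times.
square-column : ∀ P j κ → κ ≤ j → Star (RemoveHook (suc P)) (replicate j j ++ rows⁺ (suc P) κ) (replicate j j)
square-column P j zero _ = subst (λ l → Star (RemoveHook (suc P)) l (replicate j j))
  (sym (++-identityʳ (replicate j j))) ε
square-column P j (suc κ) κ<j = subst (λ l → RemoveHook (suc P) (replicate j j ++ l)
  (replicate j j ++ rows⁺ (suc P) κ)) (++-identityʳ (replicate (suc P) (suc κ)))
    (removeHook (replicate j j) [] _ (castSeg refl (replicate-∷ʳ P κ) (+-comm P 1)
      (seg-block {d = 0} P refl z≤n)) refl
      (partition-square-++ j (≤-trans (firstPart-rows⁺ (suc P) κ) (<⇒≤ κ<j)) (partition-rows⁺ (suc P) κ))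
      (part-++-cong (replicate j j) λ i → trans (part-rows⁺ (suc P) κ i)
        (cong (λ l → part l i) (sym (++-identityʳ (replicate (suc P) κ))))))
  ◅ square-column P j κ (<⇒≤ κ<j)

strip-first-row : ∀ P k rest → IsPartition rest → firstPart rest ≤ suc (suc P) →
  Star (RemoveHook (suc P)) (suc (suc k * suc P) ∷ rest) (suc (suc P) ∷ rest)
strip-first-row P zero rest _ _ = subst (λ x → Star (RemoveHook (suc P)) (suc (suc x) ∷ rest)
  (suc (suc P) ∷ rest)) (sym (+-identityʳ P)) ε
strip-first-row P (suc k) rest q le =
  hook [] rest (seg-first-row P (suc k) (≤-trans le≤ (n≤1+n _))) (partition-∷ z<s le≤ q)
    ◅ strip-first-row P k rest q le
  where
  le≤ : firstPart rest ≤ suc (suc k * suc P)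
  le≤ = ≤-trans le (s≤s (m≤m+n (suc P) _))

-- First K horizontal hooks shorten the top row to p + 1. One hook turns ((p+1), (j+2)^j) into the
-- square of side j + 1. The next runs through this square and the m rows below it, and leaves (j^j)
-- above p rows of length κ; it has p nodes because n + κ = 2j. The columns go last.
core-A : ∀ P K j m n κ → m + n ≡ P → n + suc κ ≡ suc (j + j) → κ ≤ j → j ≤ P →
  Star (RemoveHook (suc P)) (suc (suc K * suc P) ∷ ((replicate j (2 + j) ++ replicate m (suc κ)) ++ rows⁺ n κ))
    (replicate j j)
core-A P K j m n κ mn nκ κ≤j j≤P = strip-first-row P K rest₀
    (subst IsPartition (sym assoc)
      (partition-block j z<s (≤-trans tail≤ (s≤s (≤-trans κ≤j (n≤1+n j)))) tail-part))
    (subst (λ l → firstPart l ≤ 2 + P) (sym assoc) (firstPart-block≤ j (s≤s (s≤s j≤P))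
      (≤-trans tail≤ (s≤s (≤-trans κ≤j (≤-trans j≤P (n≤1+n P)))))))
  ◅◅ subst (λ l → RemoveHook p (suc p ∷ l) (replicate (suc j) (suc j) ++ tail)) (sym assoc)
       (hook [] tail (seg-first-block p (P ∸ j) j (cong suc (sym (m∸n+n≡m j≤P)))
         (≤-trans tail≤ (s≤s (≤-trans κ≤j (n≤1+n j)))))
         (partition-block (suc j) z<s (≤-trans tail≤ (s≤s κ≤j)) tail-part))
  ◅ subst (λ l → RemoveHook p l (replicate j j ++ rows⁺ p κ)) (++-assoc (replicate (suc j) (suc j)) _ _)
       (removeHook [] (rows⁺ n κ) (replicate j j ++ rows⁺ p κ)
         (castSeg refl refl count≡ (seg-two-blocks {d = j ∸ κ} j m d≡
           (≤-trans (firstPart-rows⁺ n κ) (n≤1+n κ)))) refl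
         (partition-square-++ j (≤-trans (firstPart-rows⁺ p κ) κ≤j) (partition-rows⁺ p κ))
         λ i → trans (part-++-cong (replicate j j) (λ i → trans (part-rows⁺ p κ i) (trans
            (cong (λ l → part l i) (trans (cong (λ x → replicate x κ) (cong suc (sym mn)))
              (replicate-+ (suc m) n κ)))
            (sym (part-++-cong (replicate (suc m) κ) (part-rows⁺ n κ) i)))) i)
            (cong (λ l → part l i) (sym (++-assoc (replicate j j) _ _))))
  ◅ square-column P j κ κ≤j
  where
  p = suc P
  tail = replicate m (suc κ) ++ rows⁺ n κ
  rest₀ = (replicate j (2 + j) ++ replicate m (suc κ)) ++ rows⁺ n κ
  assoc : rest₀ ≡ replicate j (2 + j) ++ tail
  assoc = ++-assoc (replicate j (2 + j)) _ _
  tail≤ : firstPart tail ≤ suc κ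
  tail≤ = firstPart-block≤ m ≤-refl (≤-trans (firstPart-rows⁺ n κ) (n≤1+n κ))
  tail-part : IsPartition tail
  tail-part = partition-block m z<s (≤-trans (firstPart-rows⁺ n κ) (n≤1+n κ)) (partition-rows⁺ n κ)
  d≡ : suc j ≡ j ∸ κ + suc κ
  d≡ = trans (cong suc (sym (m∸n+n≡m κ≤j))) (sym (+-suc _ κ))
  count≡ : j + (suc (j ∸ κ) + m) ≡ suc P
  count≡ = +-cancelʳ-≡ κ _ _ (begin
    j + (suc (j ∸ κ) + m) + κ  ≡⟨ e₁ j (j ∸ κ) m κ ⟩
    j + suc (j ∸ κ + κ) + m    ≡⟨ cong (λ x → j + suc x + m) (m∸n+n≡m κ≤j) ⟩
    j + suc j + m              ≡⟨ cong (_+ m) (trans (+-suc j j) (sym nκ)) ⟩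
    n + suc κ + m              ≡⟨ e₂ n κ m ⟩
    suc (m + n) + κ            ≡⟨ cong (λ x → suc x + κ) mn ⟩
    suc P + κ                  ∎)
    where
    open ≡-Reasoning
    e₁ : ∀ j d m κ → j + (suc d + m) + κ ≡ j + suc (d + κ) + m
    e₁ = solve-∀
    e₂ : ∀ n κ m → n + suc κ + m ≡ suc (m + n) + κ
    e₂ = solve-∀

half< : ∀ P j → 2 ≤ P → j + j ≤ suc P → j < P
half< P j 2≤P 2j≤ with <-≤-connex j P
... | inj₁ j<P = j<P
... | inj₂ P≤j = contradiction (+-cancelʳ-≤ P P 1 (≤-trans (+-mono-≤ P≤j P≤j) 2j≤)) (<⇒≱ 2≤P)

-- The hooks are the second p-segments from `fixed-B`, removed while the top row and the square stay
-- in place. They lead to e = 0 and s = j, where `core-A` takes over.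
core-B : ∀ P e s t j K → s + t ≡ P → 2 ≤ P → j ≤ s + P * e → j + j ≤ suc P →
  2 + (s + suc P * e) ≤ suc (suc K * suc P) →
  Star (RemoveHook (suc P)) (familyB (suc (suc K * suc P)) s (suc (s + suc P * e)) t j) (replicate j j)
core-B P e s t j K st 2≤P j≤ 2j≤ q≤ = go e s t st j≤ q≤
  where
  p = suc P
  x = suc (suc K * p)
  j<P = half< P j 2≤P 2j≤
  reduce : ∀ {mid mid′ y} → Seg j y mid mid′ p →
    (IsPartition (replicate j j) → IsPartition (mid′ ++ replicate j j)) →
    firstPart (mid′ ++ replicate j j) ≤ x → RemoveHook p (x ∷ (mid ++ replicate j j))
      (x ∷ (mid′ ++ replicate j j))
  reduce {mid} {mid′} seg q le = hook (x ∷ []) (replicate j j)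
    (subst (λ h → Seg h _ mid mid′ p) (sym (firstPart-square j)) seg)
    (partition-∷ z<s le (q (partition-square j)))
  next : ∀ e s t → suc s + t ≡ P → j ≤ s + P * e → 2 + (suc s + p * e) ≤ x →
    RemoveHook p (familyB x (suc s) (suc (suc s + p * e)) t j) (familyB x s (suc (s + p * e)) (suc t) j)
  next e s t st j≤ q≤ = reduce
      (castSeg refl refl (trans (+-suc s (suc t)) (cong suc (trans (+-suc s t) st)))
        (seg-two-blocks {d = 1} s t refl (≤-trans j≤q (n≤1+n _))))
      (λ sq → subst IsPartition (sym (++-assoc (replicate s (suc q)) (replicate (suc t) q) (replicate j j)))
        (partition-block s z<s (n≤1+n q)
          (partition-block (suc t) z<s (≤-trans (≤-reflexive (firstPart-square j)) j≤q) sq)))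
      (subst (λ l → firstPart l ≤ x)
        (sym (++-assoc (replicate s (suc q)) (replicate (suc t) q) (replicate j j)))
        (firstPart-block≤ s (≤-trans (n≤1+n _) q≤) (≤-trans (n≤1+n _) (≤-trans (n≤1+n _) q≤))))
    where
    q = suc (s + p * e)
    j≤q : j ≤ q
    j≤q = ≤-trans j≤ (≤-trans (+-monoʳ-≤ s (*-monoˡ-≤ e (n≤1+n P))) (n≤1+n _))
  go₀ : ∀ s t → s + t ≡ P → j ≤ s → 2 + (s + p * 0) ≤ x →
    Star (RemoveHook p) (familyB x s (suc (s + p * 0)) t j) (replicate j j)
  go₀ s t st j≤ q≤ with s ≟ j
  go₀ (suc s) t st j≤ q≤ | no s≢j = next 0 s t st (≤-trans j≤s (m≤m+n s _)) q≤
      ◅ go₀ s (suc t) (trans (+-suc s t) st) j≤s (≤-trans (n≤1+n _) q≤)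
    where
    j≤s : j ≤ s
    j≤s = s≤s⁻¹ (≤∧≢⇒< j≤ (s≢j ∘ sym))
  go₀ zero t st j≤ q≤ | no s≢j = contradiction (sym (n≤0⇒n≡0 j≤)) s≢j
  -- Here q = j + 1, and below the top row lie ((j+2)^j, (j+1)^t, j^j): the shape treated in
  -- `core-A` with κ = n = j.
  go₀ .j t st j≤ q≤ | yes refl = subst₂
    (λ q l → Star (RemoveHook p) (x ∷ ((replicate j (suc q) ++ replicate t q) ++ l)) (replicate j j))
    (cong suc (sym (trans (cong (j +_) (*-zeroʳ P)) (+-identityʳ j)))) (rows⁺-square j)
    (core-A P K j t j j (trans (+-comm t j) st) (+-suc j j) ≤-refl (<⇒≤ j<P))
  go : ∀ e s t → s + t ≡ P → j ≤ s + P * e → 2 + (s + p * e) ≤ x →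
    Star (RemoveHook p) (familyB x s (suc (s + p * e)) t j) (replicate j j)
  go zero s t st j≤ q≤ = go₀ s t st (subst (j ≤_) (trans (cong (s +_) (*-zeroʳ P)) (+-identityʳ s)) j≤) q≤
  go (suc e) (suc s) t st j≤ q≤ = next (suc e) s t st j≤′ q≤ ◅ go (suc e) s (suc t) (trans (+-suc s t) st) j≤′
    (≤-trans (n≤1+n _) q≤)
    where
    j≤′ : j ≤ s + P * suc e
    j≤′ = ≤-trans (<⇒≤ j<P) (≤-trans (m≤m*n P (suc e)) (m≤n+m _ s))
  go (suc e) zero zero st _ _ = contradiction 2≤P (subst (λ k → ¬ 2 ≤ k) st λ ())
  go (suc e) zero (suc t) refl j≤ q≤ = reduce
      (castSeg (cong (λ k → replicate P (suc k)) (sym (*-suc p e))) refl (+-comm t 2)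
        (seg-block {d = 1} t refl (≤-trans j≤q (n≤1+n _))))
      (λ sq → subst IsPartition (sym (++-assoc (replicate t (suc q)) (q ∷ []) (replicate j j)))
        (partition-block t z<s (n≤1+n q) (partition-∷ z<s (≤-trans (≤-reflexive (firstPart-square j)) j≤q) sq)))
      (subst (λ l → firstPart l ≤ x) (sym (++-assoc (replicate t (suc q)) (q ∷ []) (replicate j j)))
        (firstPart-block≤ t (≤-trans (n≤1+n _) (≤-trans (n≤1+n _) q≤′))
          (≤-trans (n≤1+n _) (≤-trans (n≤1+n _) (≤-trans (n≤1+n _) q≤′)))))
    ◅ go e t 1 (+-comm t 1) (≤-trans (s≤s⁻¹ j<P) (m≤m+n t _)) (≤-trans (n≤1+n _) (≤-trans (n≤1+n _) q≤′))
    where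
    q = suc (t + p * e)
    q≤′ : 3 + q ≤ x
    q≤′ = subst (λ k → 2 + k ≤ x) (*-suc p e) q≤
    j≤q : j ≤ q
    j≤q = ≤-trans (s≤s⁻¹ j<P) (≤-trans (m≤m+n t _) (n≤1+n _))

core-half : ∀ i → let p = 4 + (i + i) in Star (RemoveHook p) (replicate 2 (2 + p) ++ replicate i (4 + i))
  (replicate (2 + i) (2 + i))
core-half i = subst (λ l → RemoveHook p l (suc p ∷ replicate (suc i) (3 + i))) (++-identityʳ rows)
    (removeHook [] [] _ (castSeg refl refl (e₁ i) (seg-two-blocks {d = 2 + i} 1 i (e₂ i) z≤n)) refl
      (partition-∷ z<s (s≤s (s≤s (s≤s (≤-trans (m≤m+n i i) (m≤n+m _ 2))))) (subst IsPartition (++-identityʳ _)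
        (partition-block (suc i) z<s z≤n ([] , []))))
      λ k → cong (λ l → part l k) (sym (++-identityʳ (suc p ∷ replicate (suc i) (3 + i)))))
  ◅ subst (λ l → RemoveHook p l (replicate (2 + i) (2 + i))) (++-identityʳ _)
    (removeHook [] [] _ (castSeg refl refl (e₃ i) (seg-two-blocks {d = 2 + i} 0 (suc i) (e₄ i) z≤n)) refl
      (partition-square (2 + i)) λ k → cong (λ l → part l k) (sym (++-identityʳ (replicate (2 + i) (2 + i)))))
  ◅ ε
  where
  p = 4 + (i + i)
  rows = replicate 2 (2 + p) ++ replicate i (4 + i)
  e₁ : ∀ i → 1 + (suc (2 + i) + i) ≡ 4 + (i + i)
  e₁ = solve-∀
  e₂ : ∀ i → 6 + (i + i) ≡ 2 + i + suc (3 + i)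
  e₂ = solve-∀
  e₃ : ∀ i → suc (2 + i) + suc i ≡ 4 + (i + i)
  e₃ = solve-∀
  e₄ : ∀ i → 5 + (i + i) ≡ 2 + i + suc (2 + i)
  e₄ = solve-∀

-- The rim of the square has 2j - 1 nodes. If p < 2j, its last p nodes form a hook: inside the last
-- row if p ≤ j, otherwise in the last p - j + 1 rows.
core⇒2j≤p : ∀ P j → IsPCore (suc P) (replicate j j) → j + j ≤ suc P
core⇒2j≤p P j (_ , none) with <-≤-connex (suc P) (j + j)
... | inj₂ le = le
core⇒2j≤p P (suc i) (_ , none) | inj₁ p<2j with <-≤-connex P (suc i)
core⇒2j≤p P (suc i) (_ , none) | inj₁ p<2j | inj₁ p≤j with m≤n⇒∃[o]m+o≡n p≤j
... | y , e = contradiction (subst (λ l → RemoveHook (suc P) l (replicate i (suc i) ++ rows⁺ 1 y))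
  (replicate-∷ʳ i (suc i))
  (removeHook (replicate i (suc i)) [] (replicate i (suc i) ++ rows⁺ 1 y) (end {y = y} P (sym e) z≤n) refl
    (partition-block i z<s (≤-trans (firstPart-rows⁺ 1 y) (subst (y ≤_) e (m≤n+m y (suc P))))
      (partition-rows⁺ 1 y))
    (part-++-cong (replicate i (suc i)) (part-rows⁺ 1 y)))) (none _)
core⇒2j≤p P (suc i) (_ , none) | inj₁ p<2j | inj₂ j≤P with m≤n⇒∃[o]m+o≡n j≤P
... | a , refl with m≤n⇒∃[o]m+o≡n (+-cancelˡ-< (suc i) (suc a) (suc i)
  (subst (_< suc i + suc i) (sym (+-suc (suc i) a)) p<2j))
... | b , e = contradiction (subst (λ l → RemoveHook (suc P) l (replicate b (suc i) ++ rows⁺ (suc a) i))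
  (trans (cong (replicate b (suc i) ++_) (++-identityʳ _)) rows≡)
  (removeHook (replicate b (suc i)) [] (replicate b (suc i) ++ rows⁺ (suc a) i)
    (castSeg refl refl (cong suc (+-comm a (suc i)))
      (seg-block {d = i} (suc a) (cong suc (sym (+-identityʳ i))) z≤n)) refl
    (partition-block b z<s (≤-trans (firstPart-rows⁺ (suc a) i) (n≤1+n i)) (partition-rows⁺ (suc a) i))
    (part-++-cong (replicate b (suc i)) λ k → trans (part-rows⁺ (suc a) i k)
      (sym (part-++-0 (replicate (suc a) i) k))))) (none _)
  where
  rows≡ : replicate b (suc i) ++ replicate (2 + a) (suc i) ≡ replicate (suc i) (suc i)
  rows≡ = trans (sym (replicate-+ b (2 + a) (suc i))) (cong (λ n → replicate n (suc i)) (trans (+-comm b _) e))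

-- Existence

sum-three-blocks : ∀ x s t u a b c → sum (x ∷ ((replicate s a ++ replicate t b) ++ replicate u c))
  ≡ x + (s * a + t * b + u * c)
sum-three-blocks x s t u a b c = cong (x +_) (trans (sum-++ (replicate s a ++ replicate t b) _)
  (cong₂ _+_ (trans (sum-++ (replicate s a) _) (cong₂ _+_ (sum-replicate s a) (sum-replicate t b)))
    (sum-replicate u c)))

good-square : ∀ {p} j → j + j ≤ p → IsPCore p (square j) → GoodPartition p 0 (square j) (square j)
good-square {p} zero le core = good {R = []} 0 refl (jsRuns [] [] [] []) (fixed-square 0 le) ε core
  (sym (*-zeroʳ p))
good-square {p} (suc j) le core = good 0 (++-identityʳ _) (js-square j le) (fixed-square (suc j) le) ε core
  (sym (trans (cong (sum (square (suc j)) +_) (*-zeroʳ p)) (+-identityʳ _)))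

good-weight-two : ∀ i m → let j = suc i; p = suc (suc m + (j + j)) in IsPCore p (square j) →
  GoodPartition p 2 (square j) (suc p ∷ (replicate j (2 + j) ++ replicate (suc m) 1))
good-weight-two i m core = good 2 (cong (λ l → suc p ∷ (replicate j (2 + j) ++ l))
  (++-identityʳ (replicate (suc m) 1))) (js-weight-two i m) (fixed-weight-two j m refl)
  (subst (λ l → Star (RemoveHook p) l (square j)) (cong₂ _∷_ (cong suc (+-identityʳ p))
    (++-identityʳ (replicate j (2 + j) ++ replicate (suc m) 1)))
    (core-A (suc m + (j + j)) 0 j (suc m) (j + j) 0 refl (+-comm (j + j) 1) z≤n
      (≤-trans (m≤m+n j j) (m≤n+m (j + j) (suc m)))))
  core
  (trans (cong (suc p +_) (trans (sum-++ (replicate j (2 + j)) _) (cong₂ _+_ (sum-replicate j (2 + j))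
    (sum-replicate (suc m) 1))))
    (trans (e i m) (cong (_+ p * 2) (sym (sum-replicate j j)))))
  where
  j = suc i
  p = suc (suc m + (j + j))
  e : ∀ i m → suc (suc (suc m + (suc i + suc i))) + (suc i * (2 + suc i) + suc m * 1)
    ≡ suc i * suc i + suc (suc m + (suc i + suc i)) * 2
  e = solve-∀

good-half : ∀ i → let j = 2 + i; p = 4 + (i + i) in IsPCore p (square j) →
  GoodPartition p 2 (square j) (replicate 2 (2 + p) ++ replicate i (4 + i))
good-half i core with js-half i
... | R , R≡ , jsR = good 2 R≡ jsR (fixed-half i) (core-half i) core
  (trans (sum-++ (replicate 2 (6 + (i + i))) (replicate i (4 + i)))
    (trans (cong₂ _+_ (sum-replicate 2 (6 + (i + i))) (sum-replicate i (4 + i)))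
    (trans (e i) (cong (_+ (4 + (i + i)) * 2) (sym (sum-replicate (2 + i) (2 + i)))))))
  where
  e : ∀ i → 2 * (6 + (i + i)) + i * (4 + i) ≡ (2 + i) * (2 + i) + (4 + (i + i)) * 2
  e = solve-∀

-- `d` is p - 2j and `2 + k` is half the weight. The exponent m = `d + k` is then forced by p = m +
-- n + 1.
good-A : ∀ d k r → let j = 2 + k + r; p = (j + j) + d in IsPCore p (square j) →
  GoodPartition p ((2 + k) * 2) (square j) (familyA p k r (d + k))
good-A d k r core = go (d + k) refl
  where
  j = 2 + k + r
  p = (j + j) + d
  P = (1 + k + r) + j + d
  P≡ : P ≡ d + k + (3 + k + (r + r))
  P≡ = e d k r
    where
    e : ∀ d k r → (1 + k + r) + (2 + k + r) + d ≡ d + k + (3 + k + (r + r))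
    e = solve-∀
  weight : sum (familyA p k r (d + k)) ≡ sum (square j) + p * ((2 + k) * 2)
  weight = trans (sum-three-blocks (suc ((2 + k) * p)) j (d + k) (3 + k + (r + r)) (4 + k + r) (2 + k) (1 + k))
    (trans (e d k r) (cong (_+ p * ((2 + k) * 2)) (sym (sum-replicate j j))))
    where
    e : ∀ d k r → suc ((2 + k) * (2 + k + r + (2 + k + r) + d)) +
        ((2 + k + r) * (4 + k + r) + (d + k) * (2 + k) + (3 + k + (r + r)) * (1 + k))
      ≡ (2 + k + r) * (2 + k + r) + (2 + k + r + (2 + k + r) + d) * ((2 + k) * 2)
    e = solve-∀
  chain : Star (RemoveHook p) (familyA p k r (d + k)) (square j)
  chain = core-A P (1 + k) j (d + k) (3 + k + (r + r)) (1 + k) (sym P≡) (e k r)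
    (≤-trans (n≤1+n _) (m≤m+n (2 + k) r))
    (≤-trans (m≤n+m j (1 + k + r)) (m≤m+n _ d))
    where
    e : ∀ k r → 3 + k + (r + r) + suc (1 + k) ≡ suc ((2 + k + r) + (2 + k + r))
    e = solve-∀
  go : ∀ m → d + k ≡ m → GoodPartition p ((2 + k) * 2) (square j) (familyA p k r (d + k))
  go zero e with m+n≡0⇒m≡0 d e | m+n≡0⇒n≡0 d e
  ... | refl | refl = good 4
    (cong (λ l → suc (2 * p) ∷ l) (trans (cong (replicate (2 + r) (4 + r) ++_) (++-identityʳ _))
                             (cong (_++ replicate (3 + (r + r)) 1)
                               (sym (++-identityʳ (replicate (2 + r) (4 + r)))))))
                        (subst (λ p → JSRuns p ((suc (2 * p) , 1) ∷ (4 + r , 2 + r) ∷ (1 , 3 + (r + r)) ∷ []))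
                          (sym (cong suc P≡)) (js-A₀ r))
                        (fixed-A P k r 0 P≡ z≤n) chain core weight
  go (suc m) e = good ((2 + k) * 2)
    (cong (λ l → suc ((2 + k) * p) ∷ l) (trans
      (cong₂ (λ l m → replicate j (4 + k + r) ++ (replicate m (2 + k) ++ l))
        (++-identityʳ (replicate (3 + k + (r + r)) (1 + k))) (sym e))
      (sym (++-assoc (replicate j (4 + k + r)) _ _))))
    (subst (λ p → JSRuns p ((suc ((2 + k) * p) , 1) ∷ (4 + k + r , j) ∷ (2 + k , suc m) ∷
      (1 + k , 3 + k + (r + r)) ∷ []))
      (sym (cong suc (trans P≡ (cong (_+ (3 + k + (r + r))) e)))) (js-A k r m))
    (fixed-A P k r (d + k) P≡ (m≤n+m k d)) chain core weight

good-B : ∀ s t e j → let P = s + suc t; p = suc P; k = s + P * e in 2 ≤ P → j ≤ k → IsPCore p (square j) →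
  GoodPartition p (suc k * 2) (square j) (familyB (suc (suc k * p)) s (suc (s + p * e)) (suc t) j)
good-B s t e j 2≤P j≤k core with js-B (s + suc t) e s (suc t) j refl (s≤s z≤n) j≤k
  (core⇒2j≤p (s + suc t) j core)
... | R , R≡ , jsR = good (suc k * 2) R≡ jsR (fixed-B P e s (suc t) j refl (s≤s z≤n) j≤k 2j≤p)
  (core-B P e s (suc t) j k refl 2≤P j≤k 2j≤p (s≤s (q≤kp P e s (≤-trans (n≤1+n 1) 2≤P)))) core
  (trans (sum-three-blocks (suc (suc k * suc P)) s (suc t) j (suc (suc (s + suc P * e)))
    (suc (s + suc P * e)) j)
    (trans (eq s t e j) (cong (_+ suc P * (suc k * 2)) (sym (sum-replicate j j)))))
  where
  P = s + suc t
  k = s + P * e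
  2j≤p = core⇒2j≤p P j core
  eq : ∀ s t e j → suc (suc (s + (s + suc t) * e) * suc (s + suc t)) +
      (s * suc (suc (s + suc (s + suc t) * e)) + suc t * suc (s + suc (s + suc t) * e) + j * j)
    ≡ j * j + suc (s + suc t) * (suc (s + (s + suc t) * e) * 2)
  eq = solve-∀

-- Supplies s and e for family B from k - 1 = s + (p - 1)e. As s < p - 1, at least one part equals
-- q.
divide : ∀ P c → 0 < P → ∃ λ s → ∃₂ λ t e → s + suc t ≡ P × c ≡ s + P * e
divide P@(suc _) c _ with m≤n⇒∃[o]m+o≡n (m%n<n c P)
... | t , st = c % P , t , c / P , trans (+-suc _ t) st
  , trans (m≡m%n+[m/n]*n c P) (cong (c % P +_) (*-comm (c / P) P))

existence : ∀ P c j → 2 ≤ P → IsPCore (suc P) (square j) → ¬ Exceptional (suc P) (c * 2) (square j) →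
  Σ (List ℕ) (GoodPartition (suc P) (c * 2) (square j))
existence P zero j 2≤P core _ = _ , good-square j (core⇒2j≤p P j core) core
existence P (suc c) j 2≤P core ¬ex with <-≤-connex c j
-- Half the weight is k = `suc c`, so j ≤ c means k > j.
existence P (suc c) j 2≤P core ¬ex | inj₂ j≤c with divide P c (≤-trans (n≤1+n 1) 2≤P)
... | s , t , e , refl , refl = _ , good-B s t e j 2≤P j≤c core
existence P (suc c) j 2≤P core ¬ex | inj₁ c<j with m≤n⇒∃[o]m+o≡n (core⇒2j≤p P j core)
existence P (suc (suc k)) j 2≤P core ¬ex | inj₁ c<j | d , e with m≤n⇒∃[o]m+o≡n c<j
... | r , refl with e
... | refl = _ , good-A d k r core
-- For k = 1 the difference p - 2j decides: at least 2 allows the general family, 1 is the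
-- exception, and 0 needs its own partition.
existence P (suc zero) (suc i) 2≤P core ¬ex | inj₁ _ | suc (suc m) , e with trans (sym e)
  (+-comm (suc i + suc i) (suc (suc m)))
... | refl = _ , good-weight-two i m core
existence P (suc zero) (suc i) 2≤P core ¬ex | inj₁ _ | suc zero , e =
  contradiction (refl , suc i , trans (cong (λ x → suc i + x + 1) (+-identityʳ (suc i))) e , refl) ¬ex
-- Here j = 1 and p = 2j = 2, which is excluded.
existence P (suc zero) (suc zero) 2≤P core ¬ex | inj₁ _ | zero , refl = contradiction 2≤P λ { (s≤s ()) }
existence P (suc zero) (suc (suc i)) 2≤P core ¬ex | inj₁ _ | zero , e with trans (sym e) (eq i)
  where
  eq : ∀ i → suc (suc i) + suc (suc i) + 0 ≡ 4 + (i + i)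
  eq = solve-∀
... | refl = _ , good-half i core

-- Non-existence: the p-rim in terms of runs

runs-spec : ∀ la → IsPartition la → expand (runs la) ≡ la × Linked _⊳_ (runs la) × All IsRun (runs la)
runs-spec [] _ = refl , [] , []
runs-spec (x ∷ xs) (lk , 0<x ∷ pos) with runs xs | runs-spec xs (linked-tail lk , pos)
... | [] | refl , _ , _ = refl , [-] , (0<x , z<s) ∷ []
... | (y , suc k) ∷ R | refl , dec , (_ , _) ∷ run with x ≡ᵇ y in q
...   | true with ≡ᵇ⇒≡ x y (subst T (sym q) tt)
...     | refl = refl , same dec , (0<x , z<s) ∷ run
  where
  same : ∀ {l a b R} → Linked _⊳_ ((l , a) ∷ R) → Linked _⊳_ ((l , b) ∷ R)
  same [-] = [-]
  same (lt ∷ lk) = lt ∷ lk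
runs-spec (x ∷ xs) (y≤x ∷ lk , 0<x ∷ pos) | (y , suc k) ∷ R | refl , dec , 0<y ∷ run | false =
  refl , ≤∧≢⇒< y≤x (λ { refl → subst T q (≡⇒≡ᵇ x x refl) }) ∷ dec , (0<x , z<s) ∷ 0<y ∷ run

-- The p-rim of a Jantzen–Seitz partition: a p-segment covers either one run of equal
-- parts or two of them.

data JSRim (p : ℕ) : List (ℕ × ℕ) → ℕ → Set where
  small : ∀ {l a A} → suc A ≡ l + a → A < p → JSRim p ((l , a) ∷ []) A
  big   : ∀ {l a} → p < l + a → JSRim p ((l , a) ∷ []) p
  pair₀ : ∀ {d l a b} → d + a + b ≡ p → JSRim p ((d + l , a) ∷ (l , b) ∷ []) p
  pair  : ∀ {d l a b e c x R A} → d + a + b ≡ p → 0 < e → e + b + c ≡ x * p → 0 < x → JSRim p ((l , c) ∷ R) A →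
          JSRim p ((d + (e + l) , a) ∷ (e + l , b) ∷ (l , c) ∷ R) (p + A)
  sing  : ∀ {d l a b x R A} → d + a + b ≡ x * p → 2 ≤ x → JSRim p ((l , b) ∷ R) A →
          JSRim p ((d + l , a) ∷ (l , b) ∷ R) (p + A)

js-tail : ∀ {p r R} → JSRuns p (r ∷ R) → JSRuns p R
js-tail (jsRuns dec (_ ∷ run) (_ ∷ reg) js) = jsRuns (linked-tail dec) run reg (linked-tail js)

js-step : ∀ {p l₁ a₁ l₂ a₂ R} → JSRuns p ((l₁ , a₁) ∷ (l₂ , a₂) ∷ R) →
  ∃ λ d → ∃ λ (x : ℕ) → d + l₂ ≡ l₁ × 0 < d × d + a₁ + a₂ ≡ x * p × 0 < x
js-step {p} {l₁} {a₁} {l₂} {a₂} (jsRuns (lt ∷ _) ((_ , 0<a) ∷ _) _ (divides x e ∷ _)) =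
  l₁ ∸ l₂ , x , m∸n+n≡m (<⇒≤ lt) , m<n⇒0<n∸m lt , e , 0<x x e
  where
  0<x : ∀ x → l₁ ∸ l₂ + a₁ + a₂ ≡ x * p → 0 < x
  0<x (suc _) _ = z<s
  0<x zero e = contradiction (m+n≡0⇒n≡0 (l₁ ∸ l₂) (m+n≡0⇒m≡0 _ e)) (>⇒≢ 0<a)

-- The quotient x of the first congruence decides. For x = 1, the first p rim nodes end with the
-- first node in the last row of the second run. For x ≥ 2, the first run alone has more than p rim
-- nodes, because b < p.
jsRim : ∀ {p r R} → JSRuns p (r ∷ R) → ∃ (JSRim p (r ∷ R))
jsRim {p} {l , a} {[]} (jsRuns _ ((0<l , _) ∷ _) _ _) with <-≤-connex p (l + a)
... | inj₁ lt = p , big lt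
... | inj₂ le = l + a ∸ 1 , small (m+[n∸m]≡n (≤-trans 0<l (m≤m+n l a)))
  (subst (_≤ p) (sym (m+[n∸m]≡n (≤-trans 0<l (m≤m+n l a)))) le)
jsRim {p} {R = (l₂ , b) ∷ R} js with js-step js
... | d , suc (suc x) , refl , _ , e , _ with jsRim (js-tail js)
...   | A , rim = p + A , sing {x = suc (suc x)} e (s≤s (s≤s z≤n)) rim
jsRim {p} {R = (l₂ , b) ∷ []} js | d , 1 , refl , _ , e , _ = p , pair₀ (trans e (+-identityʳ p))
jsRim {p} {R = (l₂ , b) ∷ (l₃ , c) ∷ R} js | d , 1 , refl , _ , e , _ with js-step (js-tail js) | jsRim
  (js-tail (js-tail js))
... | d₂ , x , refl , 0<d₂ , e₂ , 0<x | A , rim = p + A , pair (trans e (+-identityʳ p)) 0<d₂ e₂ 0<x rim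

sing⇒p≤ : ∀ {p} d a {b x} → d + a + b ≡ x * p → 2 ≤ x → b < p → p < d + a
sing⇒p≤ {p} d a {b} {x} e 2≤x b<p = +-cancelʳ-< b p (d + a) (begin-strict
  p + b        <⟨ +-monoʳ-< p b<p ⟩
  p + p        ≡⟨ cong (p +_) (+-identityʳ p) ⟨
  2 * p        ≤⟨ *-monoˡ-≤ p 2≤x ⟩
  x * p        ≡⟨ e ⟨
  d + a + b    ∎)
  where open ≤-Reasoning

seg-run : ∀ {h} p l a y → a < p → suc l + a ≡ p + y → h ≤ suc y →
  Seg h y (replicate (suc a) (suc l)) (replicate a l ++ y ∷ []) p
seg-run p l a y a<p e h≤ with m≤n⇒∃[o]m+o≡n a<p
... | d , refl = castSeg refl refl (+-suc a d) (seg-block a (+-cancelʳ-≡ a _ _ (trans e (eq a d y))) h≤)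
  where
  eq : ∀ a d y → suc a + d + y ≡ suc d + y + a
  eq = solve-∀

castRim : ∀ {p xs xs′ ws a a′} → xs ≡ xs′ → a ≡ a′ → PRim p xs ws a → PRim p xs′ ws a′
castRim refl refl r = r

jsRim⇒pRim : ∀ {p R A} → JSRim p R A → JSRuns p R → ∃ λ ws → PRim p (expand R) ws A
jsRim⇒pRim (small {A = A} e A<p) (jsRuns _ ((s≤s {n = l} _ , s≤s {n = a} _) ∷ _) _ _) = _ ,
  castRim (sym (++-identityʳ (replicate (suc a) (suc l)))) A≡
    (short (seg-block a (cong suc (sym (+-identityʳ l))) z≤n) (subst (_≤ _) (sym A≡) (<⇒≤ A<p)))
  where
  A≡ : a + suc l ≡ A
  A≡ = suc-injective (trans (+-comm (suc a) (suc l)) (sym e))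
jsRim⇒pRim {p} (big lt) (jsRuns _ ((s≤s {n = l} _ , s≤s {n = a} _) ∷ _) (a<p ∷ _) _) with m≤n⇒∃[o]m+o≡n lt
... | y , e = _ , castRim (sym (++-identityʳ (replicate (suc a) (suc l)))) refl
  (whole (seg-run p l a y (≤-trans (n≤1+n _) a<p) (suc-injective (trans (sym (+-suc (suc l) a)) (sym e))) z≤n))
jsRim⇒pRim (pair₀ {d} e) (jsRuns _
  ((_ , s≤s {n = a} _) ∷ (s≤s {n = l} _ , s≤s {n = b} _) ∷ _) _ _) with d + suc l | +-suc d l
... | _ | refl = _ , castRim (cong (replicate (suc a) (suc (d + l)) ++_)
  (sym (++-identityʳ (replicate (suc b) (suc l))))) refl
  (whole (castSeg refl refl (trans (eq a d b) e) (seg-two-blocks {d = d} a (suc b) (sym (+-suc d l)) z≤n)))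
  where
  eq : ∀ a d b → a + (suc d + suc b) ≡ d + suc a + suc b
  eq = solve-∀
jsRim⇒pRim (pair {d} {e = e} {R = R} d≡ 0<e _ _ rim) js@(jsRuns _ ((_ , s≤s {n = a} _) ∷ (_ , s≤s {n = b} _) ∷
  (s≤s {n = l} _ , s≤s {n = c} _) ∷ _) _ _)
  with jsRim⇒pRim rim (js-tail (js-tail js)) | e + suc l | +-suc e l
... | ws , r | _ | refl with d + suc (e + l) | +-suc d (e + l)
...   | _ | refl = _ , castRim (++-assoc (replicate (suc a) (suc (d + (e + l))))
  (replicate (suc b) (suc (e + l))) (expand ((suc l , suc c) ∷ R))) refl
  (castSeg refl refl (trans (eq a d b) d≡) (seg-two-blocks {d = d} a (suc b) (sym (+-suc d (e + l)))
    (s≤s (m≤n+m l e))) ∷ r)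
  where
  eq : ∀ a d b → a + (suc d + suc b) ≡ d + suc a + suc b
  eq = solve-∀
jsRim⇒pRim {p} (sing {d} {R = R} d≡ 2≤x rim) js@(jsRuns _
  ((_ , s≤s {n = a} _) ∷ (s≤s {n = l} _ , s≤s {n = b} _) ∷ _) (a<p ∷ b<p ∷ _) _)
  with jsRim⇒pRim rim (js-tail js) | m≤n⇒∃[o]m+o≡n (sing⇒p≤ d (suc a) d≡ 2≤x b<p)
... | ws , r | y , y≡ = _ , castRim (cong (λ k → replicate (suc a) k ++ expand ((suc l , suc b) ∷ R))
  (sym (+-suc d l))) refl
  (seg-run p (d + l) a (y + suc l) (≤-trans (n≤1+n _) a<p)
    (suc-injective (trans (eq d l a) (trans (cong (_+ suc l) (sym y≡)) (cong suc (+-assoc p y (suc l))))))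
    (s≤s (≤-trans (n≤1+n l) (m≤n+m (suc l) y))) ∷ r)
  where
  eq : ∀ d l a → suc (suc (d + l) + a) ≡ d + suc a + suc l
  eq = solve-∀

length-run : ∀ l a R → length (expand ((l , a) ∷ R)) ≡ a + length (expand R)
length-run l a R = trans (length-++ (replicate a l)) (cong (_+ length (expand R)) (length-replicate a))

sum-run : ∀ l a R → sum (expand ((l , a) ∷ R)) ≡ a * l + sum (expand R)
sum-run l a R = trans (sum-++ (replicate a l) _) (cong (_+ sum (expand R)) (sum-replicate a l))

-- The p-rim is part of the rim, which has l + r - 1 nodes if there are r rows and the first has
-- length l. Together with 2r = a + ε this yields r ≤ l, the bound `wide`.
jsRim< : ∀ {p R A} → JSRuns p R → JSRim p R A → A < firstRun R + length (expand R)
jsRim< _ (small {l} {a} e _) = ≤-reflexive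
  (trans e (cong (l +_) (sym (trans (length-run l a []) (+-identityʳ a)))))
jsRim< _ (big {l} {a} lt) = ≤-trans lt
  (≤-reflexive (cong (l +_) (sym (trans (length-run l a []) (+-identityʳ a)))))
jsRim< (jsRuns _ (_ ∷ (0<l , _) ∷ _) _ _) (pair₀ {d} {l} {a} {b} refl)
  rewrite length-run (d + l) a ((l , b) ∷ []) | length-run l b [] = subst (suc (d + a + b) ≤_) (eq d l a b)
    (+-monoˡ-≤ (d + a + b) 0<l)
  where
  eq : ∀ d l a b → l + (d + a + b) ≡ d + l + (a + (b + 0))
  eq = solve-∀
jsRim< js (pair {d} {l} {a} {b} {e} {c} {R = R} {A} refl _ _ _ rim)
  rewrite length-run (d + (e + l)) a ((e + l , b) ∷ (l , c) ∷ R) | length-run (e + l) b ((l , c) ∷ R) = begin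
    suc (d + a + b + A)        ≡⟨ +-suc (d + a + b) A ⟨
    d + a + b + suc A          ≤⟨ +-monoʳ-≤ (d + a + b) (jsRim< (js-tail (js-tail js)) rim) ⟩
    d + a + b + (l + r)        ≤⟨ m≤m+n _ e ⟩
    d + a + b + (l + r) + e    ≡⟨ eq d l a b e r ⟩
    d + (e + l) + (a + (b + r)) ∎
  where
  open ≤-Reasoning
  r = length (expand ((l , c) ∷ R))
  eq : ∀ d l a b e r → d + a + b + (l + r) + e ≡ d + (e + l) + (a + (b + r))
  eq = solve-∀
jsRim< {p} js@(jsRuns _ _ (_ ∷ b<p ∷ _) _) (sing {d} {l} {a} {b} {R = R} {A} d≡ 2≤x rim)
  rewrite length-run (d + l) a ((l , b) ∷ R) = begin
    suc (p + A)        ≡⟨ +-suc p A ⟨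
    p + suc A          ≤⟨ +-mono-≤ (<⇒≤ (sing⇒p≤ d a d≡ 2≤x b<p)) (jsRim< (js-tail js) rim) ⟩
    d + a + (l + r)    ≡⟨ eq d l a r ⟩
    d + l + (a + r)    ∎
  where
  open ≤-Reasoning
  r = length (expand ((l , b) ∷ R))
  eq : ∀ d l a r → d + a + (l + r) ≡ d + l + (a + r)
  eq = solve-∀

-- Containment of the core

part-hook≤ : ∀ {p la mu} → RemoveHook p la mu → ∀ i → part mu i ≤ part la i
part-hook≤ {la = la} {mu} (_ , _ , _ , h) i with <-≤-connex (part la i) (part mu i)
... | inj₁ lt = contradiction (proj₁ (proj₁ (h i (part la i)) lt)) 1+n≰n
... | inj₂ le = le

part-chain≤ : ∀ {p la mu} → Star (RemoveHook p) la mu → ∀ i → part mu i ≤ part la i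
part-chain≤ ε i = ≤-refl
part-chain≤ {la = la} (h ◅ hs) i = ≤-trans (part-chain≤ hs i) (part-hook≤ {la = la} h i)

part-replicate : ∀ {n i} l → i < n → part (replicate n l) i ≡ l
part-replicate {suc n} {zero} l _ = refl
part-replicate {suc n} {suc i} l (s≤s lt) = part-replicate l lt

part-expandˡ : ∀ l a R {i} → i < a → part (expand ((l , a) ∷ R)) i ≡ l
part-expandˡ l a R lt = trans (part-++ˡ (replicate a l) _ (subst (_ <_) (sym (length-replicate a)) lt))
  (part-replicate l lt)

part-expandʳ : ∀ l a R i → part (expand ((l , a) ∷ R)) (a + i) ≡ part (expand R) i
part-expandʳ l a R i = trans (cong (λ k → part (expand ((l , a) ∷ R)) (k + i)) (sym (length-replicate a)))
  (part-++ʳ (replicate a l) _ i)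

part-expand≤ : ∀ {p R} → JSRuns p R → ∀ i → part (expand R) i ≤ firstRun R
part-expand≤ {R = []} js i = z≤n
part-expand≤ {R = (l , a) ∷ R} js@(jsRuns dec ((0<l , _) ∷ _) _ _) i with <-≤-connex i a
... | inj₁ lt = ≤-reflexive (part-expandˡ l a R lt)
... | inj₂ le with m≤n⇒∃[o]m+o≡n le
...   | o , refl = ≤-trans (≤-reflexive (part-expandʳ l a R o)) (≤-trans (part-expand≤ (js-tail js) o)
  (<⇒≤ (firstRun< 0<l dec)))

length≤sum : ∀ {xs} → All (λ x → 0 < x) xs → length xs ≤ sum xs
length≤sum [] = z≤n
length≤sum (0<x ∷ pos) = +-mono-≤ 0<x (length≤sum pos)

part≤head : ∀ {x xs} → Linked _≥_ (x ∷ xs) → ∀ i → part xs i ≤ x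
part≤head [-] i = z≤n
part≤head (y≤x ∷ lk) zero = y≤x
part≤head (y≤x ∷ lk) (suc i) = ≤-trans (part≤head lk i) y≤x

-- The rows down to row `i` count at least j each because the parts decrease, and the others at
-- least 1; `suc i` is added on the right to avoid subtraction.
sum-bound : ∀ {xs j} i → IsPartition xs → j ≤ part xs i → suc i ≤ length xs →
  suc i * j + length xs ≤ sum xs + suc i
sum-bound {x ∷ xs} {j} zero (lk , _ ∷ pos) le _ = begin
  j + 0 + suc (length xs)  ≡⟨ cong (_+ suc (length xs)) (+-identityʳ j) ⟩
  j + suc (length xs)      ≤⟨ +-mono-≤ le (s≤s (length≤sum pos)) ⟩
  x + suc (sum xs)         ≡⟨ trans (+-suc x _) (+-comm 1 _) ⟩
  x + sum xs + 1           ∎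
  where open ≤-Reasoning
sum-bound {x ∷ xs} {j} (suc i) (lk , _ ∷ pos) le (s≤s i<) = begin
  j + suc i * j + suc (length xs)    ≡⟨ eq j (suc i * j) (length xs) ⟩
  suc (j + (suc i * j + length xs))  ≤⟨ s≤s (+-mono-≤ (≤-trans le (part≤head lk i))
    (sum-bound i (linked-tail lk , pos) le i<)) ⟩
  suc (x + (sum xs + suc i))         ≡⟨ eq′ x (sum xs) i ⟩
  x + sum xs + suc (suc i)           ∎
  where
  open ≤-Reasoning
  eq : ∀ j k l → j + k + suc l ≡ suc (j + (k + l))
  eq = solve-∀
  eq′ : ∀ x s i → suc (x + (s + suc i)) ≡ x + s + suc (suc i)
  eq′ = solve-∀

fixed-column : ∀ {p la ws a} → IsMullineuxFixed p la → PRim p la ws a → a + eps p a ≡ length la + length la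
fixed-column {la = []} _ r = contradiction (pRim-length>0 r) λ ()
fixed-column {p} {x ∷ xs} (_ , _ , e) r = subst (λ A → A + eps p A ≡ length (x ∷ xs) + length (x ∷ xs))
  (proj₁ (pRim-spec r))
  (double (length xs) _ (sym (cong firstLength e)))
  where
  firstLength : List (ℕ × ℕ) → ℕ
  firstLength [] = 0
  firstLength ((_ , l) ∷ _) = l
  -- The difference is positive, so the subtraction was not truncated.
  double : ∀ n m → m ∸ suc n ≡ suc n → m ≡ suc n + suc n
  double n m z with m≤n⇒∃[o]m+o≡n {suc n} {m}
    (<⇒≤ (m∸n≢0⇒n<m {m} {suc n} λ z′ → contradiction (trans (sym z) z′) λ ()))
  ... | o , refl = cong (suc n +_) (trans (sym (m+n∸m≡n (suc n) o)) z)

-- Arithmetic of the weight-two case, with p = 2j + 1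

too-big : ∀ {x y} k → x ≡ suc y + k → x ≤ y → ⊥
too-big {y = y} k refl le = m+n≮m y k le

odd≢double : ∀ m n → suc (m + m) ≢ n + n
odd≢double m (suc n) e = odd≢double n m (sym (trans (suc-injective e) (+-suc n n)))

product-even : ∀ l → ∃ λ h → suc l * l ≡ h + h
product-even zero = 0 , refl
product-even (suc l) with product-even l
... | h , e = h + suc l , trans (eq l) (trans (cong (_+ (suc l + suc l)) e) (eq′ h l))
  where
  eq : ∀ l → suc (suc l) * suc l ≡ suc l * l + (suc l + suc l)
  eq = solve-∀
  eq′ : ∀ h l → h + h + (suc l + suc l) ≡ h + suc l + (h + suc l)
  eq′ = solve-∀

double-≤ : ∀ {m n} → m + m ≤ n + n → m ≤ n
double-≤ {m} {n} le with <-≤-connex n m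
... | inj₁ lt = contradiction le (<⇒≱ (+-mono-< lt lt))
... | inj₂ m≤n = m≤n

4ab≤[a+b]² : ∀ a b → a * b * 4 ≤ (b + a) * (b + a)
4ab≤[a+b]² a b with ≤-total a b
... | inj₁ a≤b with m≤n⇒∃[o]m+o≡n a≤b
...   | o , refl = subst (a * (a + o) * 4 ≤_) (eq a o) (m≤m+n _ (o * o))
  where
  eq : ∀ a o → a * (a + o) * 4 + o * o ≡ (a + o + a) * (a + o + a)
  eq = solve-∀
4ab≤[a+b]² a b | inj₂ b≤a with m≤n⇒∃[o]m+o≡n b≤a
...   | o , refl = subst ((b + o) * b * 4 ≤_) (eq b o) (m≤m+n _ (o * o))
  where
  eq : ∀ b o → (b + o) * b * 4 + o * o ≡ (b + (b + o)) * (b + (b + o))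
  eq = solve-∀

∣-by-cancel : ∀ {p n} u v → n + u * p ≡ v * p → p ∣ n
∣-by-cancel {p} {n} u v e = ∣m+n∣m⇒∣n (subst (p ∣_) (trans (sym e) (+-comm n (u * p))) (n∣m*n v)) (n∣m*n u)

-- If the p-rim of a Jantzen–Seitz partition consists of two p-segments with p nodes each
-- and there are p parts, then p divides the size. One lemma for each shape of the rim.

∣-sing-big : ∀ {p} a b d l x → a + (b + 0) ≡ p → d + a + b ≡ x * p → p ∣ a * (d + l) + (b * l + 0)
∣-sing-big a b d l x refl e = ∣-by-cancel a (a * x + l)
  (trans (e₁ a b d l) (trans (cong (λ y → a * y + (a + (b + 0)) * l) e) (e₂ a b l x)))
  where
  e₁ : ∀ a b d l → a * (d + l) + (b * l + 0) + a * (a + (b + 0)) ≡ a * (d + a + b) + (a + (b + 0)) * l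
  e₁ = solve-∀
  e₂ : ∀ a b l x → a * (x * (a + (b + 0))) + (a + (b + 0)) * l ≡ (a * x + l) * (a + (b + 0))
  e₂ = solve-∀

-- Comparing the number of rows with e + b + c = p gives e = a, and the size becomes a(d + a + b) +
-- pl.
∣-sing-pair : ∀ {p} a b c d e l x → a + (b + (c + 0)) ≡ p → d + a + b ≡ x * p → e + b + c ≡ p →
  p ∣ a * (d + (e + l)) + (b * (e + l) + (c * l + 0))
∣-sing-pair a b c d e l x refl d≡ e≡ with +-cancelʳ-≡ (b + c) e a
  (trans (sym (+-assoc e b c)) (trans e≡ (eq a b c)))
  where
  eq : ∀ a b c → a + (b + (c + 0)) ≡ a + (b + c)
  eq = solve-∀
... | refl = ∣-by-cancel 0 (a * x + l)
  (trans (e₁ a b c d l) (trans (cong (λ y → a * y + (a + (b + (c + 0))) * l) d≡) (e₂ a b c l x)))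
  where
  e₁ : ∀ a b c d l → a * (d + (a + l)) + (b * (a + l) + (c * l + 0)) + 0
    ≡ a * (d + a + b) + (a + (b + (c + 0))) * l
  e₁ = solve-∀
  e₂ : ∀ a b c l x → a * (x * (a + (b + (c + 0)))) + (a + (b + (c + 0))) * l ≡ (a * x + l) * (a + (b + (c + 0)))
  e₂ = solve-∀

-- Here the number of rows forces d = c.
∣-pair-big : ∀ {p} a b c d e l x → a + (b + (c + 0)) ≡ p → d + a + b ≡ p → e + b + c ≡ x * p →
  p ∣ a * (d + (e + l)) + (b * (e + l) + (c * l + 0))
∣-pair-big a b c d e l x refl d≡ e≡ with +-cancelʳ-≡ (a + b) d c
  (trans (sym (+-assoc d a b)) (trans d≡ (eq a b c)))
  where
  eq : ∀ a b c → a + (b + (c + 0)) ≡ c + (a + b)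
  eq = solve-∀
... | refl = ∣-by-cancel b ((a + b) * x + l)
  (trans (e₁ a b c e l) (trans (cong (λ y → (a + b) * y + (a + (b + (c + 0))) * l) e≡) (e₂ a b c l x)))
  where
  e₁ : ∀ a b c e l → a * (c + (e + l)) + (b * (e + l) + (c * l + 0)) + b * (a + (b + (c + 0)))
    ≡ (a + b) * (e + b + c) + (a + (b + (c + 0))) * l
  e₁ = solve-∀
  e₂ : ∀ a b c l x → (a + b) * (x * (a + (b + (c + 0)))) + (a + (b + (c + 0))) * l
    ≡ ((a + b) * x + l) * (a + (b + (c + 0)))
  e₂ = solve-∀

-- Here the number of rows forces d = c + g and f = a + b.
∣-pair-pair : ∀ {p} a b c g d e f l x → a + (b + (c + (g + 0))) ≡ p → d + a + b ≡ p → e + b + c ≡ x * p →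
  f + c + g ≡ p →
  p ∣ a * (d + (e + (f + l))) + (b * (e + (f + l)) + (c * (f + l) + (g * l + 0)))
∣-pair-pair a b c g d e f l x refl d≡ e≡ f≡
  with +-cancelʳ-≡ (a + b) d (c + g) (trans (sym (+-assoc d a b)) (trans d≡ (eq a b c g)))
     | +-cancelʳ-≡ (c + g) f (a + b) (trans (sym (+-assoc f c g)) (trans f≡ (eq′ a b c g)))
  where
  eq : ∀ a b c g → a + (b + (c + (g + 0))) ≡ c + g + (a + b)
  eq = solve-∀
  eq′ : ∀ a b c g → a + (b + (c + (g + 0))) ≡ a + b + (c + g)
  eq′ = solve-∀
... | refl | refl = ∣-by-cancel 0 ((a + b) * x + (a + l)) (trans (e₁ a b c g e l)
    (trans (cong (λ y → (a + b) * y + (a + (b + (c + (g + 0)))) * (a + l)) e≡) (e₂ a b c g l x)))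
  where
  e₁ : ∀ a b c g e l → a * (c + g + (e + (a + b + l))) +
    (b * (e + (a + b + l)) + (c * (a + b + l) + (g * l + 0))) + 0
    ≡ (a + b) * (e + b + c) + (a + (b + (c + (g + 0)))) * (a + l)
  e₁ = solve-∀
  e₂ : ∀ a b c g l x → (a + b) * (x * (a + (b + (c + (g + 0))))) + (a + (b + (c + (g + 0)))) * (a + l)
    ≡ ((a + b) * x + (a + l)) * (a + (b + (c + (g + 0))))
  e₂ = solve-∀

-- The same when the second p-segment is shorter than p: the size then has a closed form.

size-sing-small : ∀ {p} b d l g y → p + (l + b) ≡ (l + g) + (b + 0) + ((l + g) + (b + 0)) → d + (l + g) + b
  ≡ (2 + y) * p →
  (l + g) * (d + l) + (b * l + 0) ≡ g * g + ((l + g) * (1 + y) + l) * p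
size-sing-small {p} b d l g y e d≡ with +-cancelʳ-≡ (l + b) p (l + g + g + b) (trans e (eq b l g))
  where
  eq : ∀ b l g → (l + g) + (b + 0) + ((l + g) + (b + 0)) ≡ l + g + g + b + (l + b)
  eq = solve-∀
... | refl with +-cancelʳ-≡ (l + g + b) d ((1 + y) * (l + g + g + b) + g) (trans (sym (+-assoc d (l + g) b))
  (trans d≡ (eq b l g y)))
  where
  eq : ∀ b l g y → (2 + y) * (l + g + g + b) ≡ (1 + y) * (l + g + g + b) + g + (l + g + b)
  eq = solve-∀
...   | refl = eq b l g y
  where
  eq : ∀ b l g y → (l + g) * ((1 + y) * (l + g + g + b) + g + l) + (b * l + 0)
    ≡ g * g + ((l + g) * (1 + y) + l) * (l + g + g + b)
  eq = solve-∀

-- The column equation and the second congruence together determine the second part: e + l = yp + a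
-- + (a + b).
size-pair-small : ∀ {p} a b c d e l y → p + (l + c) ≡ a + (b + (c + 0)) + (a + (b + (c + 0))) → d + a + b ≡ p →
  e + b + c ≡ (1 + y) * p →
  a * (d + (e + l)) + (b * (e + l) + (c * l + 0)) ≡ a * p + (a + b) * y * p + (a + b) * (a + b) + c * l
size-pair-small a b c d e l y r≡ refl e≡ = trans (e₁ a b c d (e + l) l)
  (trans (cong (λ z → a * d + (a + b) * z + c * l) l₂) (e₂ a b c d l y))
  where
  p = d + a + b
  e₁ : ∀ a b c d z l → a * (d + z) + (b * z + (c * l + 0)) ≡ a * d + (a + b) * z + c * l
  e₁ = solve-∀
  e₂ : ∀ a b c d l y → a * d + (a + b) * (y * (d + a + b) + a + (a + b)) + c * l
    ≡ a * (d + a + b) + (a + b) * y * (d + a + b) + (a + b) * (a + b) + c * l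
  e₂ = solve-∀
  l₂ : e + l ≡ y * p + a + (a + b)
  l₂ = +-cancelʳ-≡ (b + c + p + c) _ _ (begin
    e + l + (b + c + p + c)             ≡⟨ f₁ e l b c p ⟩
    e + b + c + (p + (l + c))           ≡⟨ cong₂ _+_ e≡ r≡ ⟩
    (1 + y) * p + (a + (b + (c + 0)) + (a + (b + (c + 0)))) ≡⟨ f₂ a b c p y ⟩
    y * p + a + (a + b) + (b + c + p + c) ∎)
    where
    open ≡-Reasoning
    f₁ : ∀ e l b c p → e + l + (b + c + p + c) ≡ e + b + c + (p + (l + c))
    f₁ = solve-∀
    f₂ : ∀ a b c p y → (1 + y) * p + (a + (b + (c + 0)) + (a + (b + (c + 0))))
      ≡ y * p + a + (a + b) + (b + c + p + c)
    f₂ = solve-∀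

module _ (i j p n : ℕ) (j≡ : j ≡ suc i) (p≡ : p ≡ suc (j + j)) (n≡ : n ≡ j * j + p * 2) where

  private
    -- j, p and n stay opaque in the estimates and are expressed in `i` only at the end, where f = g
    -- + 1 + k. The slack `k` is a polynomial with natural coefficients, so the identity can be left
    -- to the solver.
    absurd : ∀ (f g : ℕ → ℕ → ℕ → ℕ) k →
      (let j = suc i; p = suc (j + j); n = j * j + p * 2 in f j p n ≡ suc (g j p n) + k) → f j p n ≤ g j p n → ⊥
    absurd f g k eq le = too-big k (trans (cong₂ (λ x y → f x y n) j≡ p≡′) (trans (cong (f _ _) n≡′) (trans eq
      (cong (λ x → suc x + k) (sym (trans (cong₂ (λ x y → g x y n) j≡ p≡′) (cong (g _ _) n≡′))))))) le
      where
      p≡′ : p ≡ suc (suc i + suc i)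
      p≡′ = trans p≡ (cong (λ x → suc (x + x)) j≡)
      n≡′ : n ≡ suc i * suc i + suc (suc i + suc i) * 2
      n≡′ = trans n≡ (cong₂ (λ x y → x * x + y * 2) j≡ p≡′)

  0<j : 0 < j
  0<j = subst (0 <_) (sym j≡) z<s

  -- Since 4j² + 2p = p² + 1, a divisor p of n, hence of j², would divide 1.
  p∤n : ¬ p ∣ n
  p∤n d = contradiction (trans (sym p≡)
    (∣1⇒≡1 (∣m+n∣m⇒∣n (subst (p ∣_) (eq {j} p≡) (∣m∣n⇒∣m+n (∣m⇒∣m*n 4 p∣j²) (n∣m*n 2))) (n∣m*n p))))
    (λ e → contradiction (m+n≡0⇒m≡0 j (suc-injective e)) λ z → contradiction (trans (sym j≡) z) λ ())
    where
    p∣j² : p ∣ j * j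
    p∣j² = ∣m+n∣m⇒∣n (subst (p ∣_) (trans n≡ (+-comm (j * j) (p * 2))) d) (m∣m*n 2)
    eq : ∀ {j p} → p ≡ suc (j + j) → j * j * 4 + 2 * p ≡ p * p + 1
    eq {j} refl = eq′ j
      where
      eq′ : ∀ j → j * j * 4 + 2 * suc (j + j) ≡ suc (j + j) * suc (j + j) + 1
      eq′ = solve-∀

  -- 4al ≤ (a + l)² ≤ p², whereas 4n = p² + 6p + 1.
  ¬short-run : ∀ a l → l + a ≤ p → a * l + 0 ≢ n
  ¬short-run a l le e = absurd (λ _ _ n → n * 4) (λ _ p _ → p * p) (12 * i + 18) (eq i) (begin
    n * 4           ≡⟨ cong (_* 4) (trans (sym e) (+-identityʳ (a * l))) ⟩
    a * l * 4       ≤⟨ 4ab≤[a+b]² a l ⟩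
    (l + a) * (l + a) ≤⟨ *-mono-≤ le le ⟩
    p * p           ∎)
    where
    open ≤-Reasoning
    eq : ∀ i → (suc i * suc i + suc (suc i + suc i) * 2) * 4
      ≡ suc (suc (suc i + suc i) * suc (suc i + suc i)) + (12 * i + 18)
    eq = solve-∀

  -- For g = 0 the size is a multiple of p. Otherwise the factor K of p is at least 3 and at least j
  -- + 1; doubling the size allows each bound to be used once.
  ¬sing-small : ∀ l g y → 0 < l → j ≤ l + g → g * g + ((l + g) * (1 + y) + l) * p ≢ n
  ¬sing-small l zero y _ _ e = p∤n (subst (p ∣_) e (n∣m*n ((l + 0) * (1 + y) + l)))
  ¬sing-small l g@(suc g′) y 0<l j≤ e = absurd (λ j p _ → 2 + (3 + (j + 1)) * p) (λ _ _ n → 2 * n) (i + 2)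
    (eq i) (begin
    2 + (3 + (j + 1)) * p                ≤⟨ +-mono-≤ (*-monoʳ-≤ 2 {1} (s≤s z≤n))
      (*-monoˡ-≤ p (+-mono-≤ K≥3 K≥j+1)) ⟩
    2 * (g * g) + (K + K) * p            ≡⟨ eq₂ (g * g) K p ⟩
    2 * (g * g + K * p)                  ≡⟨ cong (2 *_) e ⟩
    2 * n                                ∎)
    where
    open ≤-Reasoning
    K = (l + g) * (1 + y) + l
    l+g≤ : l + g ≤ (l + g) * (1 + y)
    l+g≤ = m≤m*n (l + g) (1 + y)
    K≥3 : 3 ≤ K
    K≥3 = +-mono-≤ (≤-trans (+-mono-≤ 0<l (s≤s z≤n)) l+g≤) 0<l
    K≥j+1 : j + 1 ≤ K
    K≥j+1 = +-mono-≤ (≤-trans j≤ l+g≤) 0<l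
    eq : ∀ i → 2 + (3 + (suc i + 1)) * suc (suc i + suc i)
      ≡ suc (2 * (suc i * suc i + suc (suc i + suc i) * 2)) + (i + 2)
    eq = solve-∀
    eq₂ : ∀ x K p → 2 * x + (K + K) * p ≡ 2 * (x + K * p)
    eq₂ = solve-∀

  -- If a + b > j, already p + (j + 1)² + 1 exceeds n. If a + b = j, then ap + jyp + cl = 2p, so a =
  -- 1, y = 0 and cl = p. The column equation gives c = l + 1, and l(l + 1) is even while p is odd.
  ¬pair-small : ∀ a b c l y → 0 < a → 0 < c → 0 < l → j ≤ a + b → p + (l + c)
    ≡ a + (b + (c + 0)) + (a + (b + (c + 0))) →
    a * p + (a + b) * y * p + (a + b) * (a + b) + c * l ≢ n
  ¬pair-small a b c l y 0<a 0<c 0<l j≤ r≡ e with m≤n⇒m<n∨m≡n j≤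
  ... | inj₁ j< = absurd (λ j p _ → p + suc j * suc j + 1) (λ _ _ n → n) 0 (eq i) (begin
    p + suc j * suc j + 1               ≤⟨ +-mono-≤
      (+-mono-≤ (≤-trans (m≤n*m p a ⦃ >-nonZero 0<a ⦄) (m≤m+n (a * p) _)) (*-mono-≤ j< j<)) (*-mono-≤ 0<c 0<l) ⟩
    a * p + (a + b) * y * p + (a + b) * (a + b) + c * l ≡⟨ e ⟩
    n                                   ∎)
    where
    open ≤-Reasoning
    eq : ∀ i → suc (suc i + suc i) + suc (suc i) * suc (suc i) + 1
      ≡ suc (suc i * suc i + suc (suc i + suc i) * 2) + 0
    eq = solve-∀
  ... | inj₂ j≡b = cases a y refl refl
    where
    e′ : a * p + j * y * p + c * l ≡ p * 2
    e′ = +-cancelˡ-≡ (j * j) _ _ (trans (eq (a * p) (j * y * p) (j * j) (c * l))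
      (trans (cong (λ q → a * p + q * y * p + q * q + c * l) j≡b) (trans e n≡)))
      where
      eq : ∀ x y z w → z + (x + y + w) ≡ x + y + z + w
      eq = solve-∀
    two : 2 ≤ a + j * y → ⊥
    two le = contradiction (begin
      suc (p * 2)                ≡⟨ trans (cong suc (*-comm p 2)) (+-comm 1 _) ⟩
      2 * p + 1                  ≤⟨ +-mono-≤ (*-monoˡ-≤ p le) (*-mono-≤ 0<c 0<l) ⟩
      (a + j * y) * p + c * l    ≡⟨ cong (_+ c * l) (*-distribʳ-+ p a (j * y)) ⟩
      a * p + j * y * p + c * l  ≡⟨ e′ ⟩
      p * 2                      ∎) 1+n≰n
      where open ≤-Reasoning
    cases : ∀ a₁ y₁ → a ≡ a₁ → y ≡ y₁ → ⊥
    cases zero _ refl _ = contradiction 0<a λ ()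
    cases (suc (suc a₁)) _ refl _ = two (s≤s (s≤s z≤n))
    cases 1 (suc y₁) refl refl = two (s≤s (*-mono-≤ 0<j (s≤s z≤n)))
    cases 1 zero refl refl with product-even l
    ... | h , ev = odd≢double j h (trans (sym (trans cl≡p p≡)) (trans (cong (_* l) c≡) ev))
      where
      cl≡p : c * l ≡ p
      cl≡p = +-cancelˡ-≡ p _ _ (trans (eq p (c * l) j) (trans e′ (eq′ p)))
        where
        eq : ∀ p x j → p + x ≡ 1 * p + j * 0 * p + x
        eq = solve-∀
        eq′ : ∀ p → p * 2 ≡ p + p
        eq′ = solve-∀
      c≡ : c ≡ suc l
      c≡ = +-cancelʳ-≡ (j + j + c) c (suc l)
        (trans (trans (eq₁ j c) (trans (cong (λ q → q + c + (q + c)) j≡b) (eq₂ b c)))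
             (trans (sym r≡) (trans (cong (_+ (l + c)) p≡) (eq₃ j l c))))
        where
        eq₁ : ∀ j c → c + (j + j + c) ≡ j + c + (j + c)
        eq₁ = solve-∀
        eq₂ : ∀ b c → 1 + b + c + (1 + b + c) ≡ 1 + (b + (c + 0)) + (1 + (b + (c + 0)))
        eq₂ = solve-∀
        eq₃ : ∀ j l c → suc (j + j) + (l + c) ≡ suc l + (j + j + c)
        eq₃ = solve-∀

  -- Q rows have length at least l ≥ j, and ρ are the rows below them. If Q < j, then the
  -- square (j^j) also occupies part of ρ.
  ¬three-segments : ∀ D Q l ρ → IsPartition ρ → 1 ≤ i → j ≤ l → p + p ≤ D + Q → p < Q + length ρ →
    (∀ g → Q + suc g ≡ j → j ≤ part ρ g) → D + Q * l + sum ρ ≤ n → ⊥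
  ¬three-segments D Q l ρ ρ-part 1≤i j≤l h₁ h₂ square size with <-≤-connex Q j
  ... | inj₂ j≤Q with m≤n⇒∃[o]m+o≡n j≤Q
  ...   | u , Q≡ = absurd (λ j p _ → p + p + suc p + (j * j + u * 2)) (λ j _ n → n + ((j + u) + (j + u))) 1
    (eq u i) (begin
    p + p + suc p + (j * j + u * 2)    ≤⟨ +-monoʳ-≤ (p + p + suc p) (+-monoʳ-≤ (j * j) (*-monoʳ-≤ u 2≤j)) ⟩
    p + p + suc p + (j * j + u * j)    ≡⟨ cong (p + p + suc p +_)
      (trans (sym (*-distribʳ-+ j j u)) (cong (_* j) Q≡)) ⟩
    p + p + suc p + Q * j              ≤⟨ +-mono-≤ (+-mono-≤ h₁ h₂) (*-monoʳ-≤ Q j≤l) ⟩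
    D + Q + (Q + length ρ) + Q * l     ≤⟨ +-monoˡ-≤ (Q * l)
      (+-monoʳ-≤ (D + Q) (+-monoʳ-≤ Q (length≤sum (proj₂ ρ-part)))) ⟩
    D + Q + (Q + sum ρ) + Q * l        ≡⟨ eq₁ D Q (sum ρ) (Q * l) ⟩
    D + Q * l + sum ρ + (Q + Q)        ≤⟨ +-monoˡ-≤ (Q + Q) size ⟩
    n + (Q + Q)                        ≡⟨ cong (λ x → n + (x + x)) Q≡ ⟨
    n + ((j + u) + (j + u))            ∎)
    where
    open ≤-Reasoning
    -- The u rows beyond the j-th have at least j nodes each; with j ≥ 2 they outweigh the 2u on the
    -- right.
    2≤j : 2 ≤ j
    2≤j = subst (2 ≤_) (sym j≡) (s≤s 1≤i)
    eq : ∀ u i → suc (suc i + suc i) + suc (suc i + suc i) + suc (suc (suc i + suc i)) + (suc i * suc i + u * 2)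
      ≡ suc (suc i * suc i + suc (suc i + suc i) * 2 + ((suc i + u) + (suc i + u))) + 1
    eq = solve-∀
    eq₁ : ∀ D Q s x → D + Q + (Q + s) + x ≡ D + x + s + (Q + Q)
    eq₁ = solve-∀
  ¬three-segments D Q l ρ ρ-part 1≤i j≤l h₁ h₂ square size | inj₁ Q<j with m≤n⇒∃[o]m+o≡n Q<j
  ... | g , Q+g = absurd (λ j p _ → p + p + suc p + j * j) (λ j _ n → n + (j + j)) 1 (eq i) (begin
    p + p + suc p + j * j                         ≡⟨ cong (λ x → p + p + suc p + x * j) Q+g′ ⟨
    p + p + suc p + (Q + suc g) * j               ≤⟨ +-monoˡ-≤ ((Q + suc g) * j) (+-mono-≤ h₁ h₂) ⟩
    D + Q + (Q + length ρ) + (Q + suc g) * j      ≡⟨ eq₁ D Q (length ρ) g j ⟩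
    D + Q * j + (suc g * j + length ρ) + (Q + Q)  ≤⟨ +-monoˡ-≤ (Q + Q) (+-mono-≤ (+-monoʳ-≤ D (*-monoʳ-≤ Q j≤l))
                                                       (sum-bound g ρ-part (square g Q+g′) g<)) ⟩
    D + Q * l + (sum ρ + suc g) + (Q + Q)         ≡⟨ eq₂ (D + Q * l) (sum ρ) g Q ⟩
    D + Q * l + sum ρ + (Q + (Q + suc g))         ≤⟨ +-mono-≤ size (+-mono-≤ (<⇒≤ Q<j) (≤-reflexive Q+g′)) ⟩
    n + (j + j)                                   ∎)
    where
    open ≤-Reasoning
    Q+g′ : Q + suc g ≡ j
    Q+g′ = trans (+-suc Q g) Q+g
    g< : suc g ≤ length ρ
    g< = +-cancelˡ-≤ Q _ _ (≤-trans (≤-reflexive Q+g′)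
      (≤-trans (m≤m+n j j) (≤-trans (n≤1+n (j + j)) (≤-trans (≤-reflexive (sym p≡)) (<⇒≤ h₂)))))
    eq : ∀ i → suc (suc i + suc i) + suc (suc i + suc i) + suc (suc (suc i + suc i)) + suc i * suc i
      ≡ suc (suc i * suc i + suc (suc i + suc i) * 2 + (suc i + suc i)) + 1
    eq = solve-∀
    eq₁ : ∀ D Q r g j → D + Q + (Q + r) + (Q + suc g) * j ≡ D + Q * j + (suc g * j + r) + (Q + Q)
    eq₁ = solve-∀
    eq₂ : ∀ x s g Q → x + (s + suc g) + (Q + Q) ≡ x + s + (Q + (Q + suc g))
    eq₂ = solve-∀

  -- At least j rows are longer than p. For j ≥ 3 these alone exceed n; the bound 2p ≤ d + a + b
  -- settles small j as well.
  ¬sing-wide : ∀ a b d l s → suc i ≤ a → 1 < l → 0 < s → p < d + l → p + p ≤ d + a + b →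
    a * (d + l) + (b * l + s) ≢ n
  ¬sing-wide (suc a) b d l s (s≤s i≤a) 1<l 0<s wide h e with m≤n⇒∃[o]m+o≡n i≤a
  ... | u , refl = absurd (λ _ p _ → p + p + 2 + (i + u) * suc p + b + 1) (λ _ _ n → n + suc (i + u))
    (i * i + i + 2 * i * u + 3 * u + b) (eq i u b) (begin
    p + p + 2 + a * suc p + b + 1                 ≤⟨ +-mono-≤
      (+-mono-≤ (+-mono-≤ (+-mono-≤ h 1<l) (*-monoʳ-≤ a wide)) (≤-refl {b})) 0<s ⟩
    d + suc a + b + l + a * (d + l) + b + s       ≡⟨ eq₁ d a b l s ⟩
    suc a * (d + l) + (b * 2 + s) + suc a         ≤⟨ +-monoˡ-≤ (suc a)
      (+-monoʳ-≤ (suc a * (d + l)) (+-monoˡ-≤ s (*-monoʳ-≤ b 1<l))) ⟩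
    suc a * (d + l) + (b * l + s) + suc a         ≡⟨ cong (_+ suc a) e ⟩
    n + suc a                                     ∎)
    where
    open ≤-Reasoning
    eq : ∀ i u b → suc (suc i + suc i) + suc (suc i + suc i) + 2 + (i + u) * suc (suc (suc i + suc i)) + b + 1
      ≡ suc (suc i * suc i + suc (suc i + suc i) * 2 + suc (i + u)) + (i * i + i + 2 * i * u + 3 * u + b)
    eq = solve-∀
    eq₁ : ∀ d a b l s → d + suc a + b + l + a * (d + l) + b + s ≡ suc a * (d + l) + (b * 2 + s) + suc a
    eq₁ = solve-∀

  -- A first row longer than p = d + a + b means m > a + b. So the first q = a + b rows contain a
  -- rectangle of q(q + 1) nodes, with q > j.
  ¬pair-wide : ∀ a b c d m l r s → 0 < a → 0 < l → j < a + b → d + a + b ≡ p → p < d + m → r ≤ s →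
    p < a + (b + (c + r)) →
    a * (d + m) + (b * m + (c * l + s)) ≢ n
  ¬pair-wide a b c d m l r s 0<a 0<l j<b d≡ wide r≤s h e with m≤n⇒∃[o]m+o≡n j<b
  ... | u , eb = absurd (λ j p _ → p + (suc j + u) * suc (suc j + u) + suc p)
    (λ j _ n → n + ((suc j + u) + (suc j + u))) (u * u + 2 * i * u + 3 * u + i + 1) (eq i u) (begin
    p + q * suc q + suc p                     ≤⟨ +-mono-≤
      (+-mono-≤ (≤-reflexive (sym d≡)) (*-monoʳ-≤ q q<m)) h ⟩
    d + a + b + q * m + (a + (b + (c + r)))   ≡⟨ cong (λ z → d + a + b + z * m + (a + (b + (c + r)))) eb ⟩
    d + a + b + (a + b) * m + (a + (b + (c + r)))  ≤⟨ ≤-reflexive (eq₁ a b c d m r) ⟩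
    1 * d + (a + b) * m + (c * 1 + r) + ((a + b) + (a + b)) ≤⟨ +-monoˡ-≤ _
      (+-mono-≤ (+-monoˡ-≤ ((a + b) * m) (*-monoˡ-≤ d 0<a)) (+-mono-≤ (*-monoʳ-≤ c 0<l) r≤s)) ⟩
    a * d + (a + b) * m + (c * l + s) + ((a + b) + (a + b)) ≡⟨ eq₂ a b (c * l) d m s ⟩
    a * (d + m) + (b * m + (c * l + s)) + ((a + b) + (a + b)) ≡⟨ cong₂ (λ x y → x + (y + y)) e (sym eb) ⟩
    n + (q + q)                               ∎)
    where
    open ≤-Reasoning
    q = suc j + u
    q<m : q < m
    q<m = +-cancelˡ-< d q m (subst (_< d + m)
      (trans (sym d≡) (trans (+-assoc d a b) (cong (d +_) (sym eb)))) wide)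
    eq : ∀ i u → suc (suc i + suc i) + (suc (suc i) + u) * suc (suc (suc i) + u) + suc (suc (suc i + suc i))
      ≡ suc (suc i * suc i + suc (suc i + suc i) * 2 + ((suc (suc i) + u) + (suc (suc i) + u))) +
        (u * u + 2 * i * u + 3 * u + i + 1)
    eq = solve-∀
    eq₁ : ∀ a b c d m r → d + a + b + (a + b) * m + (a + (b + (c + r)))
      ≡ 1 * d + (a + b) * m + (c * 1 + r) + ((a + b) + (a + b))
    eq₁ = solve-∀
    eq₂ : ∀ a b x d m s → a * d + (a + b) * m + (x + s) + ((a + b) + (a + b))
      ≡ a * (d + m) + (b * m + (x + s)) + ((a + b) + (a + b))
    eq₂ = solve-∀

  -- The rectangle of `¬pair-wide` with q = j. The margin shrinks to a single node, and the lower
  -- rows must now be known to hold more than p nodes.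
  ¬pair-exact : ∀ a b d m s → 0 < a → j ≡ a + b → d + a + b ≡ p → p < d + m → p < s →
    a * (d + m) + (b * m + s) ≢ n
  ¬pair-exact a b d m s 0<a j≡b d≡ wide p<s e = absurd (λ j p _ → p + j * suc j + suc p) (λ j _ n → n + j) 0
    (eq i) (begin
    p + j * suc j + suc p              ≤⟨ +-mono-≤ (+-mono-≤ (≤-reflexive (sym d≡)) (*-monoʳ-≤ j j<m)) p<s ⟩
    d + a + b + j * m + s              ≡⟨ cong (λ x → d + a + b + x * m + s) j≡b ⟩
    d + a + b + (a + b) * m + s        ≡⟨ eq₁ a b d m s ⟩
    1 * d + (a + b) * m + s + (a + b)  ≤⟨ +-monoˡ-≤ (a + b)
      (+-monoˡ-≤ s (+-monoˡ-≤ ((a + b) * m) (*-monoˡ-≤ d 0<a))) ⟩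
    a * d + (a + b) * m + s + (a + b)  ≡⟨ eq₂ a b d m s ⟩
    a * (d + m) + (b * m + s) + (a + b) ≡⟨ cong₂ _+_ e (sym j≡b) ⟩
    n + j                              ∎)
    where
    open ≤-Reasoning
    j<m : j < m
    j<m = +-cancelˡ-< d j m (subst (_< d + m)
      (trans (sym d≡) (trans (+-assoc d a b) (cong (d +_) (sym j≡b)))) wide)
    eq : ∀ i → suc (suc i + suc i) + suc i * suc (suc i) + suc (suc (suc i + suc i))
      ≡ suc (suc i * suc i + suc (suc i + suc i) * 2 + suc i) + 0
    eq = solve-∀
    eq₁ : ∀ a b d m s → d + a + b + (a + b) * m + s ≡ 1 * d + (a + b) * m + s + (a + b)
    eq₁ = solve-∀
    eq₂ : ∀ a b d m s → a * d + (a + b) * m + s + (a + b) ≡ a * (d + m) + (b * m + s) + (a + b)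
    eq₂ = solve-∀

-- Non-existence: cases by the shape of the p-rim

skip-run : ∀ l a R {i j} o → a + o ≡ i → j ≤ part (expand ((l , a) ∷ R)) i → j ≤ part (expand R) o
skip-run l a R o refl le = ≤-trans le (≤-reflexive (part-expandʳ l a R o))

jsRim>0 : ∀ {p R A} → 0 < p → JSRuns p R → JSRim p R A → 0 < A
jsRim>0 _ (jsRuns _ ((0<l , 0<a) ∷ _) _ _) (small e _) = s≤s⁻¹ (subst (2 ≤_) (sym e) (+-mono-≤ 0<l 0<a))
jsRim>0 0<p _ (big _) = 0<p
jsRim>0 0<p _ (pair₀ _) = 0<p
jsRim>0 0<p _ (pair _ _ _ _ _) = ≤-trans 0<p (m≤m+n _ _)
jsRim>0 0<p _ (sing _ _ _) = ≤-trans 0<p (m≤m+n _ _)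

expand>0 : ∀ {p r R} → JSRuns p (r ∷ R) → 0 < length (expand (r ∷ R)) × 0 < sum (expand (r ∷ R))
expand>0 {r = l , suc a} {R} js@(jsRuns _ ((0<l , _) ∷ _) _ _) = z<s , ≤-trans 0<l (m≤m+n l _)
expand>0 {r = l , zero} (jsRuns _ ((_ , ()) ∷ _) _ _)

two-runs≤ : ∀ {c g f l} → 0 < c → 0 < g → 0 < l → f + c + g ≤ c * (f + l) + g * l
two-runs≤ {suc c} {suc g} {f} {suc l} _ _ _ = subst (f + suc c + suc g ≤_) (eq c g f l) (m≤m+n _ _)
  where
  eq : ∀ c g f l → f + suc c + suc g + (c * f + c * l + l + g * l + l) ≡ suc c * (f + suc l) + suc g * suc l
  eq = solve-∀

eps≤1 : ∀ p a → eps p a ≤ 1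
eps≤1 p a with p ∣? a
... | yes _ = z≤n
... | no _ = ≤-refl

length₂ : ∀ l a m b R → length (expand ((l , a) ∷ (m , b) ∷ R)) ≡ a + (b + length (expand R))
length₂ l a m b R = trans (length-run l a ((m , b) ∷ R)) (cong (a +_) (length-run m b R))

length₃ : ∀ l a m b k c R → length (expand ((l , a) ∷ (m , b) ∷ (k , c) ∷ R))
  ≡ a + (b + (c + length (expand R)))
length₃ l a m b k c R = trans (length₂ l a m b ((k , c) ∷ R)) (cong (λ x → a + (b + x)) (length-run k c R))

sum₂ : ∀ l a m b R → sum (expand ((l , a) ∷ (m , b) ∷ R)) ≡ a * l + (b * m + sum (expand R))
sum₂ l a m b R = trans (sum-run l a ((m , b) ∷ R)) (cong (a * l +_) (sum-run m b R))

sum₃ : ∀ l a m b k c R → sum (expand ((l , a) ∷ (m , b) ∷ (k , c) ∷ R))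
  ≡ a * l + (b * m + (c * k + sum (expand R)))
sum₃ l a m b k c R = trans (sum₂ l a m b ((k , c) ∷ R)) (cong (λ x → a * l + (b * m + x)) (sum-run k c R))

module _ (i j p n : ℕ) (j≡ : j ≡ suc i) (p≡ : p ≡ suc (j + j)) (n≡ : n ≡ j * j + p * 2) where

  private
    0<p : 0 < p
    0<p = subst (0 <_) (sym p≡) z<s

    ≤i : ∀ {x} → x < j → x ≤ i
    ≤i {x} lt = s≤s⁻¹ (subst (x <_) j≡ lt)

    full : ∀ {r} → p + p + eps p (p + p) ≡ r + r → r ≡ p
    full {r} e = ≤-antisym (double-≤ (≤-reflexive (sym e′))) (double-≤ (≤-reflexive e′))
      where
      e′ : p + p ≡ r + r
      e′ = trans (sym (+-identityʳ (p + p)))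
        (trans (cong (p + p +_) (sym (eps-∣ (∣m∣n⇒∣m+n (∣-refl {p}) ∣-refl)))) e)

    odd : ∀ r → p + eps p p ≢ r + r
    odd r e = odd≢double j r (trans
      (sym (trans (trans (cong (p +_) (eps-∣ (∣-refl {p}))) (+-identityʳ p)) p≡)) e)

    partial : ∀ {A l a} r → suc A ≡ l + a → A < p → 0 < l → 0 < a → p + A + eps p (p + A) ≡ r + r → p + (l + a)
      ≡ r + r
    partial {A} r e A<p 0<l 0<a c = trans (cong (p +_) (sym e))
      (trans (+-suc p A) (trans (+-comm 1 (p + A)) (trans
      (cong (p + A +_) (sym (eps-∤
        (∤-p+ (∤-between (s≤s⁻¹ (subst (2 ≤_) (sym e) (+-mono-≤ 0<l 0<a))) A<p))))) c)))

    tall : ∀ {A r} → 0 < A → p + (p + A) + eps p (p + (p + A)) ≡ r + r → p < r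
    tall {A} {r} 0<A e with <-≤-connex p r
    ... | inj₁ lt = lt
    ... | inj₂ le = contradiction (≤-trans (≤-reflexive e) (+-mono-≤ le le))
      (<⇒≱ (≤-trans (+-monoʳ-< p (m<m+n p 0<A)) (m≤m+n _ _)))

    wide : ∀ {A l r} → A < l + r → A + eps p A ≡ r + r → r ≤ l
    wide {A} {l} {r} lt e = +-cancelʳ-≤ r r l
      (≤-trans (≤-reflexive (sym e)) (≤-trans (+-monoʳ-≤ A (eps≤1 p A))
        (≤-trans (≤-reflexive (+-comm A 1)) lt)))

    -- At least three segments, the first in a single run. If row `i` lies in that run, `¬sing-wide`
    -- applies; otherwise `¬three-segments` with D = d and Q = a + b.
    sing-tall : ∀ a b d l x r R → d + a + b ≡ x * p → 2 ≤ x → JSRuns p ((d + l , a) ∷ (l , b) ∷ r ∷ R) →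
      sum (expand ((d + l , a) ∷ (l , b) ∷ r ∷ R)) ≡ n → j ≤ part (expand ((d + l , a) ∷ (l , b) ∷ r ∷ R)) i →
      p < length (expand ((d + l , a) ∷ (l , b) ∷ r ∷ R)) →
        length (expand ((d + l , a) ∷ (l , b) ∷ r ∷ R)) ≤ d + l → ⊥
    sing-tall a b d l x r R d≡ 2≤x js@(jsRuns (_ ∷ r<l ∷ _)
      ((_ , 0<a) ∷ _ ∷ (0<r , _) ∷ _) _ _) size corner p<len len≤ = cases (<-≤-connex i a)
      where
      ρ = expand (r ∷ R)
      size′ : a * (d + l) + (b * l + sum ρ) ≡ n
      size′ = trans (sym (sum₂ (d + l) a l b (r ∷ R))) size
      len′ : p < a + (b + length ρ)
      len′ = subst (p <_) (length₂ (d + l) a l b (r ∷ R)) p<len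
      2p≤ : p + p ≤ d + a + b
      2p≤ = subst₂ _≤_ (cong (p +_) (+-identityʳ p)) (sym d≡) (*-monoˡ-≤ p 2≤x)
      cases : i < a ⊎ a ≤ i → ⊥
      cases (inj₁ i<a) = ¬sing-wide i j p n j≡ p≡ n≡ a b d l (sum ρ) i<a (≤-trans (s≤s 0<r) r<l)
        (proj₂ (expand>0 (js-tail (js-tail js)))) (≤-trans p<len len≤) 2p≤ size′
      cases (inj₂ a≤i) with m≤n⇒∃[o]m+o≡n a≤i
      ... | o , ao = ¬three-segments i j p n j≡ p≡ n≡ d (a + b) l ρ (expand-partition _ (JSRuns.decreasing js″)
        (JSRuns.isRun js″))
        (≤-trans 0<a a≤i) (≤-trans (skip-run (d + l) a ((l , b) ∷ r ∷ R) o ao corner)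
          (part-expand≤ (js-tail js) o))
        (≤-trans 2p≤ (≤-reflexive (+-assoc d a b))) (subst (p <_) (sym (+-assoc a b _)) len′)
        (λ g e → skip-run l b (r ∷ R) g refl (skip-run (d + l) a ((l , b) ∷ r ∷ R) (b + g)
          (suc-injective (trans (trans (eq a b g) e) j≡)) corner))
        (≤-trans (≤-reflexive (eq₁ a b d l (sum ρ))) (≤-trans (+-monoˡ-≤ _ (m≤n*m d a ⦃ >-nonZero 0<a ⦄))
          (≤-reflexive (trans (eq₂ a b d l (sum ρ)) size′))))
        where
        js″ = js-tail (js-tail js)
        eq : ∀ a b g → suc (a + (b + g)) ≡ a + b + suc g
        eq = solve-∀
        eq₁ : ∀ a b d l s → d + (a + b) * l + s ≡ d + (a * l + b * l + s)
        eq₁ = solve-∀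
        eq₂ : ∀ a b d l s → a * d + (a * l + b * l + s) ≡ a * (d + l) + (b * l + s)
        eq₂ = solve-∀

    -- At least three segments, the first through two runs. The outcome depends on how the a + b
    -- rows of these runs compare with the side j.
    pair-tall : ∀ a b c d e l x r R → (let R′ = (d + (e + l) , a) ∷ (e + l , b) ∷ (l , c) ∷ r ∷ R) →
      d + a + b ≡ p → 0 < e → e + b + c ≡ x * p → 0 < x → JSRuns p R′ → sum (expand R′) ≡ n →
        j ≤ part (expand R′) i →
      p < length (expand R′) → length (expand R′) ≤ d + (e + l) → p < c * l + sum (expand (r ∷ R)) → ⊥
    pair-tall a b c d e l x r R d≡ 0<e e≡ 0<x js@(jsRuns _
      ((_ , 0<a) ∷ _ ∷ (0<l , _) ∷ _) _ _) size corner p<len len≤ p<s = cases (<-cmp j (a + b))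
      where
      ρ = expand (r ∷ R)
      js‴ = js-tail (js-tail (js-tail js))
      ρ-part : IsPartition ρ
      ρ-part = expand-partition _ (JSRuns.decreasing js‴) (JSRuns.isRun js‴)
      size′ : a * (d + (e + l)) + (b * (e + l) + (c * l + sum ρ)) ≡ n
      size′ = trans (sym (sum₃ (d + (e + l)) a (e + l) b l c (r ∷ R))) size
      len′ : p < a + (b + (c + length ρ))
      len′ = subst (p <_) (length₃ (d + (e + l)) a (e + l) b l c (r ∷ R)) p<len
      cases : Tri (j < a + b) (j ≡ a + b) (a + b < j) → ⊥
      cases (tri< lt _ _) = ¬pair-wide i j p n j≡ p≡ n≡ a b c d (e + l) l (length ρ) (sum ρ) 0<a 0<l lt d≡
        (≤-trans p<len len≤)
        (length≤sum (proj₂ ρ-part)) len′ size′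
      cases (tri≈ _ eq _) = ¬pair-exact i j p n j≡ p≡ n≡ a b d (e + l) (c * l + sum ρ) 0<a eq d≡
        (≤-trans p<len len≤) p<s size′
      cases (tri> _ _ gt) with m≤n⇒∃[o]m+o≡n (≤i gt)
      -- The first two runs have ad + (a + b)e nodes beyond column l, and D = e + 2j is a lower
      -- bound for these. With Q = a + b + c, the congruence e + b + c = xp and p = 2j + 1 ≤ 2j + a
      -- give 2p ≤ D + Q.
      ... | o , abo = ¬three-segments i j p n j≡ p≡ n≡ (e + (j + j)) (a + b + c) l ρ ρ-part
        (≤-trans 0<a (≤-trans (m≤m+n a b) (≤i gt)))
        (≤-trans (skip-run (e + l) b ((l , c) ∷ r ∷ R) o refl
          (skip-run (d + (e + l)) a ((e + l , b) ∷ (l , c) ∷ r ∷ R) (b + o)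
            (trans (sym (+-assoc a b o)) abo) corner)) (part-expand≤ (js-tail (js-tail js)) o))
        h₁ (subst (p <_) (eq₀ a b c (length ρ)) len′)
        (λ g q → skip-run l c (r ∷ R) g refl (skip-run (e + l) b ((l , c) ∷ r ∷ R) (c + g) refl
          (skip-run (d + (e + l)) a ((e + l , b) ∷ (l , c) ∷ r ∷ R) (b + (c + g))
            (suc-injective (trans (trans (eq a b c g) q) j≡)) corner)))
        (≤-trans (≤-reflexive (+-assoc (e + (j + j)) ((a + b + c) * l) (sum ρ)))
          (≤-trans (+-monoˡ-≤ _ h₂) (≤-reflexive (trans (eq₂ a b c d e l (sum ρ)) size′))))
        where
        eq₀ : ∀ a b c s → a + (b + (c + s)) ≡ a + b + c + s
        eq₀ = solve-∀
        eq : ∀ a b c g → suc (a + (b + (c + g))) ≡ a + b + c + suc g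
        eq = solve-∀
        eq₂ : ∀ a b c d e l s → a * d + (a + b) * e + ((a + b + c) * l + s)
          ≡ a * (d + (e + l)) + (b * (e + l) + (c * l + s))
        eq₂ = solve-∀
        h₁ : p + p ≤ e + (j + j) + (a + b + c)
        h₁ = begin
          p + p                       ≡⟨ cong₂ _+_ (sym (+-identityʳ p)) p≡ ⟩
          1 * p + suc (j + j)         ≤⟨ +-mono-≤ (*-monoˡ-≤ p 0<x) (+-monoˡ-≤ (j + j) 0<a) ⟩
          x * p + (a + (j + j))       ≡⟨ cong (_+ (a + (j + j))) e≡ ⟨
          e + b + c + (a + (j + j))   ≡⟨ eq₃ a b c e (j + j) ⟩
          e + (j + j) + (a + b + c)   ∎
          where
          open ≤-Reasoning
          eq₃ : ∀ a b c e j → e + b + c + (a + j) ≡ e + j + (a + b + c)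
          eq₃ = solve-∀
        h₂ : e + (j + j) ≤ a * d + (a + b) * e
        h₂ = bound a e 0<a 0<e (trans (sym p≡) (trans (sym d≡) (eq₄ a b d)))
          where
          eq₄ : ∀ a b d → d + a + b ≡ a + b + d
          eq₄ = solve-∀
          bound : ∀ a e → 0 < a → 0 < e → {k : ℕ} → suc k ≡ a + b + d → e + k ≤ a * d + (a + b) * e
          bound (suc a) (suc e) _ _ refl = subst (suc e + (a + b + d) ≤_) (eq₅ a b d e) (m≤m+n _ _)
            where
            eq₅ : ∀ a b d e → suc e + (a + b + d) + (a * d + (a + b) * e) ≡ suc a * d + (suc a + b) * suc e
            eq₅ = solve-∀

  no-fixed-JS : ∀ R → JSRuns p R → sum (expand R) ≡ n → j ≤ part (expand R) i → IsMullineuxFixed p (expand R) →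
    ⊥
  no-fixed-JS [] _ _ corner _ = contradiction (≤-trans (subst (0 <_) (sym j≡) z<s) corner) λ ()
  no-fixed-JS (r ∷ R) js size corner fix with jsRim js
  ... | A , rim with jsRim⇒pRim rim js
  ...   | ws , r′ = go rim js size corner (fixed-column fix r′)
    where
    go : ∀ {R A} → JSRim p R A → JSRuns p R → sum (expand R) ≡ n → j ≤ part (expand R) i →
      A + eps p A ≡ length (expand R) + length (expand R) → ⊥
    go (small {l} {a} {A} e A<p) _ size _ _ =
      ¬short-run i j p n j≡ p≡ n≡ a l (subst (_≤ p) e A<p) (trans (sym (sum-run l a [])) size)
    go (big {l} {a} _) _ _ _ col = odd (length (expand ((l , a) ∷ []))) col
    go (pair₀ {d} {l} {a} {b} _) _ _ _ col = odd (length (expand ((d + l , a) ∷ (l , b) ∷ []))) col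
    go (sing {d} {l} {a} {b} {x} d≡ _ (big _)) _ size _ col = p∤n i j p n j≡ p≡ n≡
      (subst (p ∣_) (trans (sym (sum₂ (d + l) a l b [])) size)
        (∣-sing-big a b d l x (trans (sym (length₂ (d + l) a l b [])) (full col)) d≡))
    go (sing {d} {a = a} {x = x} d≡ _ (pair₀ {e} {l} {b} {c} e≡)) _ size _ col = p∤n i j p n j≡ p≡ n≡
      (subst (p ∣_) (trans (sym (sum₃ (d + (e + l)) a (e + l) b l c [])) size)
        (∣-sing-pair a b c d e l x (trans (sym (length₃ (d + (e + l)) a (e + l) b l c [])) (full col)) d≡ e≡))
    go (sing {d} {l} {a} {b} d≡ 2≤x (small {A = A} e A<p)) js@(jsRuns _
      ((_ , 0<a) ∷ (0<l , 0<b) ∷ _) _ _) size corner col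
      with m≤n⇒∃[o]m+o≡n 2≤x | m≤n⇒∃[o]m+o≡n l≤a
      where
      parts : p + (l + b) ≡ a + (b + 0) + (a + (b + 0))
      parts = subst (λ r → p + (l + b) ≡ r + r) (length₂ (d + l) a l b [])
        (partial (length (expand ((d + l , a) ∷ (l , b) ∷ []))) e A<p 0<l 0<b col)
      -- 2(a + b) = p + (l + b) ≥ 2(l + b), which permits the substitution a = l + g.
      l≤a : l ≤ a
      l≤a = +-cancelʳ-≤ b l a (≤-trans
        (double-≤ (≤-trans (+-monoˡ-≤ (l + b) (subst (_≤ p) e A<p)) (≤-reflexive parts)))
          (≤-reflexive (cong (a +_) (+-identityʳ b))))
    ... | y , refl | g , refl = ¬sing-small i j p n j≡ p≡ n≡ l g y 0<l (tops (<-≤-connex i (l + g)))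
        (trans (sym (size-sing-small b d l g y (subst (λ r → p + (l + b) ≡ r + r)
          (length₂ (d + l) (l + g) l b [])
            (partial (length (expand ((d + l , l + g) ∷ (l , b) ∷ []))) e A<p 0<l 0<b col)) d≡))
               (trans (sym (sum₂ (d + l) (l + g) l b [])) size))
      where
      tops : i < l + g ⊎ l + g ≤ i → j ≤ l + g
      tops (inj₁ lt) = subst (_≤ l + g) (sym j≡) lt
      -- If row `i` is in the second run, then j ≤ l, and l ≤ a gives the bound all the same.
      tops (inj₂ le) with m≤n⇒∃[o]m+o≡n le
      ... | o , q = ≤-trans (≤-trans (skip-run (d + l) (l + g) ((l , b) ∷ []) o q corner)
        (part-expand≤ (js-tail js) o)) (m≤m+n l g)
    go (sing {d} {a = a} {x = x} d≡ 2≤x inner@(sing {e} {l} {b} {c} {R = R} _ _ rim)) js size corner col =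
      sing-tall a b d (e + l) x (l , c) R d≡ 2≤x js size corner
        (tall (jsRim>0 0<p (js-tail (js-tail js)) rim) col) (wide (jsRim< js (sing {x = x} d≡ 2≤x inner)) col)
    go (sing {d} {a = a} {x = x} d≡ 2≤x inner@(pair {e} {l} {b} {c} {f} {g} {R = R} _ _ _ _ rim)) js size corner col =
      sing-tall a b d (e + (f + l)) x (f + l , c) ((l , g) ∷ R) d≡ 2≤x js size corner
        (tall (jsRim>0 0<p (js-tail (js-tail (js-tail js))) rim) col)
          (wide (jsRim< js (sing {x = x} d≡ 2≤x inner)) col)
    go (pair {d} {l} {a} {b} {e} {c} {x} d≡ _ e≡ _ (big _)) _ size _ col = p∤n i j p n j≡ p≡ n≡
      (subst (p ∣_) (trans (sym (sum₃ (d + (e + l)) a (e + l) b l c [])) size)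
        (∣-pair-big a b c d e l x (trans (sym (length₃ (d + (e + l)) a (e + l) b l c [])) (full col)) d≡ e≡))
    go (pair {d} {a = a} {b} {e} {x = x} d≡ _ e≡ _
      (pair₀ {f} {l} {c} {g} f≡)) _ size _ col = p∤n i j p n j≡ p≡ n≡
      (subst (p ∣_) (trans (sym (trans (sum₃ L₁ a L₂ b (f + l) c ((l , g) ∷ []))
        (cong (λ z → a * L₁ + (b * L₂ + (c * (f + l) + z))) (sum-run l g [])))) size)
        (∣-pair-pair a b c g d e f l x
          (trans (sym (trans (length₃ L₁ a L₂ b (f + l) c ((l , g) ∷ []))
            (cong (λ z → a + (b + (c + z))) (length-run l g [])))) (full col)) d≡ e≡ f≡))
      where
      L₁ = d + (e + (f + l))
      L₂ = e + (f + l)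
    go (pair {d} {l} {a} {b} {e} {c} d≡ _ e≡ 0<x (small {A = A} q A<p)) js@(jsRuns _
      ((_ , 0<a) ∷ _ ∷ (0<l , 0<c) ∷ _) _ _) size corner col
      with m≤n⇒∃[o]m+o≡n 0<x
    ... | y , refl = ¬pair-small i j p n j≡ p≡ n≡ a b c l y 0<a 0<c 0<l (tops (<-≤-connex i (a + b))) parts
        (trans (sym (size-pair-small a b c d e l y parts d≡ e≡))
          (trans (sym (sum₃ (d + (e + l)) a (e + l) b l c [])) size))
      where
      parts : p + (l + c) ≡ a + (b + (c + 0)) + (a + (b + (c + 0)))
      parts = subst (λ r → p + (l + c) ≡ r + r) (length₃ (d + (e + l)) a (e + l) b l c [])
        (partial (length (expand ((d + (e + l) , a) ∷ (e + l , b) ∷ (l , c) ∷ []))) q A<p 0<l 0<c col)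
      eq : ∀ a b c → a + (b + (c + 0)) ≡ a + b + c
      eq = solve-∀
      l≤ : l ≤ a + b
      l≤ = +-cancelʳ-≤ c l (a + b)
        (≤-trans (double-≤ (≤-trans (+-monoˡ-≤ (l + c) (subst (_≤ p) q A<p)) (≤-reflexive parts)))
          (≤-reflexive (eq a b c)))
      tops : i < a + b ⊎ a + b ≤ i → j ≤ a + b
      tops (inj₁ lt) = subst (_≤ a + b) (sym j≡) lt
      tops (inj₂ le) with m≤n⇒∃[o]m+o≡n le
      ... | o , abo = ≤-trans (≤-trans (skip-run (e + l) b ((l , c) ∷ []) o refl
        (skip-run (d + (e + l)) a ((e + l , b) ∷ (l , c) ∷ []) (b + o)
          (trans (sym (+-assoc a b o)) abo) corner))
                                       (part-expand≤ (js-tail (js-tail js)) o)) l≤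
    go (pair {d} {a = a} {b} {e} {x = x} d≡ 0<e e≡ 0<x inner@(sing {f} {l} {c} {g} {y} {R} f≡ 2≤y rim)) js@(jsRuns _ (_ ∷ _ ∷ (_ , 0<c) ∷ (0<l , 0<g) ∷ _) _ _) size corner col =
      pair-tall a b c d e (f + l) x (l , g) R d≡ 0<e e≡ 0<x js size corner
        (tall (jsRim>0 0<p (js-tail (js-tail (js-tail js))) rim) col)
          (wide (jsRim< js (pair {x = x} d≡ 0<e e≡ 0<x inner)) col)
        -- The third and fourth runs alone have more than p nodes, as their congruence has quotient
        -- y ≥ 2.
        (begin-strict
          p                            <⟨ m<m+n p 0<p ⟩
          p + p                        ≡⟨ cong (p +_) (+-identityʳ p) ⟨
          2 * p                        ≤⟨ *-monoˡ-≤ p 2≤y ⟩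
          y * p                        ≡⟨ f≡ ⟨
          f + c + g                    ≤⟨ two-runs≤ {c} {g} {f} {l} 0<c 0<g 0<l ⟩
          c * (f + l) + g * l          ≤⟨ +-monoʳ-≤ (c * (f + l)) (m≤m+n (g * l) _) ⟩
          c * (f + l) + (g * l + sum (expand R)) ≡⟨ cong (c * (f + l) +_) (sum-run l g R) ⟨
          c * (f + l) + sum (expand ((l , g) ∷ R)) ∎)
      where open ≤-Reasoning
    go (pair {d} {a = a} {b} {e} {x = x} d≡ 0<e e≡ 0<x inner@(pair {f} {l} {c} {g} {h} {k} {R = R} f≡ _ _ _ rim)) js@(jsRuns _ (_ ∷ _ ∷ (_ , 0<c) ∷ (0<m , 0<g) ∷ _) _ _) size corner col =
      pair-tall a b c d e (f + m) x (m , g) ((l , k) ∷ R) d≡ 0<e e≡ 0<x js size corner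
        (tall (jsRim>0 0<p (js-tail (js-tail (js-tail (js-tail js)))) rim) col)
          (wide (jsRim< js (pair {x = x} d≡ 0<e e≡ 0<x inner)) col)
        -- The third and fourth runs guarantee only p nodes here, but a fifth run follows.
        (begin-strict
          p                            ≡⟨ f≡ ⟨
          f + c + g                    ≤⟨ two-runs≤ {c} {g} {f} {m} 0<c 0<g 0<m ⟩
          c * (f + m) + g * m          <⟨ +-monoʳ-< (c * (f + m))
            (m<m+n (g * m) (proj₂ (expand>0 (js-tail (js-tail (js-tail (js-tail js))))))) ⟩
          c * (f + m) + (g * m + sum (expand ((l , k) ∷ R))) ≡⟨ cong (c * (f + m) +_)
            (sum-run m g ((l , k) ∷ R)) ⟨
          c * (f + m) + sum (expand ((m , g) ∷ (l , k) ∷ R)) ∎)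
      where
      open ≤-Reasoning
      m = h + l

non-existence : ∀ {p w mu} → 2 < p → Exceptional p w mu → ¬ Σ (List ℕ) (GoodPartition p w mu)
-- j = 0 would mean p = 1.
non-existence 2<p (_ , zero , refl , _) _ = contradiction 2<p λ { (s≤s ()) }
non-existence {p} _ (refl , suc i , p≡ , refl) (la , la-part , ((_ , reg) , js) , fix ,
  (chain , _) , weight) with runs-spec la la-part
... | la≡ , dec , run = no-fixed-JS i j p (j * j + p * 2) refl p≡′ refl (runs la) (jsRuns dec run reg js)
    (trans (cong sum la≡) (trans weight (cong (_+ p * 2) (sum-replicate j j))))
    -- Removing hooks never lengthens a row, so row `i` is at least as long as in the square.
    (subst (λ xs → j ≤ part xs i) (sym la≡) (≤-trans (≤-reflexive (sym (part-replicate j (n<1+n i))))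
      (part-chain≤ chain i)))
    (subst (IsMullineuxFixed p) (sym la≡) fix)
  where
  j = suc i
  p≡′ : p ≡ suc (j + j)
  p≡′ = trans (sym p≡) (eq i)
    where
    eq : ∀ i → 2 * suc i + 1 ≡ suc (suc i + suc i)
    eq = solve-∀

theorem4p3 : (p : ℕ) → 2 < p → (w : ℕ) → 2 ∣ w → (mu : List ℕ) → IsPCore p mu →
    (mu ≡ [] ⊎ Σ ℕ (λ j → (1 ≤ j) × (mu ≡ square j))) →
    ((¬ Exceptional p w mu → Σ (List ℕ) (λ la → GoodPartition p w mu la)) ×
    (Exceptional p w mu → ¬ Σ (List ℕ) (λ la → GoodPartition p w mu la)))
-- The empty core is the square of side 0.
theorem4p3 (suc P) 2<p@(s≤s 2≤P) w (divides c refl) mu core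
  (inj₁ refl) = existence P c 0 2≤P core , non-existence 2<p
theorem4p3 (suc P) 2<p@(s≤s 2≤P) w (divides c refl) mu core
  (inj₂ (j , _ , refl)) = existence P c j 2≤P core , non-existence 2<p
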